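{- Let $(R(m,d))_{m,d\in\mathbb{N}}$ be a family of ordered graphs with the properties described in the context. Then for every ordered graph $F$, \[ \rho_{<}(F) = \lim_{d \to \infty} \lim_{m \to \infty} \rho_{<}(F, R(m, d)). \]
   Context: An ordered graph is a graph whose vertex set carries a total order. An ordered graph $G$ contains (an ordered copy of) an ordered graph $F$ if there is an injective order-preserving map $V(F)\to V(G)$ sending edges of $F$ to edges of $G$; otherwise $G$ is $F$-free. For ordered graphs $F$ and $G$ (with $e(G)>0$), $\rho_{<}(F,G)=\max\{e(G')/e(G) : G'\subseteq G,\ G' \text{ is } F\text{ -free}\}$, and the relative Turán density is $\rho_{<}(F)=\inf_G \rho_{<}(F,G)$ over all ordered graphs $G$. For distinct $x,y\in\{0,1\}^d$ let $\delta(x,y)=\min\{i : x_i\neq y_i\}$; $\{0,1\}^d$ is ordered lexicographically ($x<y$ iff $x_{\delta(x,y)}=0$). The set $\{0,1\}^d\times[m]$ is ordered lexicographically: $(x,i)<(y,j)$ iff $x<y$, or $x=y$ and $i<j$. Blocks are $B_x=\{x\}\times[m]$. An edge between $B_x$ and $B_y$ with $\delta(x,y)=\ell$ is a level-$\ell$ edge, and $e_\ell(G)$ is the number of level-$\ell$ edges of $G$. The family $R(m,d)$ (ordered graph on $\{0,1\}^d\times[m]$) satisfies: for every $d\in\mathbb{N}$ and $\varepsilon>0$, for all sufficiently large $m$, (i) for every $\ell\in[d]$, $(1-\varepsilon)2^{d-1}m^2\le e_\ell(R(m,d))\le(1+\varepsilon)2^{d-1}m^2$, and $(1-\varepsilon)d2^{d-1}m^2\le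 e(R(m,d))\le(1+\varepsilon)d2^{d-1}m^2$; (ii) for all distinct $x,y\in\{0,1\}^d$ and all $P\subseteq B_x$, $Q\subseteq B_y$ with $|P|,|Q|\ge m^{2/3}$, the number of edges of $R(m,d)$ between $P$ and $Q$ is at most $(1+\varepsilon)2^{ -d+\delta(x,y)}|P||Q|$. (Such a family exists, e.g. from a suitable sample of the random graph in which $(x,i)(y,j)$ is an edge independently with probability $2^{ -d+\delta(x,y)}$.) -}

module Defs where

open import Axiom.ExcludedMiddle using (ExcludedMiddle)
open import Data.Bool.Base using (Bool; true; false; T; if_then_else_)
open import Data.Bool.Properties using (T?)
open import Data.Empty using (⊥)
open import Data.Fin.Base as Fin using (Fin; zero; suc; combine; quotient; remainder; finToFun)
import Data.Fin.Properties as Fin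
open import Data.Fin.Subset using (Subset; _∈_; _⊆_; ∣_∣)
open import Data.Fin.Subset.Properties using (_∈?_)
import Data.Integer.Base as ℤ
open import Data.List.Base using (List; length; filter; allFin; cartesianProduct)
open import Data.Nat.Base as ℕ using (ℕ; zero; suc; _^_; _∸_)
import Data.Nat.Properties as ℕ
open import Data.Product using (Σ; ∃; ∃-syntax; _×_; _,_; proj₁; proj₂)
open import Data.Rational.Base as ℚ using (ℚ; 0ℚ; 1ℚ; _<_; _≤_; _+_; _-_; _*_; -_)
import Data.Rational.Properties as ℚ
open import Data.Sum.Base using (_⊎_; inj₁; inj₂)
open import Data.Unit.Base using (tt)
open import Data.Vec.Base as Vec using (Vec; []; _∷_; tabulate)
open import Data.Vec.Properties using (≡-dec)
open import Function.Definitions using (Injective)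
open import Level using (0ℓ)
open import Relation.Binary.Core using (_Preserves_⟶_)
open import Relation.Binary.Definitions using (tri<; tri≈; tri>)
open import Relation.Binary.PropositionalEquality
open import Relation.Nullary using (Dec; yes; no; does; ¬_)
open import Relation.Nullary.Decidable using (_×-dec_)
open import Relation.Unary using (Decidable)

------------------------------------------------------------------------
-- Real numbers: Dedekind cuts of ℚ

record ℝ : Set₁ where
  field
    -- lower q means q < x and upper q means x < q, for the real x in question.
    lower upper : ℚ → Set
    lower-inhabited : ∃ lower
    upper-inhabited : ∃ upper
    lower-down : ∀ {q r} → q < r → lower r → lower q
    upper-up   : ∀ {q r} → q < r → upper q → upper r
    lower-open : ∀ {q} → lower q → ∃[ r ] q < r × lower r
    upper-open : ∀ {r} → upper r → ∃[ q ] q < r × upper q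
    disjoint   : ∀ {q} → lower q → upper q → ⊥
    located    : ∀ {q r} → q < r → lower q ⊎ upper r

private
  q-1<q : ∀ q → q - 1ℚ < q
  q-1<q q = subst (q - 1ℚ <_) (ℚ.+-identityʳ q) (ℚ.+-monoʳ-< q (ℚ.negative⁻¹ (- 1ℚ)))

  q<q+1 : ∀ q → q < q + 1ℚ
  q<q+1 q = subst (_< q + 1ℚ) (ℚ.+-identityʳ q) (ℚ.+-monoʳ-< q (ℚ.positive⁻¹ 1ℚ))

fromℚ : ℚ → ℝ
fromℚ p = record
  { lower = _< p
  ; upper = p <_
  ; lower-inhabited = p - 1ℚ , q-1<q p
  ; upper-inhabited = p + 1ℚ , q<q+1 p
  ; lower-down = ℚ.<-trans
  ; upper-up = λ q<r p<q → ℚ.<-trans p<q q<r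
  ; lower-open = λ q<p → let r , q<r , r<p = ℚ.<-dense q<p in r , q<r , r<p
  ; upper-open = λ p<r → let q , p<q , q<r = ℚ.<-dense p<r in q , q<r , p<q
  ; disjoint = ℚ.<-asym
  ; located = loc
  }
  where
  loc : ∀ {q r} → q < r → q < p ⊎ p < r
  loc {q} q<r with q ℚ.<? p
  ... | yes q<p = inj₁ q<p
  ... | no  q≮p = inj₂ (ℚ.≤-<-trans (ℚ.≮⇒≥ q≮p) q<r)

-- The infimum of a nonempty family of rationals that is bounded below.
inf : ExcludedMiddle 0ℓ → {I : Set} (f : I → ℚ) → I → (b : ℚ) → (∀ i → b ≤ f i) → ℝ
inf em f i₀ b b≤f = record
  { lower = λ q → ∃[ r ] q < r × (∀ i → r ≤ f i)
  ; upper = λ q → ∃[ i ] f i < q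
  ; lower-inhabited = b - 1ℚ , b , q-1<q b , b≤f
  ; upper-inhabited = f i₀ + 1ℚ , i₀ , q<q+1 (f i₀)
  ; lower-down = λ { q<r (s , r<s , s≤f) → s , ℚ.<-trans q<r r<s , s≤f }
  ; upper-up = λ { q<r (i , fi<q) → i , ℚ.<-trans fi<q q<r }
  ; lower-open = λ { (s , q<s , s≤f) →
      let r , q<r , r<s = ℚ.<-dense q<s in r , q<r , s , r<s , s≤f }
  ; upper-open = λ { (i , fi<r) →
      let q , fi<q , q<r = ℚ.<-dense fi<r in q , q<r , i , fi<q }
  ; disjoint = λ { (r , q<r , r≤f) (i , fi<q) →
      ℚ.<-irrefl refl (ℚ.<-trans q<r (ℚ.≤-<-trans (r≤f i) fi<q)) }
  ; located = loc
  }
  where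
  loc : ∀ {q r} → q < r → (∃[ s ] q < s × (∀ i → s ≤ f i)) ⊎ (∃[ i ] f i < r)
  loc {q} {r} q<r with em {∃[ i ] f i < r}
  ... | yes u = inj₂ u
  ... | no ¬u = inj₁ (r , q<r , λ i → ℚ.≮⇒≥ λ fi<r → ¬u (i , fi<r))

-- x < y + ε
_<_⊕_ : ℝ → ℝ → ℚ → Set
x < y ⊕ ε = ∃[ q ] ℝ.upper x q × ℝ.lower y (q - ε)

-- lim aₙ = x, where |aₙ - x| < ε is spelled out as aₙ < x + ε and x < aₙ + ε.
_⟶_ : (ℕ → ℝ) → ℝ → Set
a ⟶ x = ∀ ε → 0ℚ < ε → ∃[ N ] ∀ n → N ℕ.≤ n → (a n < x ⊕ ε) × (x < a n ⊕ ε)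

------------------------------------------------------------------------
-- Ordered graphs

-- A finite totally ordered set is uniquely isomorphic to some Fin n, so
-- ordered graphs on n vertices are simple graphs on Fin n with its usual order.
record OrderedGraph (n : ℕ) : Set where
  field
    adj    : Fin n → Fin n → Bool
    symm   : ∀ {u v} → T (adj u v) → T (adj v u)
    irrefl : ∀ {v} → ¬ T (adj v v)

open OrderedGraph public using (adj)

pairs : ∀ n → List (Fin n × Fin n)
pairs n = cartesianProduct (allFin n) (allFin n)

edge? : ∀ {n} (G : OrderedGraph n) →
        Decidable {A = Fin n × Fin n} (λ (u , v) → u Fin.< v × T (adj G u v))
edge? G (u , v) = (u Fin.<? v) ×-dec T? (adj G u v)

e : ∀ {n} → OrderedGraph n → ℕ
e {n} G = length (filter (edge? G) (pairs n))

-- For disjoint P and Q this is the number of edges between P and Q.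
eBetween : ∀ {n} → OrderedGraph n → Subset n → Subset n → ℕ
eBetween {n} G P Q =
  length (filter (λ (u , v) → (u ∈? P) ×-dec (v ∈? Q) ×-dec T? (adj G u v)) (pairs n))

infix 4 _⊑_

-- F ⊑ G: G contains an ordered copy of F.
record _⊑_ {k n} (F : OrderedGraph k) (G : OrderedGraph n) : Set where
  field
    map       : Fin k → Fin n
    injective : Injective _≡_ _≡_ map
    monotone  : map Preserves Fin._≤_ ⟶ Fin._≤_
    edges     : ∀ {u v} → T (adj F u v) → T (adj G (map u) (map v))

-- Some F-free G′ ⊆ G has j edges.  Since vertex sets are always initial
-- segments Fin n′, a subgraph of G (on any subset of the vertices) is, after
-- relabelling its vertices in order, the same as an ordered graph G′ with G′ ⊑ G.
FreeSubgraph : ∀ {k n} → OrderedGraph k → OrderedGraph n → ℕ → Set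
FreeSubgraph F G j =
  ∃[ n′ ] Σ (OrderedGraph n′) λ G′ → G′ ⊑ G × ¬ (F ⊑ G′) × e G′ ≡ j

-- max {j ≤ n : P j}, or 0 if there is no such j.
maxUpTo : {P : ℕ → Set} → Decidable P → ℕ → ℕ
maxUpTo P? zero    = 0
maxUpTo P? (suc n) = if does (P? (suc n)) then suc n else maxUpTo P? n

-- Division of natural numbers in ℚ, with k ÷ 0 = 0.
_÷_ : ℕ → ℕ → ℚ
k ÷ zero  = 0ℚ
k ÷ suc n = (ℤ.+ k) ℚ./ suc n

0≤÷ : ∀ k n → 0ℚ ≤ k ÷ n
0≤÷ k zero    = ℚ.≤-refl
0≤÷ k (suc n) = ℚ.nonNegative⁻¹ (k ÷ suc n) ⦃ ℚ.normalize-nonNeg k (suc n) ⦄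

-- Excluded middle is used to take the maximum of a set given by a mere
-- predicate, and to form the infimum.
module _ (em : ExcludedMiddle 0ℓ) where

  -- ρ_<(F, G), with value 0 if e(G) = 0 (or if F has no vertices, in which case
  -- no graph is F-free).  The bound e G is no restriction: e G′ ≤ e G for G′ ⊑ G.
  relDensity : ∀ {k n} → OrderedGraph k → OrderedGraph n → ℚ
  relDensity F G = maxUpTo {FreeSubgraph F G} (λ _ → em) (e G) ÷ e G

  GraphWithEdge : Set
  GraphWithEdge = ∃[ n ] Σ (OrderedGraph n) λ G → 0 ℕ.< e G

  private
    edgeGraph : GraphWithEdge
    edgeGraph = 2 , record { adj = a ; symm = s ; irrefl = i } , ℕ.s≤s ℕ.z≤n
      where
      a : Fin 2 → Fin 2 → Bool
      a zero       zero       = false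
      a zero       (suc zero) = true
      a (suc zero) zero       = true
      a (suc zero) (suc zero) = false
      s : ∀ {u v} → T (a u v) → T (a v u)
      s {zero}     {suc zero} _ = tt
      s {suc zero} {zero}     _ = tt
      s {suc zero} {suc zero} ()
      i : ∀ {v} → ¬ T (a v v)
      i {zero}     ()
      i {suc zero} ()

  -- ρ_<(F)
  relTuránDensity : ∀ {k} → OrderedGraph k → ℝ
  relTuránDensity F =
    inf em {GraphWithEdge} (λ (_ , G , _) → relDensity F G) edgeGraph 0ℚ
        (λ (_ , G , _) → 0≤÷ _ (e G))

------------------------------------------------------------------------
-- The vertex set {0,1}^d × [m]

-- It is encoded as Fin (2 ^ d * m): the vertex (x , i) is combine k i, where k
-- is the number with binary digits x (most significant first).  By <-lex
-- below, the order on Fin (2 ^ d * m) is the lexicographic order.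
digits : ∀ d → Fin (2 ^ d) → Vec (Fin 2) d
digits d k = tabulate (finToFun k)

module _ (d m : ℕ) where

  Vertex : Set
  Vertex = Fin (2 ^ d ℕ.* m)

  word : Vertex → Vec (Fin 2) d
  word u = digits d (quotient m u)

  position : Vertex → Fin m
  position u = remainder {2 ^ d} m u

  block : Vec (Fin 2) d → Subset (2 ^ d ℕ.* m)
  block x = tabulate (λ u → does (≡-dec Fin._≟_ (word u) x))

-- The least i ∈ {1,…,d} with xᵢ ≠ yᵢ (and d + 1 if x = y).
δ : ∀ {d} → Vec (Fin 2) d → Vec (Fin 2) d → ℕ
δ []      []      = 1
δ (a ∷ x) (b ∷ y) = if does (a Fin.≟ b) then suc (δ x y) else 1

level : ∀ d m → OrderedGraph (2 ^ d ℕ.* m) → ℕ → ℕ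
level d m G ℓ =
  length (filter (λ (u , v) → edge? G (u , v) ×-dec (δ (word d m u) (word d m v) ℕ.≟ ℓ))
                 (pairs (2 ^ d ℕ.* m)))

-- x < y in {0,1}^d: at the first coordinate i where they differ, xᵢ = 0.
_<ʷ_ : ∀ {d} → Vec (Fin 2) d → Vec (Fin 2) d → Set
x <ʷ y = ∃[ i ] Vec.lookup x i ≡ zero × Vec.lookup y i ≡ suc zero ×
                (∀ j → j Fin.< i → Vec.lookup x j ≡ Vec.lookup y j)

private
  split-< : ∀ {a} b (k l : Fin (a ℕ.* b)) → k Fin.< l →
            quotient b k Fin.< quotient b l ⊎
            (quotient b k ≡ quotient b l × remainder {a} b k Fin.< remainder {a} b l)
  split-< {a} b k l k<l with Fin.<-cmp (quotient b k) (quotient b l)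
  ... | tri< q<q _ _ = inj₁ q<q
  ... | tri≈ _ q≡q _ = inj₂ (q≡q , ℕ.+-cancelˡ-< (b ℕ.* Fin.toℕ (quotient {a} b k)) _ _
          (subst₂ ℕ._<_ (eq k)
            (trans (eq l) (cong (λ q → b ℕ.* Fin.toℕ q ℕ.+ Fin.toℕ (remainder {a} b l)) (sym q≡q)))
            k<l))
    where
    eq : ∀ k → Fin.toℕ k ≡ b ℕ.* Fin.toℕ (quotient {a} b k) ℕ.+ Fin.toℕ (remainder {a} b k)
    eq k = trans (cong Fin.toℕ (sym (Fin.combine-remQuot {a} b k)))
                 (Fin.toℕ-combine (quotient {a} b k) (remainder {a} b k))
  ... | tri> _ _ q>q with () ← ℕ.<-asym k<l
          (subst₂ Fin._<_ (Fin.combine-remQuot {a} b l) (Fin.combine-remQuot {a} b k)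
            (Fin.combine-monoˡ-< (remainder {a} b l) (remainder {a} b k) q>q))

  word-< : ∀ d (k l : Fin (2 ^ d)) → k Fin.< l → digits d k <ʷ digits d l
  word-< zero    zero zero ()
  word-< (suc d) k    l    k<l with split-< {2} (2 ^ d) k l k<l
  ... | inj₁ q<q = zero , proj₁ (bits _ _ q<q) , proj₂ (bits _ _ q<q) , λ _ ()
    where
    bits : (a b : Fin 2) → a Fin.< b → a ≡ zero × b ≡ suc zero
    bits zero       (suc zero) _ = refl , refl
    bits (suc zero) (suc zero) (ℕ.s≤s ())
  ... | inj₂ (q≡q , r<r) with word-< d _ _ r<r
  ...   | i , xᵢ≡0 , yᵢ≡1 , agree = suc i , xᵢ≡0 , yᵢ≡1 , agree′
    where
    agree′ : ∀ j → j Fin.< suc i →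
             Vec.lookup (digits (suc d) k) j ≡ Vec.lookup (digits (suc d) l) j
    agree′ zero    _         = q≡q
    agree′ (suc j) (ℕ.s<s j<i) = agree j j<i

-- Both sides are strict total orders, so this implication determines the order.
<-lex : ∀ d m (u v : Vertex d m) → u Fin.< v →
        word d m u <ʷ word d m v ⊎
        (word d m u ≡ word d m v × position d m u Fin.< position d m v)
<-lex d m u v u<v with split-< {2 ^ d} m u v u<v
... | inj₁ q<q         = inj₁ (word-< d _ _ q<q)
... | inj₂ (q≡q , r<r) = inj₂ (cong (digits d) q≡q , r<r)

------------------------------------------------------------------------
-- The family R(m,d)

ℕ→ℚ : ℕ → ℚ
ℕ→ℚ n = n ÷ 1

_≈[_]_ : ℕ → ℚ → ℕ → Set
k ≈[ ε ] n = ((1ℚ - ε) * ℕ→ℚ n ≤ ℕ→ℚ k) × (ℕ→ℚ k ≤ (1ℚ + ε) * ℕ→ℚ n)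

-- In upper-density, m ^ 2 ≤ ∣ P ∣ ^ 3 says |P| ≥ m^(2/3), and 1 ÷ 2 ^ (d ∸ δ x y)
-- is 2^(-d+δ(x,y)), as δ x y ≤ d for x ≢ y.
record Conditions (m d : ℕ) (ε : ℚ) (G : OrderedGraph (2 ^ d ℕ.* m)) : Set where
  field
    level-size : ∀ ℓ → 1 ℕ.≤ ℓ → ℓ ℕ.≤ d → level d m G ℓ ≈[ ε ] (2 ^ (d ∸ 1) ℕ.* m ^ 2)
    size : e G ≈[ ε ] (d ℕ.* 2 ^ (d ∸ 1) ℕ.* m ^ 2)
    upper-density :
      ∀ x y → x ≢ y → ∀ P Q → P ⊆ block d m x → Q ⊆ block d m y →
      m ^ 2 ℕ.≤ ∣ P ∣ ^ 3 → m ^ 2 ℕ.≤ ∣ Q ∣ ^ 3 →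
      ℕ→ℚ (eBetween G P Q) ≤ (1ℚ + ε) * (1 ÷ (2 ^ (d ∸ δ x y))) * ℕ→ℚ (∣ P ∣ ℕ.* ∣ Q ∣)

IsRFamily : ((m d : ℕ) → OrderedGraph (2 ^ d ℕ.* m)) → Set
IsRFamily R = ∀ d → 1 ℕ.≤ d → ∀ ε → 0ℚ < ε →
  ∃[ M ] ∀ m → M ℕ.≤ m → Conditions m d ε (R m d)

{-# OPTIONS --safe #-}
-- Every copy of G in R(m,d) contains at most ρ(F,G) e(G) edges of an F-free H ⊆ R(m,d), so it suffices to
-- average over copies of G in which every edge of G is (nearly) a uniformly random edge of R(m,d).
--
-- Once the vertices of G are assigned to blocks, the level sizes force the upper density condition to be tight,
-- so R(m,d) is quasirandom between blocks (also from below) and a telescoping product shows that each edge of a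
-- random transversal copy of G is nearly uniform between its two blocks. Hence only the assignment of blocks matters.
--
-- For the limit in d the blocks form a comb: v₁ < … < vₙ, where vᵢ leaves the common branch of its successors at a
-- random position in the i-th of n consecutive runs of K positions, and the start of the runs is random too. So each
-- pair has a nearly uniform level, and forcing one bit at a random position of a run perturbs the uniform distribution
-- by O(1/√K) only.
--
-- For the limit in m the same argument is applied to G = R(m,d) inside R(M,d) with M much larger than m, each block
-- being placed into the corresponding block with a random offset: ρ(F,R(M,d)) ≤ ρ(F,R(m,d)) + o(1), so the limit exists.
module Submission where

open import Defs
open import Algebra.Bundles using (CommutativeRing)
open import Axiom.ExcludedMiddle using (ExcludedMiddle)
open import Data.Bool.Base using (Bool; true; false; T; _∧_; not; if_then_else_)
open import Data.Bool.Properties using (T?; ∧-identityʳ; ∧-zeroʳ)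
open import Data.Empty using (⊥; ⊥-elim)
open import Data.Fin.Base as Fin using (Fin; zero; suc)
import Data.Fin.Properties as Fin
open import Data.Fin.Subset using (Subset; ∣_∣)
open import Data.Fin.Subset.Properties using (_∈?_)
import Data.Integer.Base as ℤ
import Data.Integer.Properties as ℤ
open import Data.List.Base as List using (List; []; _∷_; _++_; length; filter; allFin; cartesianProduct)
open import Data.List.Membership.Propositional using (_∈_)
open import Data.List.Membership.Propositional.Properties using (∈-∃++)
open import Data.List.Relation.Binary.Permutation.Propositional as Perm using (_↭_)
open import Data.List.Relation.Binary.Permutation.Propositional.Properties using (shift; All-resp-↭; ↭-length)
open import Data.List.Relation.Unary.All as All using (All; []; _∷_)
open import Data.List.Relation.Unary.All.Properties using (all-filter)
open import Data.List.Relation.Unary.AllPairs using (AllPairs; []; _∷_; head; tail)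
open import Data.List.Relation.Unary.Any using (here; there)
import Data.List.Relation.Unary.Unique.Propositional.Properties as Unique
open import Data.Nat.Base as ℕ using (ℕ; zero; suc; _^_; _∸_)
import Data.Nat.DivMod as ℕ
import Data.Nat.Properties as ℕ
open import Data.Nat.Tactic.RingSolver using () renaming (solve-∀ to ℕ-solve-∀)
open import Data.Product using (Σ; ∃-syntax; _×_; _,_; proj₁; proj₂)
open import Data.Rational.Base as ℚ using (ℚ; mkℚ; 0ℚ; 1ℚ; ½; _<_; _≤_; _+_; _-_; _*_; -_; fromℚᵘ)
import Data.Rational.Properties as ℚ
import Data.Rational.Unnormalised.Base as ℚᵘ
import Data.Rational.Unnormalised.Properties as ℚᵘ
open import Data.Sum.Base using (_⊎_; inj₁; inj₂)
open import Data.Vec.Base as Vec using (Vec; []; _∷_; lookup; _[_]≔_)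
import Data.Vec.Properties as Vec
open import Function.Base using (_∘_; id; _∋_)
open import Function.Definitions using (Injective)
open import Level using (0ℓ)
open import Relation.Binary.Core using (_Preserves_⟶_)
open import Relation.Binary.Definitions using (tri<; tri≈; tri>)
open import Relation.Binary.PropositionalEquality
open import Relation.Nullary using (Dec; yes; no; does; ¬_)
open import Relation.Nullary.Decidable using (_×-dec_; dec⇒maybe)
open import Relation.Unary using (Pred; Decidable)
open import Tactic.RingSolver using (solve-∀)
open import Tactic.RingSolver.Core.AlmostCommutativeRing using (AlmostCommutativeRing; fromCommutativeRing)
open import Algebra.Properties.Semiring.Sum (CommutativeRing.semiring ℚ.+-*-commutativeRing)
  using (sum; sum-cong-≗; ∑-distrib-+; ∑-comm; *-distribˡ-sum)

-- One half of the outer limit is immediate: a graph `R m d` with an edge is itself one of the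
-- graphs over which the infimum runs. Everything else bounds `relDensity em F (R m d)` from above,
-- which is why the averaging estimates over words are one-sided. The obstacle is that a typical
-- edge of R(m,d) is not an edge between two typical blocks. Independent uniform words mostly differ
-- at one of the first positions, whereas the density 2^(δ-d) is just what gives all d levels
-- equally many edges; hence the effort to give each edge of G a random level. Once the blocks are
-- fixed, restricting to tuples that span G conditions every pair of blocks on carrying an edge, so
-- the edges of an F-free subgraph are counted with the weight `multiplicity`, the inverse of the
-- density. The counting errors grow like (2^d)^l for l edges, so the regularity must be chosen
-- after d and G; this is possible because m tends to infinity first. When R(m,d) itself plays the
-- role of G, its vertices share blocks and must keep their order inside them, hence windows in
-- place of whole blocks.

ring : AlmostCommutativeRing 0ℓ 0ℓ
ring = fromCommutativeRing ℚ.+-*-commutativeRing (λ x → dec⇒maybe (0ℚ ℚ.≟ x))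

-- Rational arithmetic

≤-by : ∀ {a b} x → 0ℚ ≤ x → a + x ≡ b → a ≤ b
≤-by {a} x 0≤x refl = subst (_≤ a + x) (ℚ.+-identityʳ a) (ℚ.+-monoʳ-≤ a 0≤x)

0≤+ : ∀ {a b} → 0ℚ ≤ a → 0ℚ ≤ b → 0ℚ ≤ a + b
0≤+ = ℚ.+-mono-≤

*-monoˡ : ∀ {a b c} → 0ℚ ≤ c → a ≤ b → c * a ≤ c * b
*-monoˡ {c = c} 0≤c = ℚ.*-monoˡ-≤-nonNeg c ⦃ ℚ.nonNegative 0≤c ⦄

*-monoʳ : ∀ {a b c} → 0ℚ ≤ c → a ≤ b → a * c ≤ b * c
*-monoʳ {c = c} 0≤c = ℚ.*-monoʳ-≤-nonNeg c ⦃ ℚ.nonNegative 0≤c ⦄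

0≤* : ∀ {a b} → 0ℚ ≤ a → 0ℚ ≤ b → 0ℚ ≤ a * b
0≤* {a} {b} 0≤a 0≤b = subst (_≤ a * b) (ℚ.*-zeroʳ a) (*-monoˡ 0≤a 0≤b)

*-mono : ∀ {a b c d} → 0ℚ ≤ b → 0ℚ ≤ c → a ≤ b → c ≤ d → a * c ≤ b * d
*-mono 0≤b 0≤c a≤b c≤d = ℚ.≤-trans (*-monoʳ 0≤c a≤b) (*-monoˡ 0≤b c≤d)

0≤-² : ∀ a → 0ℚ ≤ a * a
0≤-² a with ℚ.≤-total 0ℚ a
... | inj₁ 0≤a = 0≤* 0≤a 0≤a
... | inj₂ a≤0 = subst (0ℚ ≤_) (neg-sq a) (0≤* 0≤-a 0≤-a)
  where
  0≤-a : 0ℚ ≤ - a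
  0≤-a = ℚ.neg-antimono-≤ a≤0
  neg-sq : ∀ a → (- a) * (- a) ≡ a * a
  neg-sq = solve-∀ ring

0≤- : ∀ {a b} → a ≤ b → 0ℚ ≤ b - a
0≤- {a} {b} a≤b = subst (_≤ b - a) (ℚ.+-inverseʳ a) (ℚ.+-monoˡ-≤ (- a) a≤b)

≤-from-- : ∀ {a b} → 0ℚ ≤ b - a → a ≤ b
≤-from-- {a} {b} p = ≤-by (b - a) p (eq a b)
  where
  eq : ∀ a b → a + (b - a) ≡ b
  eq = solve-∀ ring

*-cancelˡ : ∀ {a b c} → 0ℚ < c → c * a ≤ c * b → a ≤ b
*-cancelˡ {c = c} 0<c = ℚ.*-cancelˡ-≤-pos c ⦃ ℚ.positive 0<c ⦄

0<* : ∀ {a b} → 0ℚ < a → 0ℚ < b → 0ℚ < a * b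
0<* {a} {b} 0<a 0<b = subst (_< a * b) (ℚ.*-zeroʳ a) (ℚ.*-monoʳ-<-pos a ⦃ ℚ.positive 0<a ⦄ 0<b)

fromℚᵘ-+ : ∀ p q → fromℚᵘ (p ℚᵘ.+ q) ≡ fromℚᵘ p + fromℚᵘ q
fromℚᵘ-+ p q = ℚ.toℚᵘ-injective (ℚᵘ.≃-trans (ℚ.toℚᵘ-fromℚᵘ (p ℚᵘ.+ q))
  (ℚᵘ.≃-sym (ℚᵘ.≃-trans (ℚ.toℚᵘ-homo-+ (fromℚᵘ p) (fromℚᵘ q))
    (ℚᵘ.+-cong (ℚ.toℚᵘ-fromℚᵘ p) (ℚ.toℚᵘ-fromℚᵘ q)))))

fromℚᵘ-* : ∀ p q → fromℚᵘ (p ℚᵘ.* q) ≡ fromℚᵘ p * fromℚᵘ q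
fromℚᵘ-* p q = ℚ.toℚᵘ-injective (ℚᵘ.≃-trans (ℚ.toℚᵘ-fromℚᵘ (p ℚᵘ.* q))
  (ℚᵘ.≃-sym (ℚᵘ.≃-trans (ℚ.toℚᵘ-homo-* (fromℚᵘ p) (fromℚᵘ q))
    (ℚᵘ.*-cong (ℚ.toℚᵘ-fromℚᵘ p) (ℚ.toℚᵘ-fromℚᵘ q)))))

-- Abstract, because ℕ→ℚ and ÷ unfold to gcd computations.
abstract
  ⟨_⟩ : ℕ → ℚ
  ⟨ n ⟩ = ℕ→ℚ n

  inv : ℕ → ℚ
  inv k = 1 ÷ suc k

  ⟨⟩-ℕ→ℚ : ∀ n → ⟨ n ⟩ ≡ ℕ→ℚ n
  ⟨⟩-ℕ→ℚ n = refl

  inv-÷ : ∀ k → inv k ≡ 1 ÷ suc k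
  inv-÷ k = refl

  ⟨0⟩ : ⟨ 0 ⟩ ≡ 0ℚ
  ⟨0⟩ = refl

  ⟨1⟩ : ⟨ 1 ⟩ ≡ 1ℚ
  ⟨1⟩ = refl

  ⟨⟩-+ : ∀ m n → ⟨ m ℕ.+ n ⟩ ≡ ⟨ m ⟩ + ⟨ n ⟩
  ⟨⟩-+ m n = trans (ℚ.fromℚᵘ-cong {ℚᵘ.mkℚᵘ (ℤ.+ (m ℕ.+ n)) 0} {p ℚᵘ.+ q} (ℚᵘ.*≡* eq)) (fromℚᵘ-+ p q)
    where
    p q : ℚᵘ.ℚᵘ
    p = ℚᵘ.mkℚᵘ (ℤ.+ m) 0
    q = ℚᵘ.mkℚᵘ (ℤ.+ n) 0
    eq : ℤ.+ (m ℕ.+ n) ℤ.* ℤ.+ 1 ≡ (ℤ.+ m ℤ.* ℤ.+ 1 ℤ.+ ℤ.+ n ℤ.* ℤ.+ 1) ℤ.* ℤ.+ 1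
    eq = cong (ℤ._* ℤ.+ 1) (sym (cong₂ ℤ._+_ (ℤ.*-identityʳ (ℤ.+ m)) (ℤ.*-identityʳ (ℤ.+ n))))

  ⟨⟩-* : ∀ m n → ⟨ m ℕ.* n ⟩ ≡ ⟨ m ⟩ * ⟨ n ⟩
  ⟨⟩-* m n = trans (ℚ.fromℚᵘ-cong {ℚᵘ.mkℚᵘ (ℤ.+ (m ℕ.* n)) 0} {p ℚᵘ.* q} (ℚᵘ.*≡* eq)) (fromℚᵘ-* p q)
    where
    p q : ℚᵘ.ℚᵘ
    p = ℚᵘ.mkℚᵘ (ℤ.+ m) 0
    q = ℚᵘ.mkℚᵘ (ℤ.+ n) 0
    eq : ℤ.+ (m ℕ.* n) ℤ.* ℤ.+ 1 ≡ (ℤ.+ m ℤ.* ℤ.+ n) ℤ.* ℤ.+ 1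
    eq = cong (ℤ._* ℤ.+ 1) (ℤ.pos-* m n)

  ÷-cancel : ∀ k n .⦃ _ : ℕ.NonZero n ⦄ → (k ÷ n) * ⟨ n ⟩ ≡ ⟨ k ⟩
  ÷-cancel k (suc n) = trans (sym (fromℚᵘ-* p q))
      (ℚ.fromℚᵘ-cong {p ℚᵘ.* q} {ℚᵘ.mkℚᵘ (ℤ.+ k) 0} (ℚᵘ.*≡* eq))
    where
    p q : ℚᵘ.ℚᵘ
    p = ℚᵘ.mkℚᵘ (ℤ.+ k) n
    q = ℚᵘ.mkℚᵘ (ℤ.+ suc n) 0
    eq : (ℤ.+ k ℤ.* ℤ.+ suc n) ℤ.* ℤ.+ 1 ≡ ℤ.+ k ℤ.* (ℤ.+ (suc n ℕ.* 1))
    eq = trans (ℤ.*-identityʳ (ℤ.+ k ℤ.* ℤ.+ suc n)) (cong (λ x → ℤ.+ k ℤ.* ℤ.+ x) (sym (ℕ.*-identityʳ (suc n))))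

  0≤⟨⟩ : ∀ n → 0ℚ ≤ ⟨ n ⟩
  0≤⟨⟩ n = 0≤÷ n 1

  0<⟨⟩ : ∀ n .⦃ _ : ℕ.NonZero n ⦄ → 0ℚ < ⟨ n ⟩
  0<⟨⟩ (suc n) = ℚ.positive⁻¹ _ ⦃ ℚ.normalize-pos (suc n) 1 ⦄

  0<inv : ∀ k → 0ℚ < inv k
  0<inv k = ℚ.positive⁻¹ _ ⦃ ℚ.normalize-pos 1 (suc k) ⦄

  archimedean : ∀ {ε} → 0ℚ < ε → ∃[ k ] inv k ≤ ε
  archimedean {mkℚ (ℤ.+ zero) d c} 0<ε with () ← ℚ.positive 0<ε
  archimedean {mkℚ (ℤ.-[1+ n ]) d c} 0<ε with () ← ℚ.positive 0<ε
  archimedean {ε@(mkℚ (ℤ.+ suc n) d c)} 0<ε = d , ℚ.toℚᵘ-cancel-≤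
    (ℚᵘ.≤-respˡ-≃ (ℚᵘ.≃-sym (ℚ.toℚᵘ-fromℚᵘ (ℚᵘ.mkℚᵘ (ℤ.+ 1) d)))
      (ℚᵘ.*≤* (ℤ.*-monoʳ-≤-nonNeg (ℤ.+ suc d) {ℤ.+ 1} {ℤ.+ suc n} (ℤ.+≤+ (ℕ.s≤s ℕ.z≤n)))))

inv-* : ∀ k → inv k * ⟨ suc k ⟩ ≡ 1ℚ
inv-* k = trans (cong (_* ⟨ suc k ⟩) (inv-÷ k)) (trans (÷-cancel 1 (suc k)) ⟨1⟩)

0≤inv : ∀ k → 0ℚ ≤ inv k
0≤inv k = ℚ.<⇒≤ (0<inv k)

⟨⟩-suc : ∀ n → ⟨ suc n ⟩ ≡ 1ℚ + ⟨ n ⟩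
⟨⟩-suc n = trans (⟨⟩-+ 1 n) (cong (_+ ⟨ n ⟩) ⟨1⟩)

⟨⟩-mono : ∀ {m n} → m ℕ.≤ n → ⟨ m ⟩ ≤ ⟨ n ⟩
⟨⟩-mono {m} {n} m≤n = ≤-by ⟨ n ∸ m ⟩ (0≤⟨⟩ (n ∸ m))
  (trans (sym (⟨⟩-+ m (n ∸ m))) (cong ⟨_⟩ (ℕ.m+[n∸m]≡n m≤n)))

⟨⟩-mono-< : ∀ {m n} → m ℕ.< n → ⟨ m ⟩ < ⟨ n ⟩
⟨⟩-mono-< {m} {n} m<n = ℚ.<-≤-trans
  (subst₂ _<_ (ℚ.+-identityˡ ⟨ m ⟩) (sym (⟨⟩-+ 1 m)) (ℚ.+-monoˡ-< ⟨ m ⟩ (0<⟨⟩ 1)))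
  (⟨⟩-mono m<n)

⟨⟩-cancel : ∀ {m n} → ⟨ m ⟩ ≤ ⟨ n ⟩ → m ℕ.≤ n
⟨⟩-cancel {m} {n} p with m ℕ.≤? n
... | yes m≤n = m≤n
... | no m≰n = ⊥-elim (ℚ.<-irrefl refl (ℚ.<-≤-trans (⟨⟩-mono-< (ℕ.≰⇒> m≰n)) p))

-- Indicators and finite sums

𝟙 : Bool → ℚ
𝟙 true  = 1ℚ
𝟙 false = 0ℚ

0≤𝟙 : ∀ b → 0ℚ ≤ 𝟙 b
0≤𝟙 true  = ℚ.nonNegative⁻¹ 1ℚ
0≤𝟙 false = ℚ.≤-refl

𝟙≤1 : ∀ b → 𝟙 b ≤ 1ℚ
𝟙≤1 true  = ℚ.≤-refl
𝟙≤1 false = ℚ.nonNegative⁻¹ 1ℚ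

𝟙-∧ : ∀ a b → 𝟙 (a ∧ b) ≡ 𝟙 a * 𝟙 b
𝟙-∧ true  b = sym (ℚ.*-identityˡ (𝟙 b))
𝟙-∧ false b = sym (ℚ.*-zeroˡ (𝟙 b))

𝟙-mono : ∀ {a b} → (T a → T b) → 𝟙 a ≤ 𝟙 b
𝟙-mono {false} {b} _ = 0≤𝟙 b
𝟙-mono {true} {true} _ = ℚ.≤-refl
𝟙-mono {true} {false} f = ⊥-elim (f _)

sum-mono : ∀ {n} {f g : Fin n → ℚ} → (∀ i → f i ≤ g i) → sum f ≤ sum g
sum-mono {zero} _ = ℚ.≤-refl
sum-mono {suc n} f≤g = ℚ.+-mono-≤ (f≤g zero) (sum-mono (f≤g ∘ suc))

sum-nonneg : ∀ {n} {f : Fin n → ℚ} → (∀ i → 0ℚ ≤ f i) → 0ℚ ≤ sum f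
sum-nonneg {zero} _ = ℚ.≤-refl
sum-nonneg {suc n} 0≤f = 0≤+ (0≤f zero) (sum-nonneg (0≤f ∘ suc))

sum-const : ∀ n c → sum {n} (λ _ → c) ≡ ⟨ n ⟩ * c
sum-const zero c = trans (sym (ℚ.*-zeroˡ c)) (cong (_* c) (sym ⟨0⟩))
sum-const (suc n) c = trans (cong (c +_) (sum-const n c)) (trans (eq c ⟨ n ⟩) (cong (_* c) (sym (⟨⟩-suc n))))
  where
  eq : ∀ c n → c + n * c ≡ (1ℚ + n) * c
  eq = solve-∀ ring

sum-zero : ∀ {n} {f : Fin n → ℚ} → (∀ i → f i ≡ 0ℚ) → sum f ≡ 0ℚ
sum-zero {n} f≡0 = trans (sum-cong-≗ f≡0) (trans (sum-const n 0ℚ) (ℚ.*-zeroʳ ⟨ n ⟩))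

sum-pick : ∀ {n} (i : Fin n) (f : Fin n → ℚ) → sum (λ j → 𝟙 (does (i Fin.≟ j)) * f j) ≡ f i
sum-pick {suc n} zero f = trans (cong₂ _+_ (ℚ.*-identityˡ (f zero)) (sum-zero (λ j → ℚ.*-zeroˡ (f (suc j))))) (ℚ.+-identityʳ (f zero))
sum-pick {suc n} (suc i) f = trans (cong₂ _+_ (ℚ.*-zeroˡ (f zero)) (sum-pick i (f ∘ suc))) (ℚ.+-identityˡ (f (suc i)))

sumL : {A : Set} → List A → (A → ℚ) → ℚ
sumL []       f = 0ℚ
sumL (x ∷ xs) f = f x + sumL xs f

sumL-mono : {A : Set} (xs : List A) {f g : A → ℚ} → (∀ x → x ∈ xs → f x ≤ g x) → sumL xs f ≤ sumL xs g
sumL-mono []       f≤g = ℚ.≤-refl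
sumL-mono (x ∷ xs) f≤g = ℚ.+-mono-≤ (f≤g x (here refl)) (sumL-mono xs (λ y y∈xs → f≤g y (there y∈xs)))

sumL-+ : {A : Set} (xs : List A) {f g : A → ℚ} → sumL xs (λ x → f x + g x) ≡ sumL xs f + sumL xs g
sumL-+ []               = refl
sumL-+ (x ∷ xs) {f} {g} = trans (cong (f x + g x +_) (sumL-+ xs)) (interchange (f x) (g x) (sumL xs f) (sumL xs g))
  where
  interchange : ∀ a b c d → a + b + (c + d) ≡ a + c + (b + d)
  interchange = solve-∀ ring

sumL-*ˡ : {A : Set} (xs : List A) (c : ℚ) {f : A → ℚ} → c * sumL xs f ≡ sumL xs (λ x → c * f x)
sumL-*ˡ []       c     = ℚ.*-zeroʳ c
sumL-*ˡ (x ∷ xs) c {f} = trans (ℚ.*-distribˡ-+ c (f x) (sumL xs f)) (cong (c * f x +_) (sumL-*ˡ xs c))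

sumL-*ʳ : {A : Set} (xs : List A) (c : ℚ) {f : A → ℚ} → sumL xs (λ x → f x * c) ≡ sumL xs f * c
sumL-*ʳ []       c     = sym (ℚ.*-zeroˡ c)
sumL-*ʳ (x ∷ xs) c {f} = trans (cong (f x * c +_) (sumL-*ʳ xs c)) (sym (ℚ.*-distribʳ-+ c (f x) (sumL xs f)))

sumL-const : {A : Set} (xs : List A) (c : ℚ) → sumL xs (λ _ → c) ≡ ⟨ length xs ⟩ * c
sumL-const []       c = trans (sym (ℚ.*-zeroˡ c)) (cong (_* c) (sym ⟨0⟩))
sumL-const (x ∷ xs) c = trans (cong (c +_) (sumL-const xs c)) (trans (eq c ⟨ length xs ⟩) (cong (_* c) (sym (⟨⟩-suc (length xs)))))
  where
  eq : ∀ c n → c + n * c ≡ (1ℚ + n) * c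
  eq = solve-∀ ring

sumL-++ : {A : Set} (xs ys : List A) {f : A → ℚ} → sumL (xs ++ ys) f ≡ sumL xs f + sumL ys f
sumL-++ [] ys = sym (ℚ.+-identityˡ _)
sumL-++ (x ∷ xs) ys {f} = trans (cong (f x +_) (sumL-++ xs ys)) (sym (ℚ.+-assoc (f x) (sumL xs f) (sumL ys f)))

sumL-map : {A B : Set} (h : A → B) (xs : List A) {f : B → ℚ} → sumL (List.map h xs) f ≡ sumL xs (f ∘ h)
sumL-map h [] = refl
sumL-map h (x ∷ xs) {f} = cong (f (h x) +_) (sumL-map h xs)

sumL-tabulate : {A : Set} {n : ℕ} (h : Fin n → A) {f : A → ℚ} → sumL (List.tabulate h) f ≡ sum (f ∘ h)
sumL-tabulate {n = zero} h = refl
sumL-tabulate {n = suc n} h {f} = cong (f (h zero) +_) (sumL-tabulate (h ∘ suc))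

sumL-product : {A B : Set} (xs : List A) (ys : List B) {f : A × B → ℚ} →
  sumL (cartesianProduct xs ys) f ≡ sumL xs (λ x → sumL ys (λ y → f (x , y)))
sumL-product [] ys = refl
sumL-product (x ∷ xs) ys = trans (sumL-++ (List.map (x ,_) ys) _) (cong₂ _+_ (sumL-map (x ,_) ys) (sumL-product xs ys))

sumL-filter : {A : Set} {P : Pred A 0ℓ} (P? : Decidable P) (xs : List A) {f : A → ℚ} →
  sumL (filter P? xs) f ≡ sumL xs (λ x → 𝟙 (does (P? x)) * f x)
sumL-filter P? [] = refl
sumL-filter P? (x ∷ xs) {f} with does (P? x)
... | true  = cong₂ _+_ (sym (ℚ.*-identityˡ (f x))) (sumL-filter P? xs)
... | false = trans (sumL-filter P? xs) (trans (sym (ℚ.+-identityˡ _)) (cong (_+ sumL xs (λ x → 𝟙 (does (P? x)) * f x)) (sym (ℚ.*-zeroˡ (f x)))))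

⟨length⟩ : {A : Set} (xs : List A) → ⟨ length xs ⟩ ≡ sumL xs (λ _ → 1ℚ)
⟨length⟩ [] = ⟨0⟩
⟨length⟩ (x ∷ xs) = trans (⟨⟩-suc (length xs)) (cong (1ℚ +_) (⟨length⟩ xs))

∑∑ : ∀ {m n} → (Fin m → Fin n → ℚ) → ℚ
∑∑ f = sum (λ i → sum (f i))

∑∑-cong : ∀ {m n} {f g : Fin m → Fin n → ℚ} → (∀ i j → f i j ≡ g i j) → ∑∑ f ≡ ∑∑ g
∑∑-cong eq = sum-cong-≗ (λ i → sum-cong-≗ (eq i))

∑∑-mono : ∀ {m n} {f g : Fin m → Fin n → ℚ} → (∀ i j → f i j ≤ g i j) → ∑∑ f ≤ ∑∑ g
∑∑-mono le = sum-mono (λ i → sum-mono (le i))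

sumL-pairs : ∀ n {P : Pred (Fin n × Fin n) 0ℓ} (P? : Decidable P) {f : Fin n × Fin n → ℚ} →
  sumL (filter P? (pairs n)) f ≡ ∑∑ (λ u v → 𝟙 (does (P? (u , v))) * f (u , v))
sumL-pairs n P? {f} = trans (sumL-filter P? (pairs n) {f}) (trans (sumL-product (allFin n) (allFin n) {g})
  (trans (sumL-tabulate id {λ u → sumL (allFin n) (λ v → g (u , v))})
    (sum-cong-≗ (λ u → sumL-tabulate id {λ v → g (u , v)}))))
  where
  g : Fin n × Fin n → ℚ
  g x = 𝟙 (does (P? x)) * f x

length-pairs : ∀ n {P : Pred (Fin n × Fin n) 0ℓ} (P? : Decidable P) →
  ⟨ length (filter P? (pairs n)) ⟩ ≡ ∑∑ (λ u v → 𝟙 (does (P? (u , v))))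
length-pairs n P? = trans (⟨length⟩ (filter P? (pairs n))) (trans (sumL-pairs n P? {λ _ → 1ℚ})
  (∑∑-cong {g = λ u v → 𝟙 (does (P? (u , v)))} (λ u v → ℚ.*-identityʳ (𝟙 (does (P? (u , v)))))))

bool-≡ : ∀ {a b} → (T a → T b) → (T b → T a) → a ≡ b
bool-≡ {false} {false} _ _ = refl
bool-≡ {true}  {true}  _ _ = refl
bool-≡ {false} {true}  _ g = ⊥-elim (g _)
bool-≡ {true}  {false} f _ = ⊥-elim (f _)

T-does : {P : Set} (P? : Dec P) → P → T (does P?)
T-does (yes _) _ = _
T-does (no ¬p) p = ⊥-elim (¬p p)

does-T : {P : Set} (P? : Dec P) → T (does P?) → P
does-T (yes p) _ = p

inImage : ∀ {m n} → (Fin m → Fin n) → (Fin m → Bool) → Fin n → Bool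
inImage ι α j = does (Fin.any? (λ i → T? (does (ι i Fin.≟ j) ∧ α i)))
  where open import Data.Bool.Properties using (T?)

T-∧ : ∀ {a b} → T a → T b → T (a ∧ b)
T-∧ {true} {true} _ _ = _

T-∧⁻ : ∀ {a b} → T (a ∧ b) → T a × T b
T-∧⁻ {true} {true} _ = _ , _

sum-atMostOne : ∀ {n} (b : Fin n → Bool) (c : Bool) → (∀ i j → T (b i) → T (b j) → i ≡ j) →
  (∀ i → T (b i) → T c) → (T c → ∃[ i ] T (b i)) → sum (λ i → 𝟙 (b i)) ≡ 𝟙 c
sum-atMostOne b false uniq f g = sum-zero (λ i → cong 𝟙 (bool-≡ (f i) λ ()))
sum-atMostOne {n} b true uniq f g = trans
  (sum-cong-≗ (λ j → trans (cong 𝟙 (bool-≡ {b j} {does (i₀ Fin.≟ j)}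
      (λ bj → T-does (i₀ Fin.≟ j) (uniq i₀ j bi₀ bj))
      (λ t → subst (T ∘ b) (does-T (i₀ Fin.≟ j) t) bi₀)))
    (sym (ℚ.*-identityʳ _)))) (sum-pick i₀ (λ _ → 1ℚ))
  where
  i₀ : Fin n
  i₀ = proj₁ (g _)
  bi₀ : T (b i₀)
  bi₀ = proj₂ (g _)

-- Turns a set of places in a window into the set of positions it occupies, so that statements about
-- subsets of a whole block apply to it.
sum-image : ∀ {m n} (ι : Fin m → Fin n) → (∀ {i j} → ι i ≡ ι j → i ≡ j) → (α : Fin m → Bool) (f : Fin n → ℚ) →
  sum (λ i → 𝟙 (α i) * f (ι i)) ≡ sum (λ j → 𝟙 (inImage ι α j) * f j)
sum-image ι inj α f = trans (sum-cong-≗ (λ i → trans (cong (𝟙 (α i) *_) (sym (sum-pick (ι i) f)))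
    (trans (*-distribˡ-sum (𝟙 (α i)) (λ j → 𝟙 (does (ι i Fin.≟ j)) * f j)) (sum-cong-≗ (λ j → reorder i j)))))
  (trans (∑-comm (λ i j → f j * 𝟙 (does (ι i Fin.≟ j) ∧ α i)))
    (sum-cong-≗ (λ j → trans (sym (*-distribˡ-sum (f j) (λ i → 𝟙 (does (ι i Fin.≟ j) ∧ α i))))
      (trans (cong (f j *_) (sum-atMostOne (λ i → does (ι i Fin.≟ j) ∧ α i) _
          (λ i i′ p q → inj (trans (does-T (ι i Fin.≟ j) (proj₁ (T-∧⁻ p))) (sym (does-T (ι i′ Fin.≟ j) (proj₁ (T-∧⁻ q))))))
          (λ i p → T-does (Fin.any? _) (i , p))
          (does-T (Fin.any? _))))
        (ℚ.*-comm (f j) _)))))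
  where
  assoc : ∀ a b c → a * (b * c) ≡ c * (b * a)
  assoc = solve-∀ ring
  reorder : ∀ i j → 𝟙 (α i) * (𝟙 (does (ι i Fin.≟ j)) * f j) ≡ f j * 𝟙 (does (ι i Fin.≟ j) ∧ α i)
  reorder i j = trans (assoc (𝟙 (α i)) (𝟙 (does (ι i Fin.≟ j))) (f j)) (cong (f j *_) (sym (𝟙-∧ (does (ι i Fin.≟ j)) (α i))))

-- Probability measures as expectation functionals

record Average (A : Set) : Set₁ where
  field
    𝔼       : (A → ℚ) → ℚ
    𝔼-+     : ∀ f g → 𝔼 (λ a → f a + g a) ≡ 𝔼 f + 𝔼 g
    𝔼-*     : ∀ c f → 𝔼 (λ a → c * f a) ≡ c * 𝔼 f
    𝔼-mono  : ∀ {f g} → (∀ a → f a ≤ g a) → 𝔼 f ≤ 𝔼 g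
    𝔼-const : ∀ c → 𝔼 (λ _ → c) ≡ c

open Average

module _ {A : Set} (α : Average A) where

  𝔼-cong : ∀ {f g} → (∀ a → f a ≡ g a) → 𝔼 α f ≡ 𝔼 α g
  𝔼-cong f≡g = ℚ.≤-antisym (𝔼-mono α (ℚ.≤-reflexive ∘ f≡g)) (𝔼-mono α (ℚ.≤-reflexive ∘ sym ∘ f≡g))

  𝔼-≤ : ∀ {f c} → (∀ a → f a ≤ c) → 𝔼 α f ≤ c
  𝔼-≤ {f} {c} f≤c = subst (𝔼 α f ≤_) (𝔼-const α c) (𝔼-mono α f≤c)

  𝔼-≥ : ∀ {f c} → (∀ a → c ≤ f a) → c ≤ 𝔼 α f
  𝔼-≥ {f} {c} c≤f = subst (_≤ 𝔼 α f) (𝔼-const α c) (𝔼-mono α c≤f)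

  𝔼-*ʳ : ∀ c f → 𝔼 α (λ a → f a * c) ≡ 𝔼 α f * c
  𝔼-*ʳ c f = trans (𝔼-cong (λ a → ℚ.*-comm (f a) c)) (trans (𝔼-* α c f) (ℚ.*-comm c (𝔼 α f)))

  𝔼-+const : ∀ c f → 𝔼 α (λ a → f a + c) ≡ 𝔼 α f + c
  𝔼-+const c f = trans (𝔼-+ α f (λ _ → c)) (cong (𝔼 α f +_) (𝔼-const α c))

  𝔼-sum : ∀ {n} (f : Fin n → A → ℚ) → 𝔼 α (λ a → sum (λ i → f i a)) ≡ sum (λ i → 𝔼 α (f i))
  𝔼-sum {zero}  f = 𝔼-const α 0ℚ
  𝔼-sum {suc n} f = trans (𝔼-+ α (f zero) (λ a → sum (λ i → f (suc i) a)))
    (cong (𝔼 α (f zero) +_) (𝔼-sum (f ∘ suc)))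

  𝔼-sumL : ∀ {B : Set} (xs : List B) (f : B → A → ℚ) →
    𝔼 α (λ a → sumL xs (λ x → f x a)) ≡ sumL xs (λ x → 𝔼 α (f x))
  𝔼-sumL []       f = 𝔼-const α 0ℚ
  𝔼-sumL (x ∷ xs) f = trans (𝔼-+ α (f x) (λ a → sumL xs (λ x → f x a)))
    (cong (𝔼 α (f x) +_) (𝔼-sumL xs f))

uniform : ∀ n → Average (Fin (suc n))
uniform n = record
  { 𝔼 = λ f → inv n * sum f
  ; 𝔼-+ = λ f g → trans (cong (inv n *_) (∑-distrib-+ f g)) (ℚ.*-distribˡ-+ (inv n) (sum f) (sum g))
  ; 𝔼-* = λ c f → trans (cong (inv n *_) (sym (*-distribˡ-sum c f))) (exchange (inv n) c (sum f))
  ; 𝔼-mono = λ f≤g → *-monoˡ (0≤inv n) (sum-mono f≤g)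
  ; 𝔼-const = λ c → trans (cong (inv n *_) (sum-const (suc n) c))
      (trans (sym (ℚ.*-assoc (inv n) ⟨ suc n ⟩ c)) (trans (cong (_* c) (inv-* n)) (ℚ.*-identityˡ c)))
  }
  where
  exchange : ∀ a b c → a * (b * c) ≡ b * (a * c)
  exchange = solve-∀ ring

uniform-sum : ∀ n (f : Fin (suc n) → ℚ) → sum f ≡ ⟨ suc n ⟩ * 𝔼 (uniform n) f
uniform-sum n f = trans (sym (ℚ.*-identityˡ (sum f))) (trans (cong (_* sum f) (sym (inv-* n)))
  (reorder (inv n) ⟨ suc n ⟩ (sum f)))
  where
  reorder : ∀ a b c → a * b * c ≡ b * (a * c)
  reorder = solve-∀ ring

return : {A : Set} → A → Average A
return a = record
  { 𝔼 = λ f → f a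
  ; 𝔼-+ = λ _ _ → refl
  ; 𝔼-* = λ _ _ → refl
  ; 𝔼-mono = λ f≤g → f≤g a
  ; 𝔼-const = λ _ → refl
  }

bind : {A B : Set} → Average A → (A → Average B) → Average B
bind α β = record
  { 𝔼 = λ f → 𝔼 α (λ a → 𝔼 (β a) f)
  ; 𝔼-+ = λ f g → trans (𝔼-cong α (λ a → 𝔼-+ (β a) f g)) (𝔼-+ α _ _)
  ; 𝔼-* = λ c f → trans (𝔼-cong α (λ a → 𝔼-* (β a) c f)) (𝔼-* α c _)
  ; 𝔼-mono = λ f≤g → 𝔼-mono α (λ a → 𝔼-mono (β a) f≤g)
  ; 𝔼-const = λ c → trans (𝔼-cong α (λ a → 𝔼-const (β a) c)) (𝔼-const α c)
  }

tuples : {A : Set} → Average A → ∀ n → Average (Vec A n)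
tuples α zero    = return []
tuples α (suc n) = bind α (λ a → bind (tuples α n) (λ as → return (a ∷ as)))

-- An `Average` is an abstract functional, so two of them cannot be exchanged in general; here the
-- inner one is a finite sum and linearity of `α` suffices.
𝔼-swap-uniform : {A : Set} (α : Average A) (n : ℕ) (f : A → Fin (suc n) → ℚ) →
  𝔼 α (λ a → 𝔼 (uniform n) (f a)) ≡ 𝔼 (uniform n) (λ i → 𝔼 α (λ a → f a i))
𝔼-swap-uniform α n f = trans (𝔼-* α (inv n) (λ a → sum (f a))) (cong (inv n *_) (𝔼-sum α (λ i a → f a i)))

𝔼-swap-tuples : {A : Set} (α : Average A) (q n : ℕ) (f : A → Vec (Fin (suc q)) n → ℚ) →
  𝔼 α (λ a → 𝔼 (tuples (uniform q) n) (f a)) ≡ 𝔼 (tuples (uniform q) n) (λ y → 𝔼 α (λ a → f a y))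
𝔼-swap-tuples α q zero    f = refl
𝔼-swap-tuples α q (suc n) f = trans
  (𝔼-swap-uniform α q (λ a s → 𝔼 (tuples (uniform q) n) (λ y → f a (s ∷ y))))
  (𝔼-cong (uniform q) (λ s → 𝔼-swap-tuples α q n (λ a y → f a (s ∷ y))))

module _ (q : ℕ) where

  private
    U : Average (Fin (suc q))
    U = uniform q

  -- Isolates one coordinate while the others are held fixed: an entry of a tuple of independent
  -- entries may be drawn again without changing the law.
  resample : ∀ {n} (a : Fin n) (g : Vec (Fin (suc q)) n → ℚ) →
    𝔼 (tuples U n) g ≡ 𝔼 (tuples U n) (λ y → 𝔼 U (λ s → g (y [ a ]≔ s)))
  resample {suc n} zero g = sym (trans (𝔼-const U _) (𝔼-swap-uniform (tuples U n) q (λ y s → g (s ∷ y))))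
  resample {suc n} (suc a) g = 𝔼-cong U (λ s → resample a (λ y → g (s ∷ y)))

  resample₂ : ∀ {n} (a b : Fin n) (g : Vec (Fin (suc q)) n → ℚ) →
    𝔼 (tuples U n) g ≡ 𝔼 (tuples U n) (λ y → 𝔼 U (λ s → 𝔼 U (λ t → g ((y [ a ]≔ s) [ b ]≔ t))))
  resample₂ a b g = trans (resample b g) (resample a (λ y → 𝔼 U (λ t → g (y [ b ]≔ t))))

  𝔼-marginal₂ : ∀ {n} {a b : Fin n} → a ≢ b → (g : Fin (suc q) → Fin (suc q) → ℚ) →
    𝔼 (tuples U n) (λ y → g (lookup y a) (lookup y b)) ≡ 𝔼 U (λ s → 𝔼 U (g s))
  𝔼-marginal₂ {n} {a} {b} a≢b g = trans (resample₂ a b _) (trans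
    (𝔼-cong (tuples U n) (λ y → 𝔼-cong U (λ s → 𝔼-cong U (λ t → cong₂ g
      (trans (Vec.lookup∘update′ a≢b (y [ a ]≔ s) t) (Vec.lookup∘update a y s))
      (Vec.lookup∘update b (y [ a ]≔ s) t)))))
    (𝔼-const (tuples U n) _))

-- Counting transversal copies in quasirandom systems

_≈⟨_⟩_ : ℚ → ℚ → ℚ → Set
a ≈⟨ η ⟩ b = (a ≤ b + η) × (b ≤ a + η)

module Counting (q n : ℕ) (R : Fin n × Fin n → Fin (suc q) → Fin (suc q) → Bool)
  (p : Fin n × Fin n → ℚ) (η : ℚ) where

  private
    U : Average (Fin (suc q))
    U = uniform q
    𝕐 : Average (Vec (Fin (suc q)) n)
    𝕐 = tuples U n
    Tuple : Set
    Tuple = Vec (Fin (suc q)) n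

  at : (Fin (suc q) → Fin (suc q) → Bool) → Fin n × Fin n → Tuple → Bool
  at r (a , b) y = r (lookup y a) (lookup y b)

  holds : List (Fin n × Fin n) → Tuple → Bool
  holds []      y = true
  holds (f ∷ E) y = at (R f) f y ∧ holds E y

  weight : List (Fin n × Fin n) → ℚ
  weight []      = 1ℚ
  weight (f ∷ E) = p f * weight E

  -- The normalised cut norm of `R f - p f` is at most η. Rectangles are the right test sets,
  -- because this is the shape of the constraints that the other edges impose on the two ends of f.
  Quasirandom : Fin n × Fin n → Set
  Quasirandom f = ∀ (α β : Fin (suc q) → Bool) →
    𝔼 U (λ s → 𝔼 U (λ t → 𝟙 (α s ∧ β t) * (𝟙 (R f s t) - p f))) ≈⟨ η ⟩ 0ℚ

  -- Once all coordinates but a and b are fixed, W is the indicator of a rectangle.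
  Splits : Fin n × Fin n → (Tuple → Bool) → Set
  Splits (a , b) W = ∀ y → Σ (Fin (suc q) → Bool) λ α → Σ (Fin (suc q) → Bool) λ β → ∀ s t → W ((y [ a ]≔ s) [ b ]≔ t) ≡ α s ∧ β t

  splits-∧ : ∀ e {V W} → Splits e V → Splits e W → Splits e (λ y → V y ∧ W y)
  splits-∧ e sV sW y with sV y | sW y
  ... | α , β , V≡ | α′ , β′ , W≡ = (λ s → α s ∧ α′ s) , (λ t → β t ∧ β′ t) , λ s t →
    trans (cong₂ _∧_ (V≡ s t) (W≡ s t)) (interchange (α s) (β t) (α′ s) (β′ t))
    where
    interchange : ∀ a b c d → (a ∧ b) ∧ (c ∧ d) ≡ (a ∧ c) ∧ (b ∧ d)
    interchange true  true  c d = refl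
    interchange true  false false d = refl
    interchange true  false true d = refl
    interchange false b c d = refl

  -- Both pairs are increasing and they differ, so (i , j) cannot contain both a and b. If a does
  -- not occur, the condition depends on t alone and goes into β; otherwise b does not occur and it
  -- goes into α.
  splits-at : ∀ {a b i j} → a Fin.< b → i Fin.< j → (i , j) ≢ (a , b) → ∀ r → Splits (a , b) (at r (i , j))
  splits-at {a} {b} {i} {j} a<b i<j ij≢ab r y with i Fin.≟ a | j Fin.≟ a
  ... | yes refl | yes refl = ⊥-elim (ℕ.<-irrefl refl i<j)
  ... | no i≢a | no j≢a = (λ _ → true) , (λ t → at r (i , j) (y [ b ]≔ t)) , λ s t → cong₂ r (ign i i≢a s t) (ign j j≢a s t)
    where
    ign : ∀ k → k ≢ a → ∀ s t → lookup ((y [ a ]≔ s) [ b ]≔ t) k ≡ lookup (y [ b ]≔ t) k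
    ign k k≢a s t with k Fin.≟ b
    ... | yes refl = trans (Vec.lookup∘update b (y [ a ]≔ s) t) (sym (Vec.lookup∘update b y t))
    ... | no k≢b = trans (Vec.lookup∘update′ k≢b (y [ a ]≔ s) t)
        (trans (Vec.lookup∘update′ k≢a y s) (sym (Vec.lookup∘update′ k≢b y t)))
  ... | yes refl | no j≢a = (λ s → at r (i , j) (y [ a ]≔ s)) , (λ _ → true) , λ s t →
      trans (cong₂ r (Vec.lookup∘update′ i≢b (y [ a ]≔ s) t) (Vec.lookup∘update′ j≢b (y [ a ]≔ s) t)) (sym (∧-identityʳ _))
    where
    i≢b : i ≢ b
    i≢b refl = ℕ.<-irrefl refl a<b
    j≢b : j ≢ b
    j≢b refl = ij≢ab refl
  ... | no i≢a | yes refl = (λ s → at r (i , j) (y [ a ]≔ s)) , (λ _ → true) , λ s t →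
      trans (cong₂ r (Vec.lookup∘update′ i≢b (y [ a ]≔ s) t) (Vec.lookup∘update′ j≢b (y [ a ]≔ s) t)) (sym (∧-identityʳ _))
    where
    i≢b : i ≢ b
    i≢b refl = ℕ.<-asym a<b i<j
    j≢b : j ≢ b
    j≢b refl = ℕ.<-irrefl refl a<b

  splits-holds : ∀ {a b} E → a Fin.< b → All (λ f → proj₁ f Fin.< proj₂ f) E → All (_≢ (a , b)) E →
    Splits (a , b) (holds E)
  splits-holds [] a<b [] [] y = (λ _ → true) , (λ _ → true) , λ s t → refl
  splits-holds (f@(i , j) ∷ E) a<b (i<j ∷ E<) (f≢ ∷ E≢) =
    splits-∧ _ {at (R f) f} {holds E} (splits-at a<b i<j f≢ (R f)) (splits-holds E a<b E< E≢)

  -- With all coordinates other than a and b fixed, `W` is a rectangle and the inner average is the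
  -- one bounded by `Quasirandom`; averaging over the rest preserves the bound.
  deviation : ∀ {a b} → a Fin.< b → Quasirandom (a , b) → ∀ W → Splits (a , b) W →
    𝔼 𝕐 (λ y → 𝟙 (W y) * (𝟙 (at (R (a , b)) (a , b) y) - p (a , b))) ≈⟨ η ⟩ 0ℚ
  deviation {a} {b} a<b Rqr W sW =
    subst (_≤ 0ℚ + η) (sym eq) (𝔼-≤ 𝕐 (λ y → proj₁ (bound y))) ,
    subst (0ℚ ≤_) (trans (𝔼-+const 𝕐 η X) (cong (_+ η) (sym eq))) (𝔼-≥ 𝕐 {λ y → X y + η} (λ y → proj₂ (bound y)))
    where
    a≢b : a ≢ b
    a≢b refl = ℕ.<-irrefl refl a<b
    Φ : Tuple → ℚ
    Φ y = 𝟙 (W y) * (𝟙 (at (R (a , b)) (a , b) y) - p (a , b))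
    X : Tuple → ℚ
    X y = 𝔼 U (λ s → 𝔼 U (λ t → Φ ((y [ a ]≔ s) [ b ]≔ t)))
    eq : 𝔼 𝕐 Φ ≡ 𝔼 𝕐 X
    eq = resample₂ q a b Φ
    bound : ∀ y → X y ≈⟨ η ⟩ 0ℚ
    bound y with sW y
    ... | α , β , W≡ = subst (_≈⟨ η ⟩ 0ℚ) (𝔼-cong U (λ s → 𝔼-cong U (λ t →
      cong₂ (λ w r → 𝟙 w * (𝟙 r - p (a , b))) (sym (W≡ s t)) (sym (cong₂ (R (a , b))
        (trans (Vec.lookup∘update′ a≢b (y [ a ]≔ s) t) (Vec.lookup∘update a y s))
        (Vec.lookup∘update b (y [ a ]≔ s) t)))))) (Rqr α β)

  record Admissible (f : Fin n × Fin n) : Set where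
    constructor admissible
    field
      ordered     : proj₁ f Fin.< proj₂ f
      quasirandom : Quasirandom f
      0≤p         : 0ℚ ≤ p f
      p≤1         : p f ≤ 1ℚ

  open Admissible

  -- Edges are replaced by their densities one at a time, writing the indicator of R as (R - p) + p.
  -- The first summand contributes at most η by `deviation`; the second multiplies the inductive
  -- estimate by p ≤ 1, so errors add up without being magnified.
  telescope : 0ℚ ≤ η → ∀ {E} → AllPairs _≢_ E → All Admissible E → ∀ W → All (λ f → Splits f W) E →
    𝔼 𝕐 (λ y → 𝟙 (W y ∧ holds E y)) ≈⟨ ⟨ length E ⟩ * η ⟩ (weight E * 𝔼 𝕐 (𝟙 ∘ W))
  telescope 0≤η [] [] W [] = subst (_≤ 1ℚ * Z + ⟨ 0 ⟩ * η) eq (≤-by _ 0≤0 refl) ,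
      subst (λ x → 1ℚ * Z ≤ x + ⟨ 0 ⟩ * η) eq (≤-by _ 0≤0 refl)
    where
    Z : ℚ
    Z = 𝔼 𝕐 (𝟙 ∘ W)
    0≤0 : 0ℚ ≤ ⟨ 0 ⟩ * η
    0≤0 = 0≤* (0≤⟨⟩ 0) 0≤η
    eq : 1ℚ * Z ≡ 𝔼 𝕐 (λ y → 𝟙 (W y ∧ true))
    eq = trans (ℚ.*-identityˡ Z) (𝔼-cong 𝕐 (λ y → cong 𝟙 (sym (∧-identityʳ (W y)))))
  telescope 0≤η {f ∷ E} (f∉E ∷ uniq) (adm ∷ adms) W (sf ∷ sE) =
      subst₂ _≤_ (sym X≡) (trans (upper (p f) (weight E) Z l η) (cong (p f * weight E * Z +_) suc-η)) up ,
      subst₂ _≤_ (sym (ℚ.*-assoc (p f) (weight E) Z)) (cong₂ _+_ (sym X≡) suc-η) lo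
    where
    V : Tuple → Bool
    V y = W y ∧ holds E y
    D Y Z l : ℚ
    D = 𝔼 𝕐 (λ y → 𝟙 (V y) * (𝟙 (at (R f) f y) - p f))
    Y = 𝔼 𝕐 (𝟙 ∘ V)
    Z = 𝔼 𝕐 (𝟙 ∘ W)
    l = ⟨ length E ⟩
    ih : Y ≈⟨ l * η ⟩ (weight E * Z)
    ih = telescope 0≤η uniq adms W sE
    dev : D ≈⟨ η ⟩ 0ℚ
    dev = deviation (ordered adm) (quasirandom adm) V
      (splits-∧ f {W} {holds E} sf (splits-holds E (ordered adm) (All.map ordered adms) (All.map (λ x → x ∘ sym) f∉E)))
    distribute : ∀ v r p → v * r ≡ v * (r - p) + p * v
    distribute = solve-∀ ring
    swap-∧ : ∀ w r h → w ∧ (r ∧ h) ≡ (w ∧ h) ∧ r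
    swap-∧ true true  h = sym (∧-identityʳ h)
    swap-∧ true false h = sym (∧-zeroʳ h)
    swap-∧ false r h = refl
    X≡ : 𝔼 𝕐 (λ y → 𝟙 (W y ∧ holds (f ∷ E) y)) ≡ D + p f * Y
    X≡ = trans (𝔼-cong 𝕐 (λ y → trans (cong 𝟙 (swap-∧ (W y) (at (R f) f y) (holds E y)))
          (trans (𝟙-∧ (V y) (at (R f) f y)) (distribute (𝟙 (V y)) (𝟙 (at (R f) f y)) (p f)))))
        (trans (𝔼-+ 𝕐 _ _) (cong (D +_) (𝔼-* 𝕐 (p f) (𝟙 ∘ V))))
    0≤lη : 0ℚ ≤ l * η
    0≤lη = 0≤* (0≤⟨⟩ _) 0≤η
    plη≤lη : p f * (l * η) ≤ l * η
    plη≤lη = subst (p f * (l * η) ≤_) (ℚ.*-identityˡ (l * η)) (*-monoʳ 0≤lη (p≤1 adm))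
    up : D + p f * Y ≤ 0ℚ + η + (p f * (weight E * Z) + l * η)
    up = ℚ.+-mono-≤ (proj₁ dev) (ℚ.≤-trans (*-monoˡ (0≤p adm) (proj₁ ih))
      (subst (_≤ p f * (weight E * Z) + l * η) (sym (ℚ.*-distribˡ-+ (p f) (weight E * Z) (l * η)))
        (ℚ.+-monoʳ-≤ (p f * (weight E * Z)) plη≤lη)))
    suc-η : (1ℚ + l) * η ≡ ⟨ suc (length E) ⟩ * η
    suc-η = cong (_* η) (sym (⟨⟩-suc (length E)))
    upper : ∀ p w z l η → 0ℚ + η + (p * (w * z) + l * η) ≡ p * w * z + (1ℚ + l) * η
    upper = solve-∀ ring
    lower : ∀ d x l η → x + l * η + (d + η) ≡ d + x + (1ℚ + l) * η
    lower = solve-∀ ring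
    lo : p f * (weight E * Z) ≤ D + p f * Y + (1ℚ + l) * η
    lo = ℚ.≤-trans (*-monoˡ (0≤p adm) (proj₂ ih)) (ℚ.≤-trans
      (subst (_≤ p f * Y + l * η) (sym (ℚ.*-distribˡ-+ (p f) Y (l * η))) (ℚ.+-monoʳ-≤ (p f * Y) plη≤lη))
      (≤-by (D + η) (proj₂ dev) (lower D (p f * Y) l η)))

  weight-resp-↭ : ∀ {E E′} → E ↭ E′ → weight E ≡ weight E′
  weight-resp-↭ Perm.refl         = refl
  weight-resp-↭ (Perm.prep f r)   = cong (p f *_) (weight-resp-↭ r)
  weight-resp-↭ (Perm.swap f g r) = trans (cong (λ w → p f * (p g * w)) (weight-resp-↭ r)) (exchange (p f) (p g) _)
    where
    exchange : ∀ a b c → a * (b * c) ≡ b * (a * c)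
    exchange = solve-∀ ring
  weight-resp-↭ (Perm.trans r r′) = trans (weight-resp-↭ r) (weight-resp-↭ r′)

  holds-resp-↭ : ∀ {E E′} → E ↭ E′ → ∀ y → holds E y ≡ holds E′ y
  holds-resp-↭ Perm.refl         y = refl
  holds-resp-↭ (Perm.prep f r)   y = cong (at (R f) f y ∧_) (holds-resp-↭ r y)
  holds-resp-↭ (Perm.swap f g r) y = trans (cong (λ w → at (R f) f y ∧ (at (R g) g y ∧ w)) (holds-resp-↭ r y))
      (exchange (at (R f) f y) (at (R g) g y) _)
    where
    exchange : ∀ a b c → a ∧ (b ∧ c) ≡ b ∧ (a ∧ c)
    exchange true  b     c = refl
    exchange false true  c = refl
    exchange false false c = refl
  holds-resp-↭ (Perm.trans r r′) y = trans (holds-resp-↭ r y) (holds-resp-↭ r′ y)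

  open import Data.List.Relation.Binary.Permutation.Setoid.Properties (setoid (Fin n × Fin n)) using (Unique-resp-↭)

  -- Averages over the tuples y that span a copy of E: such a copy meets H in at most c edges, while
  -- by quasirandomness each f ∈ E is (nearly) uniformly distributed.
  module _ (0≤η : 0ℚ ≤ η) {E : List (Fin n × Fin n)} (uniq : AllPairs _≢_ E) (adms : All Admissible E)
    (H : Fin n × Fin n → Fin (suc q) → Fin (suc q) → Bool) (H⊆R : ∀ f s t → T (H f s t) → T (R f s t))
    (w : Fin n × Fin n → ℚ) (0≤w : ∀ f → 0ℚ ≤ w f) (wp≡1 : ∀ {f} → f ∈ E → w f * p f ≡ 1ℚ)
    (c : ℚ) (0≤c : 0ℚ ≤ c) (fewEdges : ∀ y → sumL E (λ f → 𝟙 (at (H f) f y)) ≤ c) where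

    private
      l : ℚ
      l = ⟨ length E ⟩

    -- As `w f` cancels `p f`, the left side is the product of the densities of all edges but f,
    -- times the density of H at f. By `telescope` this is nearly the probability that H holds at f
    -- and R at all other edges, and H ⊆ R makes such a tuple span all of E.
    edge-weight : ∀ {f} → f ∈ E → weight E * (w f * 𝔼 U (λ s → 𝔼 U (λ t → 𝟙 (H f s t)))) ≤
      𝔼 𝕐 (λ y → 𝟙 (at (H f) f y) * 𝟙 (holds E y)) + l * η
    edge-weight {f} f∈E with ∈-∃++ f∈E
    ... | E₁ , E₂ , refl = subst (_≤ _) (sym lhs) (ℚ.≤-trans (proj₂ tel) (ℚ.+-mono-≤ (𝔼-mono 𝕐 compare) shorter))
      where
      E′ : List (Fin n × Fin n)
      E′ = E₁ ++ E₂
      E↭ : E ↭ f ∷ E′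
      E↭ = shift f E₁ E₂
      adms′ : All Admissible (f ∷ E′)
      adms′ = All-resp-↭ E↭ adms
      uniq′ : AllPairs _≢_ (f ∷ E′)
      uniq′ = Unique-resp-↭ (Perm.↭⇒↭ₛ E↭) uniq
      f<f : proj₁ f Fin.< proj₂ f
      f<f = ordered (All.head adms′)
      W : Tuple → Bool
      W = at (H f) f
      tel : 𝔼 𝕐 (λ y → 𝟙 (W y ∧ holds E′ y)) ≈⟨ ⟨ length E′ ⟩ * η ⟩ (weight E′ * 𝔼 𝕐 (𝟙 ∘ W))
      tel = telescope 0≤η (tail uniq′) (All.tail adms′) W
        (All.zipWith (λ (f≢g , g-adm) → splits-at (ordered g-adm) f<f f≢g (H f)) (head uniq′ , All.tail adms′))
      marginal : 𝔼 𝕐 (𝟙 ∘ W) ≡ 𝔼 U (λ s → 𝔼 U (λ t → 𝟙 (H f s t)))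
      marginal = 𝔼-marginal₂ q (λ { eq → ℕ.<-irrefl (cong Fin.toℕ eq) f<f }) (λ s t → 𝟙 (H f s t))
      regroup : ∀ p v w h → p * v * (w * h) ≡ w * p * (v * h)
      regroup = solve-∀ ring
      lhs : weight E * (w f * 𝔼 U (λ s → 𝔼 U (λ t → 𝟙 (H f s t)))) ≡ weight E′ * 𝔼 𝕐 (𝟙 ∘ W)
      lhs = trans (cong₂ (λ v h → v * (w f * h)) (weight-resp-↭ E↭) (sym marginal))
        (trans (regroup (p f) (weight E′) (w f) (𝔼 𝕐 (𝟙 ∘ W)))
        (trans (cong (_* (weight E′ * 𝔼 𝕐 (𝟙 ∘ W))) (wp≡1 f∈E)) (ℚ.*-identityˡ _)))
      compare : ∀ y → 𝟙 (W y ∧ holds E′ y) ≤ 𝟙 (W y) * 𝟙 (holds E y)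
      compare y = subst (𝟙 (W y ∧ holds E′ y) ≤_) (𝟙-∧ (W y) (holds E y)) (𝟙-mono λ t →
        let Wy , rest = T-∧⁻ {W y} t in T-∧ Wy (subst T (sym (holds-resp-↭ E↭ y))
          (T-∧ (H⊆R f _ _ Wy) rest)))
      shorter : ⟨ length E′ ⟩ * η ≤ l * η
      shorter = *-monoʳ 0≤η (⟨⟩-mono (subst (length E′ ℕ.≤_) (sym (↭-length E↭)) (ℕ.n≤1+n _)))

    -- Summing `edge-weight` leaves the average of the number of H-edges over the tuples that span
    -- E, hence at most c times the probability of spanning E. The errors are lη for each of the l
    -- edges and c · lη from estimating this probability.
    count-bound : weight E * sumL E (λ f → w f * 𝔼 U (λ s → 𝔼 U (λ t → 𝟙 (H f s t)))) ≤
      weight E * c + (c + l) * l * η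
    count-bound = ℚ.≤-trans (subst (_≤ sumL E (λ f → Hf f + l * η)) (sym (sumL-*ˡ E (weight E)))
        (sumL-mono E (λ f → edge-weight)))
      (ℚ.≤-trans (ℚ.≤-reflexive (trans (sumL-+ E {Hf} {λ _ → l * η}) (cong₂ _+_
          (trans (sym (𝔼-sumL 𝕐 E (λ f y → 𝟙 (at (H f) f y) * 𝟙 (holds E y))))
            (𝔼-cong 𝕐 (λ y → sumL-*ʳ E (𝟙 (holds E y)))))
          (sumL-const E (l * η)))))
      (ℚ.≤-trans (ℚ.+-monoˡ-≤ (l * (l * η)) (ℚ.≤-trans
          (𝔼-mono 𝕐 (λ y → *-monoʳ (0≤𝟙 (holds E y)) (fewEdges y)))
          (ℚ.≤-trans (ℚ.≤-reflexive (𝔼-* 𝕐 c (𝟙 ∘ holds E))) (*-monoˡ 0≤c upper))))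
        (ℚ.≤-reflexive (regroup c (weight E) l η))))
      where
      Hf : Fin n × Fin n → ℚ
      Hf f = 𝔼 𝕐 (λ y → 𝟙 (at (H f) f y) * 𝟙 (holds E y))
      regroup : ∀ c v l η → c * (v * 1ℚ + l * η) + l * (l * η) ≡ v * c + (c + l) * l * η
      regroup = solve-∀ ring
      upper : 𝔼 𝕐 (𝟙 ∘ holds E) ≤ weight E * 1ℚ + l * η
      upper = subst (λ x → 𝔼 𝕐 (𝟙 ∘ holds E) ≤ weight E * x + l * η) (𝔼-const 𝕐 1ℚ)
        (proj₁ (telescope 0≤η uniq adms (λ _ → true) (All.map (λ _ y → (λ _ → true) , (λ _ → true) , λ s t → refl) adms)))

-- The binary tree

Word : ℕ → Set
Word = Vec (Fin 2)

Words : ∀ d → Average (Word d)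
Words = tuples (uniform 1)

infix 4 _≺_
data _≺_ : ∀ {d} → Word d → Word d → Set where
  here  : ∀ {d} {x y : Word d} → (zero ∷ x) ≺ (suc zero ∷ y)
  there : ∀ {d} {b} {x y : Word d} → x ≺ y → (b ∷ x) ≺ (b ∷ y)

++-≺ : ∀ {c d} (w : Word c) {x y : Word d} → x ≺ y → (w Vec.++ x) ≺ (w Vec.++ y)
++-≺ []      x≺y = x≺y
++-≺ (b ∷ w) x≺y = there (++-≺ w x≺y)

-- The average of g over the pairs x ≺ y that first differ in position ℓ + 1.
lev : ∀ d → (Word d → Word d → ℚ) → ℕ → ℚ
lev zero    g ℓ       = 0ℚ
lev (suc d) g zero    = 𝔼 (Words d) (λ x → 𝔼 (Words d) (λ y → g (zero ∷ x) (suc zero ∷ y)))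
lev (suc d) g (suc ℓ) = 𝔼 (uniform 1) (λ b → lev d (λ x y → g (b ∷ x) (b ∷ y)) ℓ)

lev-nonneg : ∀ d {g} → (∀ x y → 0ℚ ≤ g x y) → ∀ ℓ → 0ℚ ≤ lev d g ℓ
lev-nonneg zero    0≤g ℓ       = ℚ.≤-refl
lev-nonneg (suc d) 0≤g zero    = 𝔼-≥ (Words d) (λ x → 𝔼-≥ (Words d) (λ y → 0≤g _ _))
lev-nonneg (suc d) 0≤g (suc ℓ) = 𝔼-≥ (uniform 1) (λ b → lev-nonneg d (λ x y → 0≤g (b ∷ x) (b ∷ y)) ℓ)

lev-≤ : ∀ d {g B} → 0ℚ ≤ B → (∀ x y → g x y ≤ B) → ∀ ℓ → lev d g ℓ ≤ B
lev-≤ zero    0≤B g≤B ℓ       = 0≤B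
lev-≤ (suc d) 0≤B g≤B zero    = 𝔼-≤ (Words d) (λ x → 𝔼-≤ (Words d) (λ y → g≤B _ _))
lev-≤ (suc d) 0≤B g≤B (suc ℓ) = 𝔼-≤ (uniform 1) (λ b → lev-≤ d 0≤B (λ x y → g≤B (b ∷ x) (b ∷ y)) ℓ)

lev-prefix : ∀ c d g ℓ → lev (c ℕ.+ d) g (c ℕ.+ ℓ) ≡ 𝔼 (Words c) (λ w → lev d (λ x y → g (w Vec.++ x) (w Vec.++ y)) ℓ)
lev-prefix zero    d g ℓ = refl
lev-prefix (suc c) d g ℓ = 𝔼-cong (uniform 1) (λ b → lev-prefix c d (λ x y → g (b ∷ x) (b ∷ y)) ℓ)

𝔼-++ : ∀ c d (f : Word (c ℕ.+ d) → ℚ) → 𝔼 (Words (c ℕ.+ d)) f ≡ 𝔼 (Words c) (λ w → 𝔼 (Words d) (λ x → f (w Vec.++ x)))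
𝔼-++ zero    d f = refl
𝔼-++ (suc c) d f = 𝔼-cong (uniform 1) (λ b → 𝔼-++ c d (λ w → f (b ∷ w)))

𝔼-bit : ∀ f → 𝔼 (uniform 1) f ≡ ½ * (f zero + f (suc zero))
𝔼-bit f = cong₂ _*_ (inv-÷ 1) (cong (f zero +_) (ℚ.+-identityʳ (f (suc zero))))

-- Hiding a forced bit: fixing the bit of a uniformly random word at a uniformly random position
-- reweights the uniform distribution by 1 + Z, where Z has second moment 1 / K.

module _ (b : Fin 2) where

  χ : Fin 2 → ℚ
  χ b′ = if does (b Fin.≟ b′) then 1ℚ else - 1ℚ

  -- `1 + χ` is 2 where the bit at r already equals b and 0 elsewhere: the density of the forced
  -- word with respect to the uniform one.
  force-reweight : ∀ {K} (r : Fin K) (f : Word K → ℚ) →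
    𝔼 (Words K) (λ u → f (u [ r ]≔ b)) ≡ 𝔼 (Words K) (λ u → f u + f u * χ (lookup u r))
  force-reweight {suc K} zero f = trans (𝔼-const (uniform 1) (X b))
    (sym (trans (𝔼-cong (uniform 1) (λ b′ → trans (𝔼-+ (Words K) (λ u → f (b′ ∷ u)) (λ u → f (b′ ∷ u) * χ b′))
        (cong (X b′ +_) (𝔼-*ʳ (Words K) (χ b′) (λ u → f (b′ ∷ u))))))
      (trans (𝔼-bit (λ b′ → X b′ + X b′ * χ b′)) (average b))))
    where
    X : Fin 2 → ℚ
    X b′ = 𝔼 (Words K) (λ u → f (b′ ∷ u))
    average₀ : ∀ x y → ½ * (x + x * 1ℚ + (y + y * (- 1ℚ))) ≡ x
    average₀ = solve-∀ ring
    average₁ : ∀ x y → ½ * (x + x * (- 1ℚ) + (y + y * 1ℚ)) ≡ y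
    average₁ = solve-∀ ring
    average : ∀ b → ½ * (X zero + X zero * (if does (b Fin.≟ zero) then 1ℚ else - 1ℚ) +
      (X (suc zero) + X (suc zero) * (if does (b Fin.≟ suc zero) then 1ℚ else - 1ℚ))) ≡ X b
    average zero       = average₀ (X zero) (X (suc zero))
    average (suc zero) = average₁ (X zero) (X (suc zero))
  force-reweight {suc K} (suc r) f = 𝔼-cong (uniform 1) (λ b′ → force-reweight r (λ u → f (b′ ∷ u)))

  -- Signs at different positions are orthogonal: averaging over the first bit cancels the cross
  -- term and leaves 1 from the square of its own sign.
  second-moment : ∀ K → 𝔼 (Words K) (λ u → sum (λ r → χ (lookup u r)) * sum (λ r → χ (lookup u r))) ≡ ⟨ K ⟩
  second-moment zero    = trans (ℚ.*-zeroˡ 0ℚ) (sym ⟨0⟩)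
  second-moment (suc K) = trans (𝔼-bit (λ b′ → 𝔼 (Words K) (λ u → S b′ u)))
    (trans (cong (½ *_) (sym (𝔼-+ (Words K) (S zero) (S (suc zero)))))
    (trans (sym (𝔼-* (Words K) ½ (λ u → S zero u + S (suc zero) u))) (trans (𝔼-cong (Words K) (λ u → expand b (Z u)))
    (trans (𝔼-+const (Words K) 1ℚ (λ u → Z u * Z u)) (trans (cong (_+ 1ℚ) (second-moment K))
      (trans (ℚ.+-comm ⟨ K ⟩ 1ℚ) (sym (⟨⟩-suc K))))))))
    where
    Z : Word K → ℚ
    Z u = sum (λ r → χ (lookup u r))
    S : Fin 2 → Word K → ℚ
    S b′ u = (χ b′ + Z u) * (χ b′ + Z u)
    expand₀ : ∀ z → ½ * ((1ℚ + z) * (1ℚ + z) + (- 1ℚ + z) * (- 1ℚ + z)) ≡ z * z + 1ℚ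
    expand₀ = solve-∀ ring
    expand₁ : ∀ z → ½ * ((- 1ℚ + z) * (- 1ℚ + z) + (1ℚ + z) * (1ℚ + z)) ≡ z * z + 1ℚ
    expand₁ = solve-∀ ring
    expand : ∀ b z → let χ b′ = if does (b Fin.≟ b′) then 1ℚ else - 1ℚ in
      ½ * ((χ zero + z) * (χ zero + z) + (χ (suc zero) + z) * (χ (suc zero) + z)) ≡ z * z + 1ℚ
    expand zero       z = expand₀ z
    expand (suc zero) z = expand₁ z

-- K is a square, which makes the error 1/√K rational.
module Hide (k : ℕ) where

  K′ K : ℕ
  K′ = k ℕ.+ k ℕ.* suc k
  K  = suc K′

  inv-square : inv K′ ≡ inv k * inv k
  inv-square = trans (sym (ℚ.*-identityʳ (inv K′))) (trans (cong (inv K′ *_) one)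
    (trans (sym (ℚ.*-assoc (inv K′) ⟨ K ⟩ (inv k * inv k))) (trans (cong (_* (inv k * inv k)) (inv-* K′)) (ℚ.*-identityˡ _))))
    where
    square : ∀ i c → c * c * (i * i) ≡ (i * c) * (i * c)
    square = solve-∀ ring
    one : 1ℚ ≡ ⟨ K ⟩ * (inv k * inv k)
    one = sym (trans (cong (_* (inv k * inv k)) (⟨⟩-* (suc k) (suc k))) (trans (square (inv k) ⟨ suc k ⟩)
      (trans (cong₂ _*_ (inv-* k) (inv-* k)) (ℚ.*-identityˡ 1ℚ))))

  -- Averaging `force-reweight` over r gives E f + E (f Z), where Z is the mean of the signs and has
  -- second moment 1/K, the square of `inv k`. As 0 ≤ f ≤ B, E (f Z) is at least -B E|Z|, hence at
  -- least -B `inv k`.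
  hide : ∀ (b : Fin 2) (f : Word K → ℚ) {B} → (∀ u → 0ℚ ≤ f u) → (∀ u → f u ≤ B) →
    𝔼 (Words K) f ≤ 𝔼 (uniform K′) (λ r → 𝔼 (Words K) (λ u → f (u [ r ]≔ b))) + B * inv k
  hide b f {B} 0≤f f≤B = ≤-by (𝔼 (Words K) P) (𝔼-≥ (Words K) 0≤P) eq
    where
    Z : Word K → ℚ
    Z u = 𝔼 (uniform K′) (λ r → χ b (lookup u r))
    C i : ℚ
    C = ⟨ suc k ⟩
    i = inv k
    -- The inequality -z ≤ (C z² + i) / 2 with i = 1/C, in sum-of-squares form, replaces
    -- Cauchy-Schwarz and absolute values. `P` expands to f Z + B (C Z² + i) / 2, whose average is E
    -- (f Z) + B i.
    P : Word K → ℚ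
    P u = f u * (½ * C * ((Z u + i) * (Z u + i))) + (B - f u) * (½ * C * (Z u * Z u) + ½ * i)
    0≤½C : 0ℚ ≤ ½ * C
    0≤½C = 0≤* (ℚ.nonNegative⁻¹ ½) (0≤⟨⟩ (suc k))
    0≤P : ∀ u → 0ℚ ≤ P u
    0≤P u = 0≤+ (0≤* (0≤f u) (0≤* 0≤½C (0≤-² (Z u + i))))
      (0≤* (0≤- (f≤B u)) (0≤+ (0≤* 0≤½C (0≤-² (Z u))) (0≤* (ℚ.nonNegative⁻¹ ½) (0≤inv k))))
    expand : ∀ f z B C i → f * (½ * C * ((z + i) * (z + i))) + (B - f) * (½ * C * (z * z) + ½ * i) ≡
      f * z * (i * C) + (f * ½ * i * (i * C - 1ℚ) + (½ * C * B * (z * z) + ½ * i * B))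
    expand = solve-∀ ring
    collapse : ∀ f z i rest → f * z * 1ℚ + (f * ½ * i * (1ℚ - 1ℚ) + rest) ≡ f * z + rest
    collapse = solve-∀ ring
    rest : Word K → ℚ
    rest u = ½ * C * B * (Z u * Z u) + ½ * i * B
    P≡ : ∀ u → P u ≡ f u * Z u + (½ * C * B * (Z u * Z u) + ½ * i * B)
    P≡ u = trans (expand (f u) (Z u) B C i) (trans (cong (λ x → f u * Z u * x + (f u * ½ * i * (x - 1ℚ) + rest u)) (inv-* k))
      (collapse (f u) (Z u) i (rest u)))
    S : Word K → ℚ
    S u = sum (λ r → χ b (lookup u r))
    EZ² : 𝔼 (Words K) (λ u → Z u * Z u) ≡ i * i
    EZ² = trans (𝔼-cong (Words K) (λ u → square (inv K′) (sum (λ r → χ b (lookup u r)))))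
      (trans (𝔼-* (Words K) (inv K′ * inv K′) (λ u → S u * S u)) (trans (cong (inv K′ * inv K′ *_) (second-moment b K))
      (trans (ℚ.*-assoc (inv K′) (inv K′) ⟨ K ⟩) (trans (cong (inv K′ *_) (inv-* K′)) (trans (ℚ.*-identityʳ (inv K′)) inv-square)))))
      where
      square : ∀ i s → (i * s) * (i * s) ≡ i * i * (s * s)
      square = solve-∀ ring
    EP : 𝔼 (Words K) P ≡ 𝔼 (Words K) (λ u → f u * Z u) + B * i
    EP = trans (𝔼-cong (Words K) P≡) (trans (𝔼-+ (Words K) (λ u → f u * Z u) (λ u → ½ * C * B * (Z u * Z u) + ½ * i * B)) (cong (𝔼 (Words K) (λ u → f u * Z u) +_)
      (trans (𝔼-+const (Words K) (½ * i * B) (λ u → ½ * C * B * (Z u * Z u))) (trans (cong (_+ ½ * i * B) (trans (𝔼-* (Words K) (½ * C * B) (λ u → Z u * Z u)) (cong (½ * C * B *_) EZ²)))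
        (trans (factor B C i) (trans (cong (λ x → ½ * B * i * x + ½ * i * B) (inv-* k)) (halves B i)))))))
      where
      factor : ∀ B C i → ½ * C * B * (i * i) + ½ * i * B ≡ ½ * B * i * (i * C) + ½ * i * B
      factor = solve-∀ ring
      halves : ∀ B i → ½ * B * i * 1ℚ + ½ * i * B ≡ B * i
      halves = solve-∀ ring
    forced : 𝔼 (uniform K′) (λ r → 𝔼 (Words K) (λ u → f (u [ r ]≔ b))) ≡ 𝔼 (Words K) f + 𝔼 (Words K) (λ u → f u * Z u)
    forced = trans (𝔼-cong (uniform K′) (λ r → force-reweight b r f))
      (trans (sym (𝔼-swap-uniform (Words K) K′ (λ u r → f u + f u * χ b (lookup u r))))
      (trans (𝔼-cong (Words K) (λ u → trans (𝔼-+ (uniform K′) (λ _ → f u) (λ r → f u * χ b (lookup u r)))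
          (cong₂ _+_ (𝔼-const (uniform K′) (f u)) (𝔼-* (uniform K′) (f u) (λ r → χ b (lookup u r))))))
        (𝔼-+ (Words K) f (λ u → f u * Z u))))
    eq : 𝔼 (Words K) f + 𝔼 (Words K) P ≡ 𝔼 (uniform K′) (λ r → 𝔼 (Words K) (λ u → f (u [ r ]≔ b))) + B * inv k
    eq = trans (cong (𝔼 (Words K) f +_) EP) (trans (sym (ℚ.+-assoc (𝔼 (Words K) f) _ (B * i))) (cong (_+ B * i) (sym forced)))

-- Combs of words

-- The word that leaves the path `u` at position r. The initial bits of `s` are discarded; giving
-- `s` full length keeps its type independent of r.
splice : ∀ {K e} → Fin K → Word K → Word (K ℕ.+ e) → Word (K ℕ.+ e)
splice zero    (b ∷ u) (b′ ∷ s) = zero ∷ s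
splice (suc r) (b ∷ u) (b′ ∷ s) = b ∷ splice r u s

splice-≺ : ∀ {K e} (r : Fin K) u s (x : Word e) → splice r u s ≺ ((u [ r ]≔ suc zero) Vec.++ x)
splice-≺ zero    (b ∷ u) (b′ ∷ s) x = here
splice-≺ (suc r) (b ∷ u) (b′ ∷ s) x = there (splice-≺ r u s x)

-- The part of `s` behind position r has the law of the rest of `u` followed by a fresh word, so the
-- leaving word looks like a uniform word with one forced bit.
splice-marginal : ∀ {K e} (r : Fin K) (f : Word (K ℕ.+ e) → ℚ) →
  𝔼 (Words K) (λ u → 𝔼 (Words (K ℕ.+ e)) (λ s → f (splice r u s))) ≡
  𝔼 (Words K) (λ u → 𝔼 (Words e) (λ x → f ((u [ r ]≔ zero) Vec.++ x)))
splice-marginal {suc K} {e} zero f = 𝔼-cong (uniform 1) (λ b → trans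
  (𝔼-cong (Words K) (λ u → trans (𝔼-const (uniform 1) (𝔼 (Words (K ℕ.+ e)) (λ s → f (zero ∷ s))))
    (𝔼-++ K e (λ s → f (zero ∷ s))))) (𝔼-const (Words K) _))
splice-marginal {suc K} {e} (suc r) f = 𝔼-cong (uniform 1) (λ b → trans
  (𝔼-cong (Words K) (λ u → 𝔼-const (uniform 1) (𝔼 (Words (K ℕ.+ e)) (λ s → f (b ∷ splice r u s)))))
  (splice-marginal r (λ s → f (b ∷ s))))

-- Behind position r the first word continues with `s`, the second with the rest of `u` and with x.
-- The two tails are independent and uniform, so this is exactly a random pair that first differs at
-- r.
splice-lev : ∀ {K e} (r : Fin K) (g : Word (K ℕ.+ e) → Word (K ℕ.+ e) → ℚ) →
  𝔼 (Words K) (λ u → 𝔼 (Words (K ℕ.+ e)) (λ s → 𝔼 (Words e) (λ x → g (splice r u s) ((u [ r ]≔ suc zero) Vec.++ x)))) ≡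
  lev (K ℕ.+ e) g (Fin.toℕ r)
splice-lev {suc K} {e} zero g = trans (𝔼-const (uniform 1) _) (trans
  (𝔼-cong (Words K) (λ u → 𝔼-const (uniform 1) (𝔼 (Words (K ℕ.+ e)) (λ s → 𝔼 (Words e) (λ x → g (zero ∷ s) (suc zero ∷ (u Vec.++ x)))))))
  (trans (𝔼-swap-tuples (Words K) 1 (K ℕ.+ e) (λ u s → 𝔼 (Words e) (λ x → g (zero ∷ s) (suc zero ∷ (u Vec.++ x)))))
    (𝔼-cong (Words (K ℕ.+ e)) (λ s → sym (𝔼-++ K e (λ y → g (zero ∷ s) (suc zero ∷ y)))))))
splice-lev {suc K} {e} (suc r) g = 𝔼-cong (uniform 1) (λ b → trans
  (𝔼-cong (Words K) (λ u → 𝔼-const (uniform 1) (𝔼 (Words (K ℕ.+ e)) (λ s → 𝔼 (Words e) (λ x →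
    g (b ∷ splice r u s) (b ∷ ((u [ r ]≔ suc zero) Vec.++ x)))))))
  (splice-lev r (λ x y → g (b ∷ x) (b ∷ y))))

Chain : ℕ → ℕ → Set
Chain n d = Σ (Fin n → Word d) λ v → ∀ i j → i Fin.< j → v i ≺ v j

module Comb (k : ℕ) where
  open Hide k

  dep : ℕ → ℕ → ℕ
  dep zero    e = e
  dep (suc n) e = K ℕ.+ dep n e

  dep-+ : ∀ n e → dep n e ≡ n ℕ.* K ℕ.+ e
  dep-+ zero    e = refl
  dep-+ (suc n) e = trans (cong (K ℕ.+_) (dep-+ n e)) (sym (ℕ.+-assoc K (n ℕ.* K) e))

  extend : ∀ {n e} → Fin K → Word K → Word (K ℕ.+ e) → Chain n e → Chain (suc n) (K ℕ.+ e)
  extend {n} {e} r u s (v , inc) = v′ , inc′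
    where
    v′ : Fin (suc n) → Word (K ℕ.+ e)
    v′ zero    = splice r u s
    v′ (suc i) = (u [ r ]≔ suc zero) Vec.++ v i
    inc′ : ∀ i j → i Fin.< j → v′ i ≺ v′ j
    inc′ zero    (suc j) _           = splice-≺ r u s (v j)
    inc′ (suc i) (suc j) (ℕ.s≤s i<j) = ++-≺ (u [ r ]≔ suc zero) (inc i j i<j)

  -- The i-th word leaves the common branch of its successors at a random position in the i-th run of
  -- K positions; the successors all have bit 1 there.
  comb : ∀ n e → Average (Chain n (dep n e))
  comb zero    e = return ((λ ()) , λ ())
  comb (suc n) e = bind (uniform K′) λ r → bind (Words K) λ u → bind (Words (K ℕ.+ dep n e)) λ s →
    bind (comb n e) λ ch → return (extend r u s ch)

  private
    error-suc : ∀ n ζ → ζ + ⟨ n ⟩ * ζ ≡ ⟨ suc n ⟩ * ζ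
    error-suc n ζ = trans (factor ζ ⟨ n ⟩) (cong (_* ζ) (sym (⟨⟩-suc n)))
      where
      factor : ∀ ζ n → ζ + n * ζ ≡ (1ℚ + n) * ζ
      factor = solve-∀ ring

  -- Inductive step of the two estimates below: passing through a run costs one application of
  -- `hide`, hence n runs cost n B `inv k`.
  hide-run : ∀ n (b : Fin 2) {B} (X : Word K → ℚ) (Y : Word K → ℚ) → (∀ u → 0ℚ ≤ X u) → (∀ u → X u ≤ B) →
    (∀ u → X u ≤ Y u + ⟨ n ⟩ * (B * inv k)) →
    𝔼 (Words K) X ≤ 𝔼 (uniform K′) (λ r → 𝔼 (Words K) (λ u → Y (u [ r ]≔ b))) + ⟨ suc n ⟩ * (B * inv k)
  hide-run n b {B} X Y 0≤X X≤B X≤Y = ℚ.≤-trans (hide b X 0≤X X≤B) (ℚ.≤-trans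
    (ℚ.+-monoˡ-≤ ζ (ℚ.≤-trans (𝔼-mono (uniform K′) (λ r → 𝔼-mono (Words K) (λ u → X≤Y (u [ r ]≔ b))))
      (ℚ.≤-reflexive (trans (𝔼-cong (uniform K′) (λ r → 𝔼-+const (Words K) (⟨ n ⟩ * ζ) (λ u → Y (u [ r ]≔ b))))
        (𝔼-+const (uniform K′) (⟨ n ⟩ * ζ) (λ r → 𝔼 (Words K) (λ u → Y (u [ r ]≔ b))))))))
    (ℚ.≤-reflexive (trans (reorder Ey (⟨ n ⟩ * ζ) ζ) (cong (Ey +_) (error-suc n ζ)))))
    where
    ζ Ey : ℚ
    ζ = B * inv k
    Ey = 𝔼 (uniform K′) (λ r → 𝔼 (Words K) (λ u → Y (u [ r ]≔ b)))
    reorder : ∀ a b c → a + b + c ≡ a + (c + b)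
    reorder = solve-∀ ring

  -- The j-th word has one bit forced to 1 in each run before its own and one bit forced to 0 in its
  -- own run; all other bits are uniform. The runs are treated one after the other.
  comb-marginal : ∀ n e (j : Fin n) {B} (f : Word (dep n e) → ℚ) → (∀ x → 0ℚ ≤ f x) → (∀ x → f x ≤ B) →
    𝔼 (Words (dep n e)) f ≤ 𝔼 (comb n e) (λ ch → f (proj₁ ch j)) + ⟨ n ⟩ * (B * inv k)
  comb-marginal (suc n) e j {B} f 0≤f f≤B = subst (_≤ 𝔼 (comb (suc n) e) (λ ch → f (proj₁ ch j)) + ⟨ suc n ⟩ * (B * inv k))
      (sym (𝔼-++ K d f)) (main j)
    where
    d : ℕ
    d = dep n e
    X : Word K → ℚ
    X u = 𝔼 (Words d) (λ x → f (u Vec.++ x))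
    0≤X : ∀ u → 0ℚ ≤ X u
    0≤X u = 𝔼-≥ (Words d) (λ x → 0≤f (u Vec.++ x))
    X≤B : ∀ u → X u ≤ B
    X≤B u = 𝔼-≤ (Words d) (λ x → f≤B (u Vec.++ x))
    0≤ζ : 0ℚ ≤ B * inv k
    0≤ζ = 0≤* (ℚ.≤-trans (0≤X (Vec.replicate K zero)) (X≤B (Vec.replicate K zero))) (0≤inv k)
    main : ∀ j → 𝔼 (Words K) X ≤ 𝔼 (comb (suc n) e) (λ ch → f (proj₁ ch j)) + ⟨ suc n ⟩ * (B * inv k)
    main zero = ℚ.≤-trans (hide-run n zero X X 0≤X X≤B (λ u → ≤-by _ (0≤* (0≤⟨⟩ n) 0≤ζ) refl))
      (ℚ.+-monoˡ-≤ _ (ℚ.≤-reflexive (𝔼-cong (uniform K′) (λ r → trans (sym (splice-marginal r f))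
        (𝔼-cong (Words K) (λ u → 𝔼-cong (Words (K ℕ.+ d)) (λ s → sym (𝔼-const (comb n e) (f (splice r u s))))))))))
    main (suc j) = ℚ.≤-trans (hide-run n (suc zero) X (λ u → 𝔼 (comb n e) (λ ch → f (u Vec.++ proj₁ ch j))) 0≤X X≤B
        (λ u → comb-marginal n e j (λ x → f (u Vec.++ x)) (λ x → 0≤f (u Vec.++ x)) (λ x → f≤B (u Vec.++ x))))
      (ℚ.+-monoˡ-≤ _ (ℚ.≤-reflexive (𝔼-cong (uniform K′) (λ r → 𝔼-cong (Words K) (λ u →
        sym (𝔼-const (Words (K ℕ.+ d)) (𝔼 (comb n e) (λ ch → f ((u [ r ]≔ suc zero) Vec.++ proj₁ ch j)))))))))

  -- The earlier word decides the level, by the position at which it leaves. Before its run both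
  -- words share a path with one forced bit per run, which `hide-run` conceals. In that run
  -- `splice-lev` is exact, and only the later word has forced bits in the runs behind it, which
  -- `comb-marginal` conceals.
  comb-pair : ∀ n e (i j : Fin n) → i Fin.< j → ∀ {B} (g : Word (dep n e) → Word (dep n e) → ℚ) →
    (∀ x y → 0ℚ ≤ g x y) → (∀ x y → g x y ≤ B) →
    𝔼 (uniform K′) (λ r → lev (dep n e) g (Fin.toℕ i ℕ.* K ℕ.+ Fin.toℕ r)) ≤
    𝔼 (comb n e) (λ ch → g (proj₁ ch i) (proj₁ ch j)) + ⟨ n ⟩ * (B * inv k)
  comb-pair (suc n) e zero (suc j) _ {B} g 0≤g g≤B = ℚ.≤-trans
      (ℚ.≤-reflexive (𝔼-cong (uniform K′) (λ r → sym (splice-lev r g))))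
      (ℚ.≤-trans (𝔼-mono (uniform K′) (λ r → ℚ.≤-trans (𝔼-mono (Words K) (λ u → ℚ.≤-trans (𝔼-mono (Words (K ℕ.+ d)) (λ s →
          comb-marginal n e j (λ x → g (splice r u s) ((u [ r ]≔ suc zero) Vec.++ x)) (λ x → 0≤g (splice r u s) ((u [ r ]≔ suc zero) Vec.++ x)) (λ x → g≤B (splice r u s) ((u [ r ]≔ suc zero) Vec.++ x))))
        (ℚ.≤-reflexive (𝔼-+const (Words (K ℕ.+ d)) ε (λ s → Y r u s)))))
        (ℚ.≤-reflexive (𝔼-+const (Words K) ε (λ u → 𝔼 (Words (K ℕ.+ d)) (Y r u))))))
      (ℚ.≤-trans (ℚ.≤-reflexive (𝔼-+const (uniform K′) ε (λ r → 𝔼 (Words K) (λ u → 𝔼 (Words (K ℕ.+ d)) (Y r u)))))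
        (ℚ.+-monoʳ-≤ Ey (≤-by ζ 0≤ζ (trans (ℚ.+-comm ε ζ) (error-suc n ζ))))))
    where
    d : ℕ
    d = dep n e
    ζ ε : ℚ
    ζ = B * inv k
    ε = ⟨ n ⟩ * ζ
    Y : Fin K → Word K → Word (K ℕ.+ d) → ℚ
    Y r u s = 𝔼 (comb n e) (λ ch → g (splice r u s) ((u [ r ]≔ suc zero) Vec.++ proj₁ ch j))
    Ey : ℚ
    Ey = 𝔼 (uniform K′) (λ r → 𝔼 (Words K) (λ u → 𝔼 (Words (K ℕ.+ d)) (Y r u)))
    w : Word (K ℕ.+ d)
    w = Vec.replicate (K ℕ.+ d) zero
    0≤ζ : 0ℚ ≤ ζ
    0≤ζ = 0≤* (ℚ.≤-trans (0≤g w w) (g≤B w w)) (0≤inv k)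
  comb-pair (suc n) e (suc i) (suc j) (ℕ.s≤s i<j) {B} g 0≤g g≤B = ℚ.≤-trans (ℚ.≤-reflexive shifted)
      (ℚ.≤-trans (hide-run n (suc zero) X Y 0≤X X≤B
        (λ u → comb-pair n e i j i<j (λ x y → g (u Vec.++ x) (u Vec.++ y)) (λ x y → 0≤g (u Vec.++ x) (u Vec.++ y)) (λ x y → g≤B (u Vec.++ x) (u Vec.++ y))))
      (ℚ.+-monoˡ-≤ _ (ℚ.≤-reflexive (𝔼-cong (uniform K′) (λ r → 𝔼-cong (Words K) (λ u →
        sym (𝔼-const (Words (K ℕ.+ d)) (Y (u [ r ]≔ suc zero)))))))))
    where
    d : ℕ
    d = dep n e
    ℓ : Fin K → ℕ
    ℓ r = Fin.toℕ i ℕ.* K ℕ.+ Fin.toℕ r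
    G : Word K → Word d → Word d → ℚ
    G u x y = g (u Vec.++ x) (u Vec.++ y)
    X Y : Word K → ℚ
    X u = 𝔼 (uniform K′) (λ r → lev d (G u) (ℓ r))
    Y u = 𝔼 (comb n e) (λ ch → G u (proj₁ ch i) (proj₁ ch j))
    0≤B : 0ℚ ≤ B
    0≤B = ℚ.≤-trans (0≤g w w) (g≤B w w)
      where
      w : Word (K ℕ.+ d)
      w = Vec.replicate (K ℕ.+ d) zero
    0≤X : ∀ u → 0ℚ ≤ X u
    0≤X u = 𝔼-≥ (uniform K′) (λ r → lev-nonneg d (λ x y → 0≤g (u Vec.++ x) (u Vec.++ y)) (ℓ r))
    X≤B : ∀ u → X u ≤ B
    X≤B u = 𝔼-≤ (uniform K′) (λ r → lev-≤ d 0≤B (λ x y → g≤B (u Vec.++ x) (u Vec.++ y)) (ℓ r))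
    shifted : 𝔼 (uniform K′) (λ r → lev (K ℕ.+ d) g (Fin.toℕ (suc i) ℕ.* K ℕ.+ Fin.toℕ r)) ≡ 𝔼 (Words K) X
    shifted = trans (𝔼-cong (uniform K′) (λ r → trans (cong (lev (K ℕ.+ d) g) (ℕ.+-assoc K (Fin.toℕ i ℕ.* K) (Fin.toℕ r)))
        (lev-prefix K d g (ℓ r))))
      (sym (𝔼-swap-uniform (Words K) K′ (λ u r → lev d (G u) (ℓ r))))

-- Sums over words and over vertices

∑w : ∀ d → (Word d → ℚ) → ℚ
∑w zero    f = f []
∑w (suc d) f = ∑w d (λ x → f (zero ∷ x)) + ∑w d (λ x → f (suc zero ∷ x))

∑w-cong : ∀ d {f g : Word d → ℚ} → (∀ x → f x ≡ g x) → ∑w d f ≡ ∑w d g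
∑w-cong zero    f≡g = f≡g []
∑w-cong (suc d) f≡g = cong₂ _+_ (∑w-cong d (λ x → f≡g (zero ∷ x))) (∑w-cong d (λ x → f≡g (suc zero ∷ x)))

∑w-mono : ∀ d {f g : Word d → ℚ} → (∀ x → f x ≤ g x) → ∑w d f ≤ ∑w d g
∑w-mono zero    f≤g = f≤g []
∑w-mono (suc d) f≤g = ℚ.+-mono-≤ (∑w-mono d (λ x → f≤g (zero ∷ x))) (∑w-mono d (λ x → f≤g (suc zero ∷ x)))

∑w-nonneg : ∀ d {f : Word d → ℚ} → (∀ x → 0ℚ ≤ f x) → 0ℚ ≤ ∑w d f
∑w-nonneg zero    0≤f = 0≤f []
∑w-nonneg (suc d) 0≤f = 0≤+ (∑w-nonneg d (λ x → 0≤f (zero ∷ x))) (∑w-nonneg d (λ x → 0≤f (suc zero ∷ x)))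

∑w-zero : ∀ d {f : Word d → ℚ} → (∀ x → f x ≡ 0ℚ) → ∑w d f ≡ 0ℚ
∑w-zero zero    f≡0 = f≡0 []
∑w-zero (suc d) f≡0 = cong₂ _+_ (∑w-zero d (λ x → f≡0 (zero ∷ x))) (∑w-zero d (λ x → f≡0 (suc zero ∷ x)))

_at₀ _at₁ : ∀ {A : Set} {d} → (Word (suc d) → A) → Word d → A
(f at₀) x = f (zero ∷ x)
(f at₁) x = f (suc zero ∷ x)

sub : ∀ {d} → Fin 2 → Fin 2 → (Word (suc d) → Word (suc d) → ℚ) → Word d → Word d → ℚ
sub a b g x y = g (a ∷ x) (b ∷ y)

interchange : ∀ a b c d → a + b + (c + d) ≡ a + c + (b + d)
interchange = solve-∀ ring

∑w-+ : ∀ d (f g : Word d → ℚ) → ∑w d (λ x → f x + g x) ≡ ∑w d f + ∑w d g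
∑w-+ zero    f g = refl
∑w-+ (suc d) f g = trans (cong₂ _+_ (∑w-+ d (f at₀) (g at₀)) (∑w-+ d (f at₁) (g at₁)))
  (interchange (∑w d (f at₀)) (∑w d (g at₀)) (∑w d (f at₁)) (∑w d (g at₁)))

∑w-comm : ∀ c d (f : Word c → Word d → ℚ) → ∑w c (λ x → ∑w d (f x)) ≡ ∑w d (λ y → ∑w c (λ x → f x y))
∑w-comm zero    d f = refl
∑w-comm (suc c) d f = trans (cong₂ _+_ (∑w-comm c d (λ x → f (zero ∷ x))) (∑w-comm c d (λ x → f (suc zero ∷ x))))
  (sym (∑w-+ d (λ y → ∑w c (λ x → f (zero ∷ x) y)) (λ y → ∑w c (λ x → f (suc zero ∷ x) y))))

∑w-pick : ∀ d (c : Word d → Bool) (x₀ : Word d) → (∀ x → T (c x) → x ≡ x₀) → T (c x₀) → (f : Word d → ℚ) →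
  ∑w d (λ x → 𝟙 (c x) * f x) ≡ f x₀
∑w-pick zero c [] only here₀ f with c []
... | true = ℚ.*-identityˡ (f [])
∑w-pick (suc d) c (zero ∷ x₀) only here₀ f = trans (cong₂ _+_
    (∑w-pick d (λ x → c (zero ∷ x)) x₀ (λ x t → Vec.∷-injectiveʳ (only (zero ∷ x) t)) here₀ (λ x → f (zero ∷ x)))
    (∑w-zero d (λ x → trans (cong (λ b → 𝟙 b * f (suc zero ∷ x)) (bool-≡ {c (suc zero ∷ x)} {false} (λ t → absurd (only (suc zero ∷ x) t)) ⊥-elim)) (ℚ.*-zeroˡ (f (suc zero ∷ x))))))
  (ℚ.+-identityʳ (f (zero ∷ x₀)))
  where
  absurd : ∀ {x : Word d} {y} → (Fin 2 ∋ suc zero) ∷ x ≡ zero ∷ y → ⊥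
  absurd ()
∑w-pick (suc d) c (suc zero ∷ x₀) only here₀ f = trans (cong₂ _+_
    (∑w-zero d (λ x → trans (cong (λ b → 𝟙 b * f (zero ∷ x)) (bool-≡ {c (zero ∷ x)} {false} (λ t → absurd (only (zero ∷ x) t)) ⊥-elim)) (ℚ.*-zeroˡ (f (zero ∷ x)))))
    (∑w-pick d (λ x → c (suc zero ∷ x)) x₀ (λ x t → Vec.∷-injectiveʳ (only (suc zero ∷ x) t)) here₀ (λ x → f (suc zero ∷ x))))
  (ℚ.+-identityˡ (f (suc zero ∷ x₀)))
  where
  absurd : ∀ {x : Word d} {y} → (Fin 2 ∋ zero) ∷ x ≡ suc zero ∷ y → ⊥
  absurd ()

∑w-𝔼 : ∀ d (f : Word d → ℚ) → ∑w d f ≡ ⟨ 2 ^ d ⟩ * 𝔼 (Words d) f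
∑w-𝔼 zero f = trans (sym (ℚ.*-identityˡ (f []))) (cong (_* f []) (sym ⟨1⟩))
∑w-𝔼 (suc d) f = trans (cong₂ _+_ (∑w-𝔼 d f₀) (∑w-𝔼 d f₁)) (trans (double ⟨ 2 ^ d ⟩ (𝔼 (Words d) f₀) (𝔼 (Words d) f₁))
  (cong₂ _*_ (trans (sym (⟨⟩-+ (2 ^ d) (2 ^ d))) (cong (λ n → ⟨ 2 ^ d ℕ.+ n ⟩) (sym (ℕ.+-identityʳ (2 ^ d)))))
    (sym (𝔼-bit (λ b → 𝔼 (Words d) (λ x → f (b ∷ x)))))))
  where
  f₀ f₁ : Word d → ℚ
  f₀ x = f (zero ∷ x)
  f₁ x = f (suc zero ∷ x)
  double : ∀ t a b → t * a + t * b ≡ (t + t) * (½ * (a + b))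
  double = solve-∀ ring

sum-split : ∀ m {n} (f : Fin (m ℕ.+ n) → ℚ) → sum f ≡ sum (λ i → f (i Fin.↑ˡ n)) + sum (λ i → f (m Fin.↑ʳ i))
sum-split zero    f = sym (ℚ.+-identityˡ (sum f))
sum-split (suc m) {n} f = trans (cong (f zero +_) (sum-split m (f ∘ suc)))
  (sym (ℚ.+-assoc (f zero) (sum (λ i → f (suc (i Fin.↑ˡ n)))) (sum (λ i → f (suc m Fin.↑ʳ i)))))

sum-combine : ∀ a b (f : Fin (a ℕ.* b) → ℚ) → sum f ≡ sum (λ k → sum (λ i → f (Fin.combine {a} {b} k i)))
sum-combine zero    b f = refl
sum-combine (suc a) b f = trans (sum-split b f) (cong (sum (λ i → f (i Fin.↑ˡ (a ℕ.* b))) +_) (sum-combine a b (λ i → f (b Fin.↑ʳ i))))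

undigits : ∀ {d} → Word d → Fin (2 ^ d)
undigits         []      = zero
undigits {suc d} (b ∷ x) = Fin.combine b (undigits x)

sum-undigits : ∀ d (f : Fin (2 ^ d) → ℚ) → sum f ≡ ∑w d (f ∘ undigits)
sum-undigits zero    f = ℚ.+-identityʳ (f zero)
sum-undigits (suc d) f = trans (sum-combine 2 (2 ^ d) f) (cong₂ _+_ (sum-undigits d (λ k → f (Fin.combine {2} {2 ^ d} zero k)))
  (trans (ℚ.+-identityʳ (sum (λ k → f (Fin.combine {2} {2 ^ d} (suc zero) k)))) (sum-undigits d (λ k → f (Fin.combine {2} {2 ^ d} (suc zero) k)))))

digits-undigits : ∀ {d} (x : Word d) → digits d (undigits x) ≡ x
digits-undigits         []      = refl
digits-undigits {suc d} (b ∷ x) = cong₂ _∷_ (cong proj₁ (Fin.remQuot-combine b (undigits x)))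
  (trans (cong (digits d ∘ proj₂) (Fin.remQuot-combine b (undigits x))) (digits-undigits x))

combine-monoʳ-< : ∀ {m n} (a : Fin m) {k l : Fin n} → k Fin.< l → Fin.combine a k Fin.< Fin.combine a l
combine-monoʳ-< {m} {n} a {k} {l} k<l = subst₂ ℕ._<_ (sym (Fin.toℕ-combine a k)) (sym (Fin.toℕ-combine a l))
  (ℕ.+-monoʳ-< (n ℕ.* Fin.toℕ a) k<l)

undigits-mono : ∀ {d} {x y : Word d} → x ≺ y → undigits x Fin.< undigits y
undigits-mono {suc d} (here {x = x} {y}) = Fin.combine-monoˡ-< {2} {2 ^ d} {zero} {suc zero} (undigits x) (undigits y) (ℕ.s≤s ℕ.z≤n)
undigits-mono {suc d} (there {b = b} x≺y) = combine-monoʳ-< b (undigits-mono x≺y)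

module _ {d m : ℕ} where

  vtx : Word d → Fin m → Fin (2 ^ d ℕ.* m)
  vtx x i = Fin.combine (undigits x) i

  word-vtx : ∀ x i → word d m (vtx x i) ≡ x
  word-vtx x i = trans (cong (digits d ∘ proj₁) (Fin.remQuot-combine (undigits x) i)) (digits-undigits x)

  position-vtx : ∀ x i → position d m (vtx x i) ≡ i
  position-vtx x i = cong proj₂ (Fin.remQuot-combine (undigits x) i)

  vtx-mono-≺ : ∀ {x y} i j → x ≺ y → vtx x i Fin.< vtx y j
  vtx-mono-≺ i j x≺y = Fin.combine-monoˡ-< i j (undigits-mono x≺y)

  vtx-mono-< : ∀ x {i j} → i Fin.< j → vtx x i Fin.< vtx x j
  vtx-mono-< x i<j = combine-monoʳ-< (undigits x) i<j

  sum-vtx : (f : Fin (2 ^ d ℕ.* m) → ℚ) → sum f ≡ ∑w d (λ x → sum (λ i → f (vtx x i)))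
  sum-vtx f = trans (sum-combine (2 ^ d) m f) (sum-undigits d (λ k → sum (λ i → f (Fin.combine k i))))

≺-irrefl : ∀ {d} {x : Word d} → ¬ (x ≺ x)
≺-irrefl (there x≺x) = ≺-irrefl x≺x

≺⇒≢ : ∀ {d} {x y : Word d} → x ≺ y → x ≢ y
≺⇒≢ x≺x refl = ≺-irrefl x≺x

≺-compare : ∀ {d} (x y : Word d) → x ≺ y ⊎ x ≡ y ⊎ y ≺ x
≺-compare [] [] = inj₂ (inj₁ refl)
≺-compare (zero ∷ x) (suc zero ∷ y) = inj₁ here
≺-compare (suc zero ∷ x) (zero ∷ y) = inj₂ (inj₂ here)
≺-compare (zero ∷ x) (zero ∷ y) with ≺-compare x y
... | inj₁ x≺y        = inj₁ (there x≺y)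
... | inj₂ (inj₁ eq)  = inj₂ (inj₁ (cong (zero ∷_) eq))
... | inj₂ (inj₂ y≺x) = inj₂ (inj₂ (there y≺x))
≺-compare (suc zero ∷ x) (suc zero ∷ y) with ≺-compare x y
... | inj₁ x≺y        = inj₁ (there x≺y)
... | inj₂ (inj₁ eq)  = inj₂ (inj₁ (cong (suc zero ∷_) eq))
... | inj₂ (inj₂ y≺x) = inj₂ (inj₂ (there y≺x))

∑≺ : ∀ d → (Word d → Word d → ℚ) → ℚ
∑≺ zero    g = 0ℚ
∑≺ (suc d) g = ∑w d (λ x → ∑w d (λ y → g (zero ∷ x) (suc zero ∷ y))) +
  (∑≺ d (λ x y → g (zero ∷ x) (zero ∷ y)) + ∑≺ d (λ x y → g (suc zero ∷ x) (suc zero ∷ y)))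

∑≺-mono : ∀ d {f g : Word d → Word d → ℚ} → (∀ {x y} → x ≺ y → f x y ≤ g x y) → ∑≺ d f ≤ ∑≺ d g
∑≺-mono zero    f≤g = ℚ.≤-refl
∑≺-mono (suc d) f≤g = ℚ.+-mono-≤ (∑w-mono d (λ x → ∑w-mono d (λ y → f≤g here)))
  (ℚ.+-mono-≤ (∑≺-mono d (λ x≺y → f≤g (there x≺y))) (∑≺-mono d (λ x≺y → f≤g (there x≺y))))

∑≺-cong : ∀ d {f g : Word d → Word d → ℚ} → (∀ {x y} → x ≺ y → f x y ≡ g x y) → ∑≺ d f ≡ ∑≺ d g
∑≺-cong d f≡g = ℚ.≤-antisym (∑≺-mono d (ℚ.≤-reflexive ∘ f≡g)) (∑≺-mono d (ℚ.≤-reflexive ∘ sym ∘ f≡g))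

∑≺-zero : ∀ d → ∑≺ d (λ _ _ → 0ℚ) ≡ 0ℚ
∑≺-zero zero    = refl
∑≺-zero (suc d) = cong₂ _+_ (∑w-zero d (λ x → ∑w-zero d (λ y → refl))) (cong₂ _+_ (∑≺-zero d) (∑≺-zero d))

∑≺-nonneg : ∀ d {g : Word d → Word d → ℚ} → (∀ {x y} → x ≺ y → 0ℚ ≤ g x y) → 0ℚ ≤ ∑≺ d g
∑≺-nonneg d {g} 0≤g = subst (_≤ ∑≺ d g) (∑≺-zero d) (∑≺-mono d 0≤g)

∑w² : ∀ d → (Word d → Word d → ℚ) → ℚ
∑w² d g = ∑w d (λ x → ∑w d (g x))

∑w²-+ : ∀ d (f g : Word d → Word d → ℚ) → ∑w² d (λ x y → f x y + g x y) ≡ ∑w² d f + ∑w² d g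
∑w²-+ d f g = trans (∑w-cong d (λ x → ∑w-+ d (f x) (g x))) (∑w-+ d (λ x → ∑w d (f x)) (λ x → ∑w d (g x)))

∑≺-+ : ∀ d (f g : Word d → Word d → ℚ) → ∑≺ d (λ x y → f x y + g x y) ≡ ∑≺ d f + ∑≺ d g
∑≺-+ zero    f g = refl
∑≺-+ (suc d) f g = trans (cong₂ _+_ (∑w²-+ d (sub zero (suc zero) f) (sub zero (suc zero) g))
    (trans (cong₂ _+_ (∑≺-+ d (sub zero zero f) (sub zero zero g)) (∑≺-+ d (sub (suc zero) (suc zero) f) (sub (suc zero) (suc zero) g)))
      (interchange f₀ g₀ f₁ g₁)))
  (interchange (∑w² d (sub zero (suc zero) f)) (∑w² d (sub zero (suc zero) g)) (f₀ + f₁) (g₀ + g₁))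
  where
  f₀ f₁ g₀ g₁ : ℚ
  f₀ = ∑≺ d (sub zero zero f)
  f₁ = ∑≺ d (sub (suc zero) (suc zero) f)
  g₀ = ∑≺ d (sub zero zero g)
  g₁ = ∑≺ d (sub (suc zero) (suc zero) g)

∑w-* : ∀ d c (f : Word d → ℚ) → ∑w d (λ x → c * f x) ≡ c * ∑w d f
∑w-* zero    c f = refl
∑w-* (suc d) c f = trans (cong₂ _+_ (∑w-* d c (f at₀)) (∑w-* d c (f at₁))) (sym (ℚ.*-distribˡ-+ c (∑w d (f at₀)) (∑w d (f at₁))))

∑≺-* : ∀ d c (f : Word d → Word d → ℚ) → ∑≺ d (λ x y → c * f x y) ≡ c * ∑≺ d f
∑≺-* zero    c f = sym (ℚ.*-zeroʳ c)
∑≺-* (suc d) c f = trans (cong₂ _+_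
    (trans (∑w-cong d (λ x → ∑w-* d c (sub zero (suc zero) f x))) (∑w-* d c (λ x → ∑w d (sub zero (suc zero) f x))))
    (trans (cong₂ _+_ (∑≺-* d c (sub zero zero f)) (∑≺-* d c (sub (suc zero) (suc zero) f))) (sym (ℚ.*-distribˡ-+ c f₀ f₁))))
  (sym (ℚ.*-distribˡ-+ c (∑w² d (sub zero (suc zero) f)) (f₀ + f₁)))
  where
  f₀ f₁ : ℚ
  f₀ = ∑≺ d (sub zero zero f)
  f₁ = ∑≺ d (sub (suc zero) (suc zero) f)

∑w-single : ∀ d {f : Word d → ℚ} → (∀ x → 0ℚ ≤ f x) → ∀ x → f x ≤ ∑w d f
∑w-single zero 0≤f [] = ℚ.≤-refl
∑w-single (suc d) {f} 0≤f (zero ∷ x) = ℚ.≤-trans (∑w-single d (λ x → 0≤f (zero ∷ x)) x)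
  (≤-by (∑w d (λ x → f (suc zero ∷ x))) (∑w-nonneg d (λ x → 0≤f (suc zero ∷ x))) refl)
∑w-single (suc d) {f} 0≤f (suc zero ∷ x) = ℚ.≤-trans (∑w-single d (λ x → 0≤f (suc zero ∷ x)) x)
  (≤-by (∑w d (λ x → f (zero ∷ x))) (∑w-nonneg d (λ x → 0≤f (zero ∷ x))) (ℚ.+-comm (∑w d (f at₁)) (∑w d (f at₀))))

∑≺-single : ∀ {d} {g : Word d → Word d → ℚ} → (∀ {x y} → x ≺ y → 0ℚ ≤ g x y) → ∀ {x y} → x ≺ y → g x y ≤ ∑≺ d g
∑≺-single {suc d} {g} 0≤g {zero ∷ x} {suc zero ∷ y} here = ℚ.≤-trans
  (ℚ.≤-trans (∑w-single d (λ y → 0≤g here) y) (∑w-single d (λ x → ∑w-nonneg d (λ y → 0≤g here)) x))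
  (≤-by _ (0≤+ (∑≺-nonneg d (λ x≺y → 0≤g (there x≺y))) (∑≺-nonneg d (λ x≺y → 0≤g (there x≺y)))) refl)
∑≺-single {suc d} {g} 0≤g {zero ∷ x} {zero ∷ y} (there x≺y) = ℚ.≤-trans (∑≺-single (λ x≺y → 0≤g (there x≺y)) x≺y)
  (≤-by (a + c) (0≤+ (∑w-nonneg d (λ x → ∑w-nonneg d (λ y → 0≤g here))) (∑≺-nonneg d (λ x≺y → 0≤g (there x≺y)))) (reorder a b c))
  where
  a b c : ℚ
  a = ∑w d (λ x → ∑w d (λ y → g (zero ∷ x) (suc zero ∷ y)))
  b = ∑≺ d (λ x y → g (zero ∷ x) (zero ∷ y))
  c = ∑≺ d (λ x y → g (suc zero ∷ x) (suc zero ∷ y))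
  reorder : ∀ a b c → b + (a + c) ≡ a + (b + c)
  reorder = solve-∀ ring
∑≺-single {suc d} {g} 0≤g {suc zero ∷ x} {suc zero ∷ y} (there x≺y) = ℚ.≤-trans (∑≺-single (λ x≺y → 0≤g (there x≺y)) x≺y)
  (≤-by (a + b) (0≤+ (∑w-nonneg d (λ x → ∑w-nonneg d (λ y → 0≤g here))) (∑≺-nonneg d (λ x≺y → 0≤g (there x≺y)))) (reorder a b c))
  where
  a b c : ℚ
  a = ∑w d (λ x → ∑w d (λ y → g (zero ∷ x) (suc zero ∷ y)))
  b = ∑≺ d (λ x y → g (zero ∷ x) (zero ∷ y))
  c = ∑≺ d (λ x y → g (suc zero ∷ x) (suc zero ∷ y))
  reorder : ∀ a b c → c + (a + b) ≡ a + (b + c)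
  reorder = solve-∀ ring

∑w-pairs : ∀ d (g : Word d → Word d → ℚ) → ∑w² d g ≡ ∑≺ d g + ∑≺ d (λ x y → g y x) + ∑w d (λ x → g x x)
∑w-pairs zero    g = sym (ℚ.+-identityˡ (g [] []))
∑w-pairs (suc d) g = trans (cong₂ _+_
    (trans (∑w-+ d (λ x → ∑w d (sub zero zero g x)) (λ x → ∑w d (sub zero (suc zero) g x)))
      (cong (_+ ∑w² d (sub zero (suc zero) g)) (∑w-pairs d (sub zero zero g))))
    (trans (∑w-+ d (λ x → ∑w d (sub (suc zero) zero g x)) (λ x → ∑w d (sub (suc zero) (suc zero) g x)))
      (cong₂ _+_ (∑w-comm d d (sub (suc zero) zero g)) (∑w-pairs d (sub (suc zero) (suc zero) g)))))
  (reorder (∑w² d (sub zero (suc zero) g)) (∑w d (λ y → ∑w d (λ x → g (suc zero ∷ x) (zero ∷ y))))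
    (∑≺ d (sub zero zero g)) (∑≺ d (λ x y → sub zero zero g y x)) (∑w d (λ x → sub zero zero g x x))
    (∑≺ d (sub (suc zero) (suc zero) g)) (∑≺ d (λ x y → sub (suc zero) (suc zero) g y x)) (∑w d (λ x → sub (suc zero) (suc zero) g x x)))
  where
  reorder : ∀ u v a a′ da b b′ db → a + a′ + da + u + (v + (b + b′ + db)) ≡ u + (a + b) + (v + (a′ + b′)) + (da + db)
  reorder = solve-∀ ring

∑∑-vtx : ∀ {d m} (g : Fin (2 ^ d ℕ.* m) → Fin (2 ^ d ℕ.* m) → ℚ) →
  ∑∑ g ≡ ∑w d (λ x → ∑w d (λ y → ∑∑ (λ i j → g (vtx {d} {m} x i) (vtx {d} {m} y j))))
∑∑-vtx {d} {m} g = trans (sum-vtx {d} {m} (λ u → sum (g u))) (∑w-cong d (λ x → trans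
  (sum-cong-≗ (λ i → sum-vtx {d} {m} (g (vtx {d} {m} x i)))) (sum-∑w m (λ i y → sum (λ j → g (vtx {d} {m} x i) (vtx {d} {m} y j))))))
  where
  sum-∑w : ∀ n (f : Fin n → Word d → ℚ) → sum (λ i → ∑w d (f i)) ≡ ∑w d (λ y → sum (λ i → f i y))
  sum-∑w zero    f = sym (∑w-zero d (λ _ → refl))
  sum-∑w (suc n) f = trans (cong (∑w d (f zero) +_) (sum-∑w n (f ∘ suc))) (sym (∑w-+ d (f zero) (λ y → sum (λ i → f (suc i) y))))

∑∑-ordered : ∀ {d m} (g : Fin (2 ^ d ℕ.* m) → Fin (2 ^ d ℕ.* m) → ℚ) → (∀ u v → ¬ (u Fin.< v) → g u v ≡ 0ℚ) →
  ∑∑ g ≡ ∑≺ d (λ x y → ∑∑ (λ i j → g (vtx {d} {m} x i) (vtx {d} {m} y j))) + ∑w d (λ x → ∑∑ (λ i j → g (vtx {d} {m} x i) (vtx {d} {m} x j)))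
∑∑-ordered {d} {m} g g≡0 = trans (∑∑-vtx {d} {m} g) (trans (∑w-pairs d G)
  (cong (_+ ∑w d (λ x → G x x)) (trans (cong (∑≺ d G +_) backward) (ℚ.+-identityʳ (∑≺ d G)))))
  where
  G : Word d → Word d → ℚ
  G x y = ∑∑ (λ i j → g (vtx {d} {m} x i) (vtx {d} {m} y j))
  backward : ∑≺ d (λ x y → G y x) ≡ 0ℚ
  backward = trans (∑≺-cong d {λ x y → G y x} {λ _ _ → 0ℚ} (λ x≺y → sum-zero (λ i → sum-zero (λ j →
    g≡0 _ _ (λ lt → ℕ.<-asym lt (vtx-mono-≺ j i x≺y)))))) (∑≺-zero d)

-- Edge densities between blocks

abstract
  prob : ℕ → ℚ
  prob k = 1 ÷ (2 ^ k)

  prob-÷ : ∀ k → prob k ≡ 1 ÷ (2 ^ k)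
  prob-÷ k = refl

  prob-* : ∀ k → prob k * ⟨ 2 ^ k ⟩ ≡ 1ℚ
  prob-* k = trans (÷-cancel 1 (2 ^ k) ⦃ ℕ.m^n≢0 2 k ⦄) ⟨1⟩

  0≤prob : ∀ k → 0ℚ ≤ prob k
  0≤prob k = 0≤÷ 1 (2 ^ k)

prob≤1 : ∀ k → prob k ≤ 1ℚ
prob≤1 k = subst₂ _≤_ (ℚ.*-identityʳ (prob k)) (prob-* k)
  (*-monoˡ (0≤prob k) (subst (_≤ ⟨ 2 ^ k ⟩) ⟨1⟩ (⟨⟩-mono (ℕ.m^n>0 2 k))))

density : ∀ {d} → Word d → Word d → ℚ
density {d} x y = prob (d ∸ δ x y)

∑w²-𝔼 : ∀ d (f : Word d → Word d → ℚ) → ∑w² d f ≡ ⟨ 2 ^ d ⟩ * ⟨ 2 ^ d ⟩ * 𝔼 (Words d) (λ x → 𝔼 (Words d) (f x))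
∑w²-𝔼 d f = trans (∑w-cong d (λ x → ∑w-𝔼 d (f x))) (trans (∑w-* d ⟨ 2 ^ d ⟩ (λ x → 𝔼 (Words d) (f x)))
  (trans (cong (⟨ 2 ^ d ⟩ *_) (∑w-𝔼 d (λ x → 𝔼 (Words d) (f x)))) (sym (ℚ.*-assoc ⟨ 2 ^ d ⟩ ⟨ 2 ^ d ⟩ _))))

∑lev : ∀ d → (Word d → Word d → ℚ) → ℚ
∑lev d g = sum {d} (λ ℓ → lev d g (Fin.toℕ ℓ))

-- Each level carries the same total weight 2^(d-1).
∑≺-density : ∀ d (g : Word d → Word d → ℚ) → ∑≺ d (λ x y → density x y * g x y) ≡ ⟨ 2 ^ (d ∸ 1) ⟩ * ∑lev d g
∑≺-density zero    g = sym (ℚ.*-zeroʳ ⟨ 1 ⟩)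
∑≺-density (suc d) g = trans (cong₂ _+_ first (cong₂ _+_ (∑≺-density d g₀) (∑≺-density d g₁)))
    (trans (cong (⟨ 2 ^ d ⟩ * a +_) (rest d g₀ g₁)) (trans (sym (ℚ.*-distribˡ-+ ⟨ 2 ^ d ⟩ a (½ * (∑lev d g₀ + ∑lev d g₁))))
      (cong (λ s → ⟨ 2 ^ d ⟩ * (a + s)) (sym deeper))))
  where
  g₀ g₁ : Word d → Word d → ℚ
  g₀ = sub zero zero g
  g₁ = sub (suc zero) (suc zero) g
  a : ℚ
  a = 𝔼 (Words d) (λ x → 𝔼 (Words d) (λ y → g (zero ∷ x) (suc zero ∷ y)))
  first : ∑w² d (λ x y → prob d * g (zero ∷ x) (suc zero ∷ y)) ≡ ⟨ 2 ^ d ⟩ * a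
  first = trans (∑w-cong d (λ x → ∑w-* d (prob d) (sub zero (suc zero) g x)))
    (trans (∑w-* d (prob d) (λ x → ∑w d (sub zero (suc zero) g x)))
    (trans (cong (prob d *_) (∑w²-𝔼 d (sub zero (suc zero) g))) (trans (regroup (prob d) ⟨ 2 ^ d ⟩ a)
      (trans (cong (λ x → x * (⟨ 2 ^ d ⟩ * a)) (prob-* d)) (ℚ.*-identityˡ (⟨ 2 ^ d ⟩ * a))))))
    where
    regroup : ∀ p t a → p * (t * t * a) ≡ p * t * (t * a)
    regroup = solve-∀ ring
  rest : ∀ d (g₀ g₁ : Word d → Word d → ℚ) → ⟨ 2 ^ (d ∸ 1) ⟩ * ∑lev d g₀ + ⟨ 2 ^ (d ∸ 1) ⟩ * ∑lev d g₁ ≡ ⟨ 2 ^ d ⟩ * (½ * (∑lev d g₀ + ∑lev d g₁))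
  rest zero    g₀ g₁ = trans (cong₂ _+_ (ℚ.*-zeroʳ ⟨ 1 ⟩) (ℚ.*-zeroʳ ⟨ 1 ⟩)) (sym (ℚ.*-zeroʳ ⟨ 1 ⟩))
  rest (suc d) g₀ g₁ = trans (double ⟨ 2 ^ d ⟩ (∑lev (suc d) g₀) (∑lev (suc d) g₁)) (cong (_* (½ * (∑lev (suc d) g₀ + ∑lev (suc d) g₁)))
    (trans (sym (⟨⟩-+ (2 ^ d) (2 ^ d))) (cong (λ n → ⟨ 2 ^ d ℕ.+ n ⟩) (sym (ℕ.+-identityʳ (2 ^ d))))))
    where
    double : ∀ t a b → t * a + t * b ≡ (t + t) * (½ * (a + b))
    double = solve-∀ ring
  deeper : sum {d} (λ ℓ → lev (suc d) g (suc (Fin.toℕ ℓ))) ≡ ½ * (∑lev d g₀ + ∑lev d g₁)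
  deeper = trans (sym (𝔼-sum (uniform 1) {d} (λ ℓ b → lev d (sub b b g) (Fin.toℕ ℓ)))) (𝔼-bit (λ b → ∑lev d (sub b b g)))

-- The total density over all pairs of blocks, so that R(m,d) has about `T-size d` times m² edges.
T-size : ℕ → ℚ
T-size d = ⟨ d ℕ.* 2 ^ (d ∸ 1) ⟩

∑≺-density-total : ∀ d → ∑≺ d density ≡ T-size d
∑≺-density-total d = trans (∑≺-cong d (λ {x} {y} _ → sym (ℚ.*-identityʳ (density x y)))) (trans (∑≺-density d (λ _ _ → 1ℚ))
  (trans (cong (⟨ 2 ^ (d ∸ 1) ⟩ *_) (trans (sum-cong-≗ (λ ℓ → lev-one d (Fin.toℕ ℓ) (Fin.toℕ<n ℓ))) (trans (sum-const d 1ℚ) (ℚ.*-identityʳ ⟨ d ⟩))))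
    (trans (ℚ.*-comm ⟨ 2 ^ (d ∸ 1) ⟩ ⟨ d ⟩) (sym (⟨⟩-* d (2 ^ (d ∸ 1)))))))
  where
  lev-one : ∀ d ℓ → ℓ ℕ.< d → lev d (λ _ _ → 1ℚ) ℓ ≡ 1ℚ
  lev-one (suc d) zero    _           = trans (𝔼-cong (Words d) (λ x → 𝔼-const (Words d) 1ℚ)) (𝔼-const (Words d) 1ℚ)
  lev-one (suc d) (suc ℓ) (ℕ.s≤s ℓ<d) = trans (𝔼-cong (uniform 1) (λ b → lev-one d ℓ ℓ<d)) (𝔼-const (uniform 1) 1ℚ)

edge : ∀ {n} → OrderedGraph n → Fin n → Fin n → Bool
edge G u v = does (u Fin.<? v) ∧ adj G u v

⟨e⟩ : ∀ {n} (G : OrderedGraph n) → ⟨ e G ⟩ ≡ ∑∑ (λ u v → 𝟙 (edge G u v))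
⟨e⟩ {n} G = length-pairs n (edge? G)

edge-≮ : ∀ {n} (G : OrderedGraph n) u v → ¬ (u Fin.< v) → edge G u v ≡ false
edge-≮ G u v u≮v = bool-≡ (λ t → u≮v (does-T (u Fin.<? v) (proj₁ (T-∧⁻ t)))) ⊥-elim

edge-< : ∀ {n} (G : OrderedGraph n) {u v} → u Fin.< v → edge G u v ≡ adj G u v
edge-< G {u} {v} u<v = bool-≡ (λ t → proj₂ (T-∧⁻ {does (u Fin.<? v)} t)) (T-∧ (T-does (u Fin.<? v) u<v))

δ-refl : ∀ {d} (x : Word d) → δ x x ≡ suc d
δ-refl []             = refl
δ-refl (zero ∷ x)     = cong suc (δ-refl x)
δ-refl (suc zero ∷ x) = cong suc (δ-refl x)

∑∑-𝔼 : ∀ m (f : Fin (suc m) → Fin (suc m) → ℚ) → ∑∑ f ≡ ⟨ suc m ⟩ * ⟨ suc m ⟩ * 𝔼 (uniform m) (λ i → 𝔼 (uniform m) (f i))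
∑∑-𝔼 m f = trans (sum-cong-≗ (λ i → uniform-sum m (f i))) (trans (sym (*-distribˡ-sum ⟨ suc m ⟩ (λ i → 𝔼 (uniform m) (f i))))
  (trans (cong (⟨ suc m ⟩ *_) (uniform-sum m (λ i → 𝔼 (uniform m) (f i)))) (sym (ℚ.*-assoc ⟨ suc m ⟩ ⟨ suc m ⟩ (𝔼 (uniform m) (λ i → 𝔼 (uniform m) (f i)))))))

module _ {d M′ : ℕ} where

  private
    M : ℕ
    M = suc M′
    U : Average (Fin M)
    U = uniform M′

  between : OrderedGraph (2 ^ d ℕ.* M) → Word d → Word d → Fin M → Fin M → Bool
  between R x y i j = adj R (vtx {d} {M} x i) (vtx {d} {M} y j)

  withinBlocks : OrderedGraph (2 ^ d ℕ.* M) → ℚ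
  withinBlocks R = ∑w d (λ x → ∑∑ (λ i j → 𝟙 (edge R (vtx {d} {M} x i) (vtx {d} {M} x j))))

  ⟨e⟩-blocks : ∀ R → ⟨ e R ⟩ ≡ ∑≺ d (λ x y → ∑∑ (λ i j → 𝟙 (between R x y i j))) + withinBlocks R
  ⟨e⟩-blocks R = trans (⟨e⟩ R) (trans (∑∑-ordered {d} {M} (λ u v → 𝟙 (edge R u v)) (λ u v u≮v → cong 𝟙 (edge-≮ R u v u≮v)))
    (cong (_+ withinBlocks R) (∑≺-cong d (λ x≺y → ∑∑-cong (λ i j → cong 𝟙 (edge-< R (vtx-mono-≺ {d} {M} i j x≺y)))))))

-- What the conditions on R(m,d) yield for large m. `cut` is two-sided although densities are
-- assumed to be bounded from above only. `within` makes the edges inside blocks negligible, on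
-- which the conditions bear only through the total number of edges.
record Regular (d M′ : ℕ) (R : OrderedGraph (2 ^ d ℕ.* suc M′)) (ε : ℚ) : Set where
  private
    N : ℚ
    N = ⟨ suc M′ ⟩
  field
    cut : ∀ {x y : Word d} → x ≺ y → ∀ (α β : Fin (suc M′) → Bool) →
      𝔼 (uniform M′) (λ i → 𝔼 (uniform M′) (λ j → 𝟙 (α i ∧ β j) * (𝟙 (between {d} {M′} R x y i j) - density x y))) ≈⟨ ε ⟩ 0ℚ
    within : withinBlocks {d} {M′} R ≤ ε * (N * N)
    size≥  : (1ℚ - ε) * (T-size d * (N * N)) ≤ ⟨ e R ⟩
    size≤  : ⟨ e R ⟩ ≤ (1ℚ + ε) * (T-size d * (N * N))

-- Quasirandomness of R(m,d)

⟨∣∣⟩ : ∀ {n} (P : Subset n) → ⟨ ∣ P ∣ ⟩ ≡ sum (λ u → 𝟙 (lookup P u))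
⟨∣∣⟩ []          = ⟨0⟩
⟨∣∣⟩ (true ∷ P)  = trans (⟨⟩-suc ∣ P ∣) (cong (1ℚ +_) (⟨∣∣⟩ P))
⟨∣∣⟩ (false ∷ P) = trans (⟨∣∣⟩ P) (sym (ℚ.+-identityˡ (sum (λ u → 𝟙 (lookup P u)))))

does-∈? : ∀ {n} (u : Fin n) (P : Subset n) → does (u ∈? P) ≡ lookup P u
does-∈? zero    (true ∷ P)  = refl
does-∈? zero    (false ∷ P) = refl
does-∈? (suc u) (_ ∷ P)     = does-∈? u P

-- For the sets below the threshold M^(2/3), which escape the density hypothesis: (c P)³ < c³ M² ≤
-- M³ when c > 0.
few : ∀ c P M → c ℕ.^ 3 ℕ.≤ M → P ^ 3 ℕ.< M ^ 2 → c ℕ.* P ℕ.≤ M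
few zero    P M _    _   = ℕ.z≤n
few (suc c) P M c³≤M P³< with suc c ℕ.* P ℕ.≤? M
... | yes cP≤M = cP≤M
... | no  cP≰M = ⊥-elim (ℕ.<-irrefl refl (ℕ.<-≤-trans
  (ℕ.*-monoʳ-< (suc c ^ 3) ⦃ ℕ.m^n≢0 (suc c) 3 ⦄ P³<)
  (ℕ.≤-trans (ℕ.*-monoˡ-≤ (M ^ 2) c³≤M) (ℕ.≤-trans (ℕ.^-monoˡ-≤ 3 (ℕ.<⇒≤ (ℕ.≰⇒> cP≰M)))
    (ℕ.≤-reflexive (cube (suc c) P))))))
  where
  cube : ∀ c P → (c ℕ.* P) ℕ.* ((c ℕ.* P) ℕ.* ((c ℕ.* P) ℕ.* 1)) ≡ (c ℕ.* (c ℕ.* (c ℕ.* 1))) ℕ.* (P ℕ.* (P ℕ.* (P ℕ.* 1)))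
  cube = ℕ-solve-∀

-- A common bound for all losses, in units of the given accuracy: `lower-cut` costs the number of
-- pairs of blocks plus `T-size d` plus 1, and the edges within blocks cost twice `T-size d`.
cutConstant : ℕ → ℚ
cutConstant d = ∑≺ d (λ _ _ → 1ℚ) + (T-size d + (T-size d + (1ℚ + 1ℚ)))

0≤T-size : ∀ d → 0ℚ ≤ T-size d
0≤T-size d = 0≤⟨⟩ (d ℕ.* 2 ^ (d ∸ 1))

0≤1 : 0ℚ ≤ 1ℚ
0≤1 = ℚ.nonNegative⁻¹ 1ℚ

0≤∑≺1 : ∀ d → 0ℚ ≤ ∑≺ d (λ _ _ → 1ℚ)
0≤∑≺1 d = ∑≺-nonneg d {λ _ _ → 1ℚ} (λ _ → 0≤1)

module FromConditions (d M′ k : ℕ) (R : OrderedGraph (2 ^ d ℕ.* suc M′)) (cond : Conditions (suc M′) d (inv k) R)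
  (large : suc k ℕ.^ 3 ℕ.≤ suc M′) where

  open Conditions cond

  private
    M : ℕ
    M = suc M′
    U : Average (Fin M)
    U = uniform M′
    N ι τ : ℚ
    N = ⟨ M ⟩
    ι = inv k
    τ = T-size d
    vt : Word d → Fin M → Fin (2 ^ d ℕ.* M)
    vt = vtx {d} {M}
    adjacent : Word d → Word d → Fin M → Fin M → Bool
    adjacent = between {d} {M′} R
    0≤N : 0ℚ ≤ N
    0≤N = 0≤⟨⟩ M
    0≤ι : 0ℚ ≤ ι
    0≤ι = 0≤inv k

  isWord : Word d → Word d → Bool
  isWord x y = does (Vec.≡-dec Fin._≟_ y x)

  part : Word d → (Fin M → Bool) → Subset (2 ^ d ℕ.* M)
  part x α = Vec.tabulate (λ u → isWord x (word d M u) ∧ α (position d M u))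

  lookup-part : ∀ x α y i → lookup (part x α) (vt y i) ≡ isWord x y ∧ α i
  lookup-part x α y i = trans (Vec.lookup∘tabulate (λ u → isWord x (word d M u) ∧ α (position d M u)) (vt y i))
    (cong₂ (λ z j → isWord x z ∧ α j) (word-vtx {d} {M} y i) (position-vtx {d} {M} y i))

  ∑w-isWord : ∀ x (f : Word d → ℚ) → ∑w d (λ y → 𝟙 (isWord x y) * f y) ≡ f x
  ∑w-isWord x f = ∑w-pick d (isWord x) x (λ y → does-T (Vec.≡-dec Fin._≟_ y x)) (T-does (Vec.≡-dec Fin._≟_ x x) refl) f

  ⟨∣part∣⟩ : ∀ x α → ⟨ ∣ part x α ∣ ⟩ ≡ sum (𝟙 ∘ α)
  ⟨∣part∣⟩ x α = trans (⟨∣∣⟩ (part x α)) (trans (sum-vtx {d} {M} (λ u → 𝟙 (lookup (part x α) u)))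
    (trans (∑w-cong d (λ y → trans (sum-cong-≗ (λ i → trans (cong 𝟙 (lookup-part x α y i)) (𝟙-∧ (isWord x y) (α i))))
      (sym (*-distribˡ-sum (𝟙 (isWord x y)) (𝟙 ∘ α))))) (∑w-isWord x (λ _ → sum (𝟙 ∘ α)))))

  part⊆block : ∀ x α {u} → u Data.Fin.Subset.∈ part x α → u Data.Fin.Subset.∈ block d M x
  part⊆block x α {u} u∈ = Vec.lookup⇒[]= u (block d M x) (trans (Vec.lookup∘tabulate (λ u → isWord x (word d M u)) u)
    (first (trans (sym (Vec.lookup∘tabulate (λ u → isWord x (word d M u) ∧ α (position d M u)) u)) (Vec.[]=⇒lookup u∈))))
    where
    first : ∀ {a b} → a ∧ b ≡ true → a ≡ true
    first {true} _ = refl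

  eBetween-parts : ∀ x y α β → ⟨ eBetween R (part x α) (part y β) ⟩ ≡ ∑∑ (λ i j → 𝟙 (α i ∧ β j) * 𝟙 (adjacent x y i j))
  eBetween-parts x y α β = trans (length-pairs (2 ^ d ℕ.* M) _) (trans (∑∑-vtx {d} {M} (λ u v → 𝟙 (does (u ∈? P) ∧ (does (v ∈? Q) ∧ adj R u v))))
    (trans (∑w-cong d (λ x′ → trans (∑w-cong d (λ y′ → trans (∑∑-cong (pointwise x′ y′)) (factor (𝟙 (isWord x x′) * 𝟙 (isWord y y′)) (G x′ y′)))) (pull x′)))
      (∑w-isWord x (λ x′ → ∑∑ (G x′ y)))))
    where
    P Q : Subset (2 ^ d ℕ.* M)
    P = part x α
    Q = part y β
    G : Word d → Word d → Fin M → Fin M → ℚ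
    G x′ y′ i j = 𝟙 (α i ∧ β j) * 𝟙 (adjacent x′ y′ i j)
    pull : ∀ x′ → ∑w d (λ y′ → 𝟙 (isWord x x′) * 𝟙 (isWord y y′) * ∑∑ (G x′ y′)) ≡ 𝟙 (isWord x x′) * ∑∑ (G x′ y)
    pull x′ = trans (∑w-cong d (λ y′ → ℚ.*-assoc (𝟙 (isWord x x′)) (𝟙 (isWord y y′)) (∑∑ (G x′ y′))))
      (trans (∑w-* d (𝟙 (isWord x x′)) (λ y′ → 𝟙 (isWord y y′) * ∑∑ (G x′ y′))) (cong (𝟙 (isWord x x′) *_) (∑w-isWord y (λ y′ → ∑∑ (G x′ y′)))))
    factor : ∀ c (g : Fin M → Fin M → ℚ) → ∑∑ (λ i j → c * g i j) ≡ c * ∑∑ g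
    factor c g = sym (trans (*-distribˡ-sum c (λ i → sum (g i))) (sum-cong-≗ (λ i → *-distribˡ-sum c (g i))))
    pointwise : ∀ x′ y′ i j → 𝟙 (does (vt x′ i ∈? P) ∧ (does (vt y′ j ∈? Q) ∧ adj R (vt x′ i) (vt y′ j))) ≡
      𝟙 (isWord x x′) * 𝟙 (isWord y y′) * G x′ y′ i j
    pointwise x′ y′ i j = trans (cong₂ (λ a b → 𝟙 (a ∧ (b ∧ adjacent x′ y′ i j))) (trans (does-∈? (vt x′ i) P) (lookup-part x α x′ i))
        (trans (does-∈? (vt y′ j) Q) (lookup-part y β y′ j)))
      (expand (isWord x x′) (α i) (isWord y y′) (β j) (adjacent x′ y′ i j))
      where
      reorder : ∀ a b c d e → a * b * (c * d * e) ≡ a * c * (b * d * e)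
      reorder = solve-∀ ring
      expand : ∀ a b c d e → 𝟙 ((a ∧ b) ∧ ((c ∧ d) ∧ e)) ≡ 𝟙 a * 𝟙 c * (𝟙 (b ∧ d) * 𝟙 e)
      expand a b c d e = trans (𝟙-∧ (a ∧ b) ((c ∧ d) ∧ e)) (trans (cong₂ _*_ (𝟙-∧ a b) (trans (𝟙-∧ (c ∧ d) e) (cong (_* 𝟙 e) (𝟙-∧ c d))))
        (trans (reorder (𝟙 a) (𝟙 b) (𝟙 c) (𝟙 d) (𝟙 e)) (cong (λ z → 𝟙 a * 𝟙 c * (z * 𝟙 e)) (sym (𝟙-∧ b d)))))

  area : (Fin M → Bool) → (Fin M → Bool) → ℚ
  area α β = sum (𝟙 ∘ α) * sum (𝟙 ∘ β)

  area≡ : ∀ α β → ∑∑ (λ i j → 𝟙 (α i ∧ β j)) ≡ area α β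
  area≡ α β = trans (sum-cong-≗ (λ i → trans (sum-cong-≗ (λ j → 𝟙-∧ (α i) (β j))) (trans (sym (*-distribˡ-sum (𝟙 (α i)) (𝟙 ∘ β)))
      (ℚ.*-comm (𝟙 (α i)) (sum (𝟙 ∘ β))))))
    (trans (sym (*-distribˡ-sum (sum (𝟙 ∘ β)) (𝟙 ∘ α))) (ℚ.*-comm (sum (𝟙 ∘ β)) (sum (𝟙 ∘ α))))

  0≤size : ∀ (α : Fin M → Bool) → 0ℚ ≤ sum (𝟙 ∘ α)
  0≤size α = sum-nonneg {M} {𝟙 ∘ α} (λ i → 0≤𝟙 (α i))

  size≤N : ∀ (α : Fin M → Bool) → sum (𝟙 ∘ α) ≤ N
  size≤N α = subst (sum (𝟙 ∘ α) ≤_) (trans (sum-const M 1ℚ) (ℚ.*-identityʳ N)) (sum-mono (λ i → 𝟙≤1 (α i)))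

  scale : ∀ {c x} → N * N * x ≤ c * (N * N) → x ≤ c
  scale {c} {x} le = *-cancelˡ (0<* (0<⟨⟩ M) (0<⟨⟩ M)) (ℚ.≤-trans le (ℚ.≤-reflexive (ℚ.*-comm c (N * N))))

  module _ {x y : Word d} (x≺y : x ≺ y) where

    private
      p : ℚ
      p = density x y
      0≤p : 0ℚ ≤ p
      0≤p = 0≤prob (d ∸ δ x y)
      p≤1 : p ≤ 1ℚ
      p≤1 = prob≤1 (d ∸ δ x y)

    D : Fin M → Fin M → ℚ
    D i j = 𝟙 (adjacent x y i j) - p

    E : (Fin M → Bool) → (Fin M → Bool) → ℚ
    E α β = 𝔼 U (λ i → 𝔼 U (λ j → 𝟙 (α i ∧ β j) * D i j))

    edges-in : (Fin M → Bool) → (Fin M → Bool) → ℚ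
    edges-in α β = ∑∑ (λ i j → 𝟙 (α i ∧ β j) * 𝟙 (adjacent x y i j))

    E≡ : ∀ α β → N * N * E α β ≡ edges-in α β - p * area α β
    E≡ α β = trans (sym (∑∑-𝔼 M′ (λ i j → 𝟙 (α i ∧ β j) * D i j))) (trans (sum-cong-≗ (λ i → trans
        (sum-cong-≗ (λ j → split (𝟙 (α i ∧ β j)) (𝟙 (adjacent x y i j)) p)) (trans (∑-distrib-+ (λ j → 𝟙 (α i ∧ β j) * 𝟙 (adjacent x y i j)) (λ j → (- p) * 𝟙 (α i ∧ β j)))
          (cong (sum (λ j → 𝟙 (α i ∧ β j) * 𝟙 (adjacent x y i j)) +_) (sym (*-distribˡ-sum (- p) (λ j → 𝟙 (α i ∧ β j))))))))
      (trans (∑-distrib-+ (λ i → sum (λ j → 𝟙 (α i ∧ β j) * 𝟙 (adjacent x y i j))) (λ i → (- p) * sum (λ j → 𝟙 (α i ∧ β j))))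
        (cong (edges-in α β +_) (trans (sym (*-distribˡ-sum (- p) (λ i → sum (λ j → 𝟙 (α i ∧ β j))))) (trans (cong ((- p) *_) (area≡ α β))
          (sym (ℚ.neg-distribˡ-* p (area α β))))))))
      where
      split : ∀ b r p → b * (r - p) ≡ b * r + (- p) * b
      split = solve-∀ ring

    small-area : ∀ α β → area α β ≤ ι * (N * N) → E α β ≤ ι
    small-area α β small = scale (ℚ.≤-trans (ℚ.≤-reflexive (E≡ α β)) (ℚ.≤-trans (≤-by (p * area α β) (0≤* 0≤p (0≤* (0≤size α) (0≤size β)))
        (cancel (edges-in α β) (p * area α β))) (ℚ.≤-trans
          (ℚ.≤-trans (∑∑-mono (λ i j → subst (𝟙 (α i ∧ β j) * 𝟙 (adjacent x y i j) ≤_) (ℚ.*-identityʳ (𝟙 (α i ∧ β j)))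
            (*-monoˡ (0≤𝟙 (α i ∧ β j)) (𝟙≤1 (adjacent x y i j))))) (ℚ.≤-reflexive (area≡ α β))) small)))
      where
      cancel : ∀ a b → a - b + b ≡ a
      cancel = solve-∀ ring

    small-side : ∀ z α → ∣ part z α ∣ ^ 3 ℕ.< M ^ 2 → sum (𝟙 ∘ α) ≤ ι * N
    small-side z α lt = *-cancelˡ (0<⟨⟩ (suc k)) (subst₂ _≤_ (trans (⟨⟩-* (suc k) ∣ part z α ∣) (cong (⟨ suc k ⟩ *_) (⟨∣part∣⟩ z α)))
      (trans (sym (ℚ.*-identityˡ N)) (trans (cong (_* N) (sym (inv-* k))) (reorder ι ⟨ suc k ⟩ N))) (⟨⟩-mono (few (suc k) ∣ part z α ∣ M large lt)))
      where
      reorder : ∀ a b c → a * b * c ≡ b * (a * c)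
      reorder = solve-∀ ring

    area≤N² : ∀ α β → area α β ≤ N * N
    area≤N² α β = *-mono 0≤N (0≤size β) (size≤N α) (size≤N β)

    -- If one of the sets is below the threshold, the rectangle has area at most ιN² and the trivial
    -- bound suffices. Otherwise the density hypothesis allows an excess of ι p |P| |Q| ≤ ιN².
    upper-cut : ∀ α β → E α β ≤ ι
    upper-cut α β with M ^ 2 ℕ.≤? ∣ part x α ∣ ^ 3 | M ^ 2 ℕ.≤? ∣ part y β ∣ ^ 3
    ... | no P-small | _ = small-area α β (ℚ.≤-trans (*-mono (0≤* 0≤ι 0≤N) (0≤size β) (small-side x α (ℕ.≰⇒> P-small)) (size≤N β))
        (ℚ.≤-reflexive (ℚ.*-assoc ι N N)))
    ... | yes _ | no Q-small = small-area α β (ℚ.≤-trans (*-mono 0≤N (0≤size β) (size≤N α) (small-side y β (ℕ.≰⇒> Q-small)))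
        (ℚ.≤-reflexive (reorder N ι)))
      where
      reorder : ∀ n i → n * (i * n) ≡ i * (n * n)
      reorder = solve-∀ ring
    ... | yes P-big | yes Q-big = scale (ℚ.≤-trans (ℚ.≤-reflexive (E≡ α β)) (≤-by rest 0≤rest (collect (edges-in α β) p (area α β) ι (N * N))))
      where
      dens : edges-in α β ≤ (1ℚ + ι) * p * area α β
      dens = subst₂ _≤_ (trans (sym (⟨⟩-ℕ→ℚ (eBetween R (part x α) (part y β)))) (eBetween-parts x y α β))
        (cong₂ (λ a b → (1ℚ + ι) * a * b) (sym (prob-÷ (d ∸ δ x y))) (trans (sym (⟨⟩-ℕ→ℚ (∣ part x α ∣ ℕ.* ∣ part y β ∣)))
          (trans (⟨⟩-* ∣ part x α ∣ ∣ part y β ∣) (cong₂ _*_ (⟨∣part∣⟩ x α) (⟨∣part∣⟩ y β)))))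
        (upper-density x y (≺⇒≢ x≺y) (part x α) (part y β) (part⊆block x α) (part⊆block y β) P-big Q-big)
      rest : ℚ
      rest = ((1ℚ + ι) * p * area α β - edges-in α β) + ι * (N * N - p * area α β)
      0≤rest : 0ℚ ≤ rest
      0≤rest = 0≤+ (0≤- dens) (0≤* 0≤ι (0≤- (ℚ.≤-trans (*-monoʳ (0≤* (0≤size α) (0≤size β)) p≤1)
        (subst (_≤ N * N) (sym (ℚ.*-identityˡ (area α β))) (area≤N² α β)))))
      collect : ∀ x p a i n → x - p * a + (((1ℚ + i) * p * a - x) + i * (n - p * a)) ≡ i * n
      collect = solve-∀ ring

  at-most-one-level : ∀ d n → sum {d} (λ ℓ → 𝟙 (does (n ℕ.≟ suc (Fin.toℕ ℓ)))) ≤ 1ℚ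
  at-most-one-level d n = subst (_≤ 1ℚ) (sym (sum-atMostOne {d} (λ ℓ → does (n ℕ.≟ suc (Fin.toℕ ℓ))) (does (Fin.any? has)) uniq
      (λ ℓ t → T-does (Fin.any? has) (ℓ , does-T (n ℕ.≟ suc (Fin.toℕ ℓ)) t))
      (λ t → let ℓ , eq = does-T (Fin.any? has) t in ℓ , T-does (n ℕ.≟ suc (Fin.toℕ ℓ)) eq)))
    (𝟙≤1 (does (Fin.any? has)))
    where
    has : (ℓ : Fin d) → Dec (n ≡ suc (Fin.toℕ ℓ))
    has ℓ = n ℕ.≟ suc (Fin.toℕ ℓ)
    uniq : ∀ ℓ ℓ′ → T (does (has ℓ)) → T (does (has ℓ′)) → ℓ ≡ ℓ′
    uniq ℓ ℓ′ t t′ = Fin.toℕ-injective (ℕ.suc-injective (trans (sym (does-T (has ℓ) t)) (does-T (has ℓ′) t′)))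

  no-level : ∀ d → sum {d} (λ ℓ → 𝟙 (does (suc d ℕ.≟ suc (Fin.toℕ ℓ)))) ≡ 0ℚ
  no-level d = sum-zero {d} (λ ℓ → cong 𝟙 (bool-≡ (λ t → ℕ.<-irrefl (sym (ℕ.suc-injective (does-T (suc d ℕ.≟ suc (Fin.toℕ ℓ)) t))) (Fin.toℕ<n ℓ)) ⊥-elim))

  crossing : ℚ
  crossing = ∑≺ d (λ x y → ∑∑ (λ i j → 𝟙 (adjacent x y i j)))

  -- The levels 1 to d are disjoint, and an edge inside a block has δ = d + 1, so it is counted at
  -- none of them.
  levels≤crossing : sum {d} (λ ℓ → ⟨ level d M R (suc (Fin.toℕ ℓ)) ⟩) ≤ crossing
  levels≤crossing = ℚ.≤-trans (ℚ.≤-reflexive total) (ℚ.≤-trans (∑∑-mono bound) (ℚ.≤-reflexive (trans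
      (∑∑-ordered {d} {M} g (λ u v u≮v → trans (cong (λ b → 𝟙 b * 𝟙 (apart u v)) (edge-≮ R u v u≮v)) (ℚ.*-zeroˡ (𝟙 (apart u v)))))
      (trans (cong₂ _+_ (∑≺-cong d across) (∑w-zero d inside)) (ℚ.+-identityʳ crossing)))))
    where
    wd : Fin (2 ^ d ℕ.* M) → Word d
    wd = word d M
    apart : (u v : Fin (2 ^ d ℕ.* M)) → Bool
    apart u v = not (does (Vec.≡-dec Fin._≟_ (wd u) (wd v)))
    at-level : ℕ → (u v : Fin (2 ^ d ℕ.* M)) → Bool
    at-level ℓ u v = does (δ (wd u) (wd v) ℕ.≟ ℓ)
    L : (u v : Fin (2 ^ d ℕ.* M)) → ℚ
    L u v = sum {d} (λ ℓ → 𝟙 (at-level (suc (Fin.toℕ ℓ)) u v))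
    g : (u v : Fin (2 ^ d ℕ.* M)) → ℚ
    g u v = 𝟙 (edge R u v) * 𝟙 (apart u v)
    total : sum {d} (λ ℓ → ⟨ level d M R (suc (Fin.toℕ ℓ)) ⟩) ≡ ∑∑ (λ u v → 𝟙 (edge R u v) * L u v)
    total = trans (sum-cong-≗ {d} (λ ℓ → trans (length-pairs (2 ^ d ℕ.* M) _)
        (∑∑-cong (λ u v → 𝟙-∧ (edge R u v) (at-level (suc (Fin.toℕ ℓ)) u v)))))
      (trans (∑-comm {d} (λ ℓ u → sum (λ v → 𝟙 (edge R u v) * 𝟙 (at-level (suc (Fin.toℕ ℓ)) u v))))
      (sum-cong-≗ (λ u → trans (∑-comm {d} (λ ℓ v → 𝟙 (edge R u v) * 𝟙 (at-level (suc (Fin.toℕ ℓ)) u v)))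
        (sum-cong-≗ (λ v → sym (*-distribˡ-sum {d} (𝟙 (edge R u v)) (λ ℓ → 𝟙 (at-level (suc (Fin.toℕ ℓ)) u v))))))))
    L≤ : ∀ u v → L u v ≤ 𝟙 (apart u v)
    L≤ u v with Vec.≡-dec Fin._≟_ (wd u) (wd v)
    ... | yes eq = ℚ.≤-reflexive (trans (cong (λ n → sum {d} (λ ℓ → 𝟙 (does (n ℕ.≟ suc (Fin.toℕ ℓ)))))
        (trans (cong (δ (wd u)) (sym eq)) (δ-refl (wd u)))) (no-level d))
    ... | no _ = at-most-one-level d (δ (wd u) (wd v))
    bound : ∀ u v → 𝟙 (edge R u v) * L u v ≤ g u v
    bound u v = *-monoˡ (0≤𝟙 (edge R u v)) (L≤ u v)
    apart-vtx : ∀ x y i j → apart (vt x i) (vt y j) ≡ not (does (Vec.≡-dec Fin._≟_ x y))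
    apart-vtx x y i j = cong₂ (λ a b → not (does (Vec.≡-dec Fin._≟_ a b))) (word-vtx {d} {M} x i) (word-vtx {d} {M} y j)
    across : ∀ {x y} → x ≺ y → ∑∑ (λ i j → g (vt x i) (vt y j)) ≡ ∑∑ (λ i j → 𝟙 (adjacent x y i j))
    across {x} {y} x≺y = ∑∑-cong (λ i j → trans (cong₂ (λ a b → 𝟙 a * 𝟙 b) (edge-< R (vtx-mono-≺ {d} {M} i j x≺y))
      (trans (apart-vtx x y i j) (bool-≡ {b = true} (λ _ → _) (λ _ → distinct (Vec.≡-dec Fin._≟_ x y)))))
      (ℚ.*-identityʳ (𝟙 (adjacent x y i j))))
      where
      distinct : (eq? : Dec (x ≡ y)) → T (not (does eq?))
      distinct (yes eq) = ⊥-elim (≺⇒≢ x≺y eq)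
      distinct (no _)   = _
    inside : ∀ x → ∑∑ (λ i j → g (vt x i) (vt x j)) ≡ 0ℚ
    inside x = sum-zero (λ i → sum-zero (λ j → trans (cong (λ b → 𝟙 (edge R (vt x i) (vt x j)) * 𝟙 b)
        (trans (apart-vtx x x i j) (bool-≡ {b = false} (same (Vec.≡-dec Fin._≟_ x x)) ⊥-elim)))
      (ℚ.*-zeroʳ (𝟙 (edge R (vt x i) (vt x j))))))
      where
      same : (eq? : Dec (x ≡ x)) → T (not (does eq?)) → ⊥
      same (no x≢x) _ = x≢x refl

  ℕ→ℚ-* : ∀ a → ℕ→ℚ (a ℕ.* M ^ 2) ≡ ⟨ a ⟩ * (N * N)
  ℕ→ℚ-* a = trans (sym (⟨⟩-ℕ→ℚ (a ℕ.* M ^ 2))) (trans (⟨⟩-* a (M ^ 2)) (cong (⟨ a ⟩ *_)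
    (trans (⟨⟩-* M (M ℕ.* 1)) (cong (λ n → N * ⟨ n ⟩) (ℕ.*-identityʳ M)))))

  crossing≥ : (1ℚ - ι) * (τ * (N * N)) ≤ crossing
  crossing≥ = ℚ.≤-trans (ℚ.≤-reflexive spread) (ℚ.≤-trans (sum-mono {d} each) levels≤crossing)
    where
    b : ℕ
    b = 2 ^ (d ∸ 1)
    each : ∀ ℓ → (1ℚ - ι) * (⟨ b ⟩ * (N * N)) ≤ ⟨ level d M R (suc (Fin.toℕ ℓ)) ⟩
    each ℓ = subst₂ _≤_ (cong ((1ℚ - ι) *_) (ℕ→ℚ-* b)) (sym (⟨⟩-ℕ→ℚ (level d M R (suc (Fin.toℕ ℓ)))))
      (proj₁ (level-size (suc (Fin.toℕ ℓ)) (ℕ.s≤s ℕ.z≤n) (Fin.toℕ<n ℓ)))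
    reorder : ∀ e d b n → e * (d * b * n) ≡ d * (e * (b * n))
    reorder = solve-∀ ring
    spread : (1ℚ - ι) * (τ * (N * N)) ≡ sum {d} (λ _ → (1ℚ - ι) * (⟨ b ⟩ * (N * N)))
    spread = trans (cong (λ t → (1ℚ - ι) * (t * (N * N))) (⟨⟩-* d b)) (trans (reorder (1ℚ - ι) ⟨ d ⟩ ⟨ b ⟩ (N * N)) (sym (sum-const d _)))

  everything : Fin M → Bool
  everything _ = true

  mean : Word d → Word d → ℚ
  mean x y = 𝔼 U (λ i → 𝔼 U (λ j → 𝟙 (adjacent x y i j)))

  E-everything : ∀ {x y} (x≺y : x ≺ y) → E x≺y everything everything ≡ mean x y - density x y
  E-everything {x} {y} x≺y = trans (𝔼-cong U (λ i → trans (𝔼-cong U (λ j → ℚ.*-identityˡ (D x≺y i j)))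
    (𝔼-+const U (- density x y) (λ j → 𝟙 (adjacent x y i j))))) (𝔼-+const U (- density x y) (λ i → 𝔼 U (λ j → 𝟙 (adjacent x y i j))))

  mean-total : (1ℚ - ι) * τ ≤ ∑≺ d mean
  mean-total = *-cancelˡ (0<* (0<⟨⟩ M) (0<⟨⟩ M)) (subst₂ _≤_ (reorder (1ℚ - ι) τ (N * N))
    (trans (∑≺-cong d (λ {x} {y} _ → ∑∑-𝔼 M′ (λ i j → 𝟙 (adjacent x y i j)))) (∑≺-* d (N * N) mean)) crossing≥)
    where
    reorder : ∀ e t n → e * (t * n) ≡ n * (e * t)
    reorder = solve-∀ ring

  -- By `upper-cut` every summand ι + (density - mean) is nonnegative, while the level sizes bound
  -- the sum over all pairs by ι (W + τ). No single summand exceeds the sum.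
  mean≥ : ∀ {x y} → x ≺ y → ι + (density x y - mean x y) ≤ ι * (∑≺ d (λ _ _ → 1ℚ) + τ)
  mean≥ {x} {y} x≺y = ℚ.≤-trans (∑≺-single {d} {gap} (λ {x} {y} x≺y → subst (0ℚ ≤_) (negate ι (mean x y) (density x y))
      (0≤- (subst (_≤ ι) (E-everything x≺y) (upper-cut x≺y everything everything)))) x≺y) (ℚ.≤-trans (ℚ.≤-reflexive gap-total)
      (≤-by (∑≺ d mean - (1ℚ - ι) * τ) (0≤- mean-total) (collect ι W τ (∑≺ d mean))))
    where
    W : ℚ
    W = ∑≺ d (λ _ _ → 1ℚ)
    gap : Word d → Word d → ℚ
    gap x y = ι + (density x y - mean x y)
    negate : ∀ i m p → i - (m - p) ≡ i + (p - m)
    negate = solve-∀ ring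
    collect : ∀ i w t m → i * w + (t + (- 1ℚ) * m) + (m - (1ℚ - i) * t) ≡ i * (w + t)
    collect = solve-∀ ring
    neg : ∀ x → - x ≡ (- 1ℚ) * x
    neg = solve-∀ ring
    gap-total : ∑≺ d gap ≡ ι * W + (τ + (- 1ℚ) * ∑≺ d mean)
    gap-total = trans (∑≺-+ d (λ _ _ → ι) (λ x y → density x y - mean x y)) (cong₂ _+_
      (trans (∑≺-cong d (λ _ → sym (ℚ.*-identityʳ ι))) (∑≺-* d ι (λ _ _ → 1ℚ)))
      (trans (∑≺-+ d density (λ x y → - mean x y)) (cong₂ _+_ (∑≺-density-total d)
        (trans (∑≺-cong d (λ {x} {y} _ → neg (mean x y))) (∑≺-* d (- 1ℚ) mean)))))

  -- The complement of α × β consists of the rectangles (not α) × everything and α × (not β). Upper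
  -- bounds for these two and the lower bound `mean≥` for the whole leave a lower bound for α × β.
  lower-cut : ∀ {x y} (x≺y : x ≺ y) α β → 0ℚ ≤ E x≺y α β + ι * cutConstant d
  lower-cut {x} {y} x≺y α β = subst (0ℚ ≤_) (collect ι W τ a b c)
    (0≤+ (0≤+ (0≤+ (0≤- (subst (_≤ ι * (W + τ)) gap≡ (mean≥ x≺y))) (0≤- (upper-cut x≺y (not ∘ α) everything)))
      (0≤- (upper-cut x≺y α (not ∘ β)))) (0≤+ 0≤ι (0≤* 0≤ι (0≤T-size d))))
    where
    p W a b c : ℚ
    p = density x y
    W = ∑≺ d (λ _ _ → 1ℚ)
    a = E x≺y α β
    b = E x≺y (not ∘ α) everything
    c = E x≺y α (not ∘ β)
    pieces : ∀ a b z → 1ℚ * z ≡ 𝟙 (a ∧ b) * z + (𝟙 (not a ∧ true) * z + 𝟙 (a ∧ not b) * z)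
    pieces true  true  = solve-∀ ring
    pieces true  false = solve-∀ ring
    pieces false true  = solve-∀ ring
    pieces false false = solve-∀ ring
    F G H : Fin M → Fin M → ℚ
    F i j = 𝟙 (α i ∧ β j) * D x≺y i j
    G i j = 𝟙 (not (α i) ∧ true) * D x≺y i j
    H i j = 𝟙 (α i ∧ not (β j)) * D x≺y i j
    decompose : E x≺y everything everything ≡ a + (b + c)
    decompose = trans (𝔼-cong U (λ i → trans (𝔼-cong U (λ j → pieces (α i) (β j) (D x≺y i j)))
        (trans (𝔼-+ U (F i) (λ j → G i j + H i j)) (cong (𝔼 U (F i) +_) (𝔼-+ U (G i) (H i))))))
      (trans (𝔼-+ U (λ i → 𝔼 U (F i)) (λ i → 𝔼 U (G i) + 𝔼 U (H i))) (cong (a +_) (𝔼-+ U (λ i → 𝔼 U (G i)) (λ i → 𝔼 U (H i)))))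
    neg : ∀ p m → p - m ≡ - (m - p)
    neg = solve-∀ ring
    gap≡ : ι + (p - mean x y) ≡ ι - (a + (b + c))
    gap≡ = cong (ι +_) (trans (neg p (mean x y)) (cong -_ (trans (sym (E-everything x≺y)) decompose)))
    collect : ∀ i w t a b c → i * (w + t) - (i - (a + (b + c))) + (i - b) + (i - c) + (i + i * t) ≡ a + i * (w + (t + (t + (1ℚ + 1ℚ))))
    collect = solve-∀ ring

  regular : ∀ {ε} → ι * cutConstant d ≤ ε → Regular d M′ R ε
  regular {ε} ιC≤ε = record
    { cut = λ x≺y α β → ℚ.≤-trans (upper-cut x≺y α β) (subst (ι ≤_) (sym (ℚ.+-identityˡ ε)) ι≤ε) ,
        ℚ.≤-trans (lower-cut x≺y α β) (ℚ.+-monoʳ-≤ (E x≺y α β) ιC≤ε)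
    -- The edges inside blocks are what remains of at most (1 + ι) τN² edges after removing the
    -- crossing ones, of which there are at least (1 - ι) τN².
    ; within = ℚ.≤-trans (≤-by (((1ℚ + ι) * (τ * (N * N)) - ⟨ e R ⟩) + (crossing - (1ℚ - ι) * (τ * (N * N))))
          (0≤+ (0≤- e≤) (0≤- crossing≥)) (trans (cong (λ x → w + (((1ℚ + ι) * (τ * (N * N)) - x) + (crossing - (1ℚ - ι) * (τ * (N * N))))) (⟨e⟩-blocks {d} {M′} R))
            (collect w crossing ι τ (N * N)))) (*-monoʳ 0≤N² 2ιτ≤ε)
    ; size≥ = ℚ.≤-trans (*-monoʳ (0≤* 0≤τ 0≤N²) (ℚ.+-monoʳ-≤ 1ℚ (ℚ.neg-antimono-≤ ι≤ε))) e≥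
    ; size≤ = ℚ.≤-trans e≤ (*-monoʳ (0≤* 0≤τ 0≤N²) (ℚ.+-monoʳ-≤ 1ℚ ι≤ε))
    }
    where
    W w : ℚ
    W = ∑≺ d (λ _ _ → 1ℚ)
    w = withinBlocks {d} {M′} R
    0≤τ : 0ℚ ≤ τ
    0≤τ = 0≤T-size d
    0≤N² : 0ℚ ≤ N * N
    0≤N² = 0≤* 0≤N 0≤N
    0≤W : 0ℚ ≤ W
    0≤W = 0≤∑≺1 d
    2ιτ≤ε : ι * (τ + τ) ≤ ε
    2ιτ≤ε = ℚ.≤-trans (*-monoˡ 0≤ι (≤-by (W + (1ℚ + 1ℚ)) (0≤+ 0≤W (0≤+ 0≤1 0≤1)) (reorder W τ))) ιC≤ε
      where
      reorder : ∀ w t → t + t + (w + (1ℚ + 1ℚ)) ≡ w + (t + (t + (1ℚ + 1ℚ)))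
      reorder = solve-∀ ring
    ι≤ε : ι ≤ ε
    ι≤ε = ℚ.≤-trans (subst (_≤ ι * cutConstant d) (ℚ.*-identityʳ ι) (*-monoˡ 0≤ι (≤-by (W + (τ + (τ + 1ℚ))) (0≤+ 0≤W (0≤+ 0≤τ (0≤+ 0≤τ 0≤1))) (reorder W τ)))) ιC≤ε
      where
      reorder : ∀ w t → 1ℚ + (w + (t + (t + 1ℚ))) ≡ w + (t + (t + (1ℚ + 1ℚ)))
      reorder = solve-∀ ring
    collect : ∀ w c i t n → w + (((1ℚ + i) * (t * n) - (c + w)) + (c - (1ℚ - i) * (t * n))) ≡ i * (t + t) * n
    collect = solve-∀ ring
    size≡ : ℕ→ℚ (d ℕ.* 2 ^ (d ∸ 1) ℕ.* M ^ 2) ≡ τ * (N * N)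
    size≡ = ℕ→ℚ-* (d ℕ.* 2 ^ (d ∸ 1))
    e≥ : (1ℚ - ι) * (τ * (N * N)) ≤ ⟨ e R ⟩
    e≥ = subst₂ _≤_ (cong ((1ℚ - ι) *_) size≡) (sym (⟨⟩-ℕ→ℚ (e R))) (proj₁ size)
    e≤ : ⟨ e R ⟩ ≤ (1ℚ + ι) * (τ * (N * N))
    e≤ = subst₂ _≤_ (sym (⟨⟩-ℕ→ℚ (e R))) (cong ((1ℚ + ι) *_) size≡) (proj₂ size)

small : ∀ {ε} → 0ℚ < ε → ∀ c → ∃[ k ] inv k * c ≤ ε
small {ε} 0<ε c with ℚ.≤-total c 0ℚ
... | inj₁ c≤0 = 0 , ℚ.≤-trans (subst (inv 0 * c ≤_) (ℚ.*-zeroʳ (inv 0)) (*-monoˡ (0≤inv 0) c≤0)) (ℚ.<⇒≤ 0<ε)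
... | inj₂ 0≤c = k , ℚ.≤-trans (*-mono (ℚ.<⇒≤ 0<q) 0≤c k≤ (≤-by 1ℚ 0≤1 refl)) (ℚ.≤-reflexive (trans (ℚ.*-assoc ε (ℚ.1/ c′) c′)
    (trans (cong (ε *_) (ℚ.*-inverseˡ c′)) (ℚ.*-identityʳ ε))))
  where
  c′ : ℚ
  c′ = c + 1ℚ
  0<c′ : 0ℚ < c′
  0<c′ = ℚ.+-mono-≤-< 0≤c (ℚ.positive⁻¹ 1ℚ)
  instance
    c′-pos : ℚ.Positive c′
    c′-pos = ℚ.positive 0<c′
    c′-nonZero : ℚ.NonZero c′
    c′-nonZero = ℚ.pos⇒nonZero c′
  0<q : 0ℚ < ε * ℚ.1/ c′
  0<q = 0<* 0<ε (ℚ.positive⁻¹ (ℚ.1/ c′) ⦃ ℚ.1/pos⇒pos c′ ⦄)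
  k : ℕ
  k = proj₁ (archimedean 0<q)
  k≤ : inv k ≤ ε * ℚ.1/ c′
  k≤ = proj₂ (archimedean 0<q)

regular-family : ∀ R → IsRFamily R → ∀ d → 1 ℕ.≤ d → ∀ {ε} → 0ℚ < ε →
  ∃[ m₀ ] ∀ M′ → m₀ ℕ.≤ suc M′ → Regular d M′ (R (suc M′) d) ε
regular-family R fam d 1≤d {ε} 0<ε with small 0<ε (cutConstant d)
... | k , le with fam d 1≤d (inv k) (0<inv k)
... | m₁ , conds = m₁ ℕ.⊔ suc k ^ 3 , λ M′ m₀≤ → FromConditions.regular d M′ k (R (suc M′) d)
  (conds (suc M′) (ℕ.≤-trans (ℕ.m≤m⊔n m₁ (suc k ^ 3)) m₀≤)) (ℕ.≤-trans (ℕ.m≤n⊔m m₁ (suc k ^ 3)) m₀≤) le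

-- Copies of graphs and F-free subgraphs

Increasing : ∀ {m n} → (Fin m → Fin n) → Set
Increasing ι = ∀ {i j} → i Fin.< j → ι i Fin.< ι j

module _ {m n} {ι : Fin m → Fin n} (inc : Increasing ι) where

  increasing-injective : Injective _≡_ _≡_ ι
  increasing-injective {i} {j} eq with Fin.<-cmp i j
  ... | tri< i<j _ _ = ⊥-elim (ℕ.<-irrefl (cong Fin.toℕ eq) (inc i<j))
  ... | tri≈ _ i≡j _ = i≡j
  ... | tri> _ _ j<i = ⊥-elim (ℕ.<-irrefl (cong Fin.toℕ (sym eq)) (inc j<i))

  increasing-monotone : ι Preserves Fin._≤_ ⟶ Fin._≤_
  increasing-monotone {i} {j} i≤j with Fin.<-cmp i j
  ... | tri< i<j _ _ = ℕ.<⇒≤ (inc i<j)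
  ... | tri≈ _ refl _ = ℕ.≤-refl
  ... | tri> _ _ j<i = ⊥-elim (ℕ.<-irrefl refl (ℕ.<-≤-trans j<i i≤j))

  increasing-reflects : ∀ {i j} → ι i Fin.< ι j → i Fin.< j
  increasing-reflects {i} {j} lt with Fin.<-cmp i j
  ... | tri< i<j _ _ = i<j
  ... | tri≈ _ refl _ = ⊥-elim (ℕ.<-irrefl refl lt)
  ... | tri> _ _ j<i = ⊥-elim (ℕ.<-asym lt (inc j<i))

-- Graphs live on initial segments `Fin n`, so restricting one to a vertex subset S means
-- relabelling S in increasing order.
record Enumeration {n : ℕ} (S : Fin n → Bool) : Set where
  field
    size       : ℕ
    member     : Fin size → Fin n
    increasing : Increasing member
    sound      : ∀ i → T (S (member i))
    sum-member : ∀ f → sum (λ u → 𝟙 (S u) * f u) ≡ sum (f ∘ member)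

enumerate : ∀ {n} (S : Fin n → Bool) → Enumeration S
enumerate {zero} S = record { size = 0 ; member = λ () ; increasing = λ { {()} } ; sound = λ () ; sum-member = λ f → refl }
enumerate {suc n} S with S zero in eq | enumerate (S ∘ suc)
... | false | record { size = s ; member = mem ; increasing = inc ; sound = snd ; sum-member = sm } = record
  { size = s ; member = suc ∘ mem ; increasing = λ i<j → ℕ.s≤s (inc i<j) ; sound = snd
  ; sum-member = λ f → trans (cong₂ _+_ (trans (cong (λ b → 𝟙 b * f zero) eq) (ℚ.*-zeroˡ (f zero))) (sm (f ∘ suc))) (ℚ.+-identityˡ (sum (f ∘ suc ∘ mem))) }
... | true | record { size = s ; member = mem ; increasing = inc ; sound = snd ; sum-member = sm } = record
  { size = suc s ; member = mem′ ; increasing = inc′ ; sound = snd′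
  ; sum-member = λ f → cong₂ _+_ (trans (cong (λ b → 𝟙 b * f zero) eq) (ℚ.*-identityˡ (f zero))) (sm (f ∘ suc)) }
  where
  mem′ : Fin (suc s) → Fin (suc n)
  mem′ zero    = zero
  mem′ (suc i) = suc (mem i)
  inc′ : Increasing mem′
  inc′ {zero}  {suc j} _           = ℕ.s≤s ℕ.z≤n
  inc′ {suc i} {suc j} (ℕ.s≤s i<j) = ℕ.s≤s (inc i<j)
  snd′ : ∀ i → T (S (mem′ i))
  snd′ zero    = subst T (sym eq) _
  snd′ (suc i) = snd i

sum-injective-≤ : ∀ {m n} (ι : Fin m → Fin n) → Injective _≡_ _≡_ ι → (f : Fin n → ℚ) → (∀ j → 0ℚ ≤ f j) → sum (f ∘ ι) ≤ sum f
sum-injective-≤ ι inj f 0≤f = subst (_≤ sum f) (trans (sym (sum-image ι inj (λ _ → true) f)) (sum-cong-≗ (λ i → ℚ.*-identityˡ (f (ι i)))))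
  (sum-mono (λ j → subst (𝟙 (inImage ι (λ _ → true) j) * f j ≤_) (ℚ.*-identityˡ (f j)) (*-monoʳ (0≤f j) (𝟙≤1 (inImage ι (λ _ → true) j)))))

module Image {n′ N : ℕ} {G′ : OrderedGraph n′} {R : OrderedGraph N} (G′⊑R : G′ ⊑ R) where
  open _⊑_ G′⊑R

  imageEdge? : ∀ s t → Dec (∃[ a ] ∃[ b ] map a ≡ s × map b ≡ t × T (adj G′ a b))
  imageEdge? s t = Fin.any? λ a → Fin.any? λ b → (map a Fin.≟ s) ×-dec (map b Fin.≟ t) ×-dec T? (adj G′ a b)

  imageEdge : Fin N → Fin N → Bool
  imageEdge s t = does (imageEdge? s t)

  imageEdge⇒adj : ∀ {s t} → T (imageEdge s t) → T (adj R s t)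
  imageEdge⇒adj {s} {t} h with does-T (imageEdge? s t) h
  ... | a , b , refl , refl , ab = edges ab

  imageEdge-sym : ∀ {s t} → T (imageEdge s t) → T (imageEdge t s)
  imageEdge-sym {s} {t} h with does-T (imageEdge? s t) h
  ... | a , b , eqa , eqb , ab = T-does (imageEdge? t s) (b , a , eqb , eqa , OrderedGraph.symm G′ ab)

  map-increasing : Increasing map
  map-increasing {i} {j} i<j = ℕ.≤∧≢⇒< (monotone (ℕ.<⇒≤ i<j)) (λ eq → ℕ.<-irrefl (cong Fin.toℕ (injective (Fin.toℕ-injective eq))) i<j)

  ⟨e⟩-image : ⟨ e G′ ⟩ ≤ ∑∑ (λ s t → 𝟙 (does (s Fin.<? t) ∧ imageEdge s t))
  ⟨e⟩-image = ℚ.≤-trans (ℚ.≤-reflexive (⟨e⟩ G′)) (ℚ.≤-trans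
    (∑∑-mono (λ a b → 𝟙-mono (λ ab → let a<b , adj-ab = T-∧⁻ {does (a Fin.<? b)} ab in
      T-∧ (T-does (map a Fin.<? map b) (map-increasing (does-T (a Fin.<? b) a<b))) (T-does (imageEdge? (map a) (map b)) (a , b , refl , refl , adj-ab)))))
    (ℚ.≤-trans (sum-mono (λ a → sum-injective-≤ map injective (g (map a)) (0≤g (map a))))
      (sum-injective-≤ map injective (λ s → sum (g s)) (λ s → sum-nonneg {f = g s} (0≤g s)))))
    where
    g : Fin N → Fin N → ℚ
    g s t = 𝟙 (does (s Fin.<? t) ∧ imageEdge s t)
    0≤g : ∀ s t → 0ℚ ≤ g s t
    0≤g s t = 0≤𝟙 (does (s Fin.<? t) ∧ imageEdge s t)

maxUpTo-upper : ∀ {P : ℕ → Set} (P? : Decidable P) n {j} → P j → j ℕ.≤ n → j ℕ.≤ maxUpTo P? n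
maxUpTo-upper P? zero    Pj j≤n = j≤n
maxUpTo-upper P? (suc n) {j} Pj j≤n with P? (suc n)
... | yes _ = j≤n
... | no ¬P with ℕ.m≤n⇒m<n∨m≡n j≤n
...   | inj₁ (ℕ.s≤s j≤n′) = maxUpTo-upper P? n Pj j≤n′
...   | inj₂ refl = ⊥-elim (¬P Pj)

maxUpTo-attained : ∀ {P : ℕ → Set} (P? : Decidable P) n → maxUpTo P? n ≡ 0 ⊎ P (maxUpTo P? n)
maxUpTo-attained P? zero = inj₁ refl
maxUpTo-attained P? (suc n) with P? (suc n)
... | yes p = inj₂ p
... | no _  = maxUpTo-attained P? n

maxUpTo-≤ : ∀ {P : ℕ → Set} (P? : Decidable P) n → maxUpTo P? n ℕ.≤ n
maxUpTo-≤ P? zero = ℕ.z≤n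
maxUpTo-≤ P? (suc n) with P? (suc n)
... | yes p = ℕ.≤-refl
... | no _  = ℕ.m≤n⇒m≤1+n (maxUpTo-≤ P? n)

module _ (em : ExcludedMiddle 0ℓ) {k : ℕ} (F : OrderedGraph k) where

  maxFree : ∀ {n} → OrderedGraph n → ℕ
  maxFree G = maxUpTo {FreeSubgraph F G} (λ _ → em) (e G)

  module _ {n n′ N : ℕ} (G : OrderedGraph n) {G′ : OrderedGraph n′} {R : OrderedGraph N} (G′⊑R : G′ ⊑ R) (free : ¬ (F ⊑ G′))
    (y : Fin n → Fin N) (y-inc : Increasing y) where
    open _⊑_ G′⊑R
    open Image G′⊑R

    private
      hit? : ∀ u → Dec (∃[ a ] map a ≡ y u)
      hit? u = Fin.any? λ a → map a Fin.≟ y u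

      open Enumeration (enumerate (λ u → does (hit? u))) renaming (size to n″)

      pre : Fin n″ → Fin n′
      pre i = proj₁ (does-T (hit? (member i)) (sound i))
      map-pre : ∀ i → map (pre i) ≡ y (member i)
      map-pre i = proj₂ (does-T (hit? (member i)) (sound i))

      -- The intersection of G with the pullback of G′ along y, on the vertices that y sends into
      -- G′. It is contained in both graphs: it is F-free because of G′ and competes in the maximum
      -- for G.
      trace : OrderedGraph n″
      trace = record
        { adj = λ a b → adj G (member a) (member b) ∧ imageEdge (y (member a)) (y (member b))
        ; symm = λ {a} {b} h → let g , i = T-∧⁻ {adj G (member a) (member b)} h in T-∧ (OrderedGraph.symm G g) (imageEdge-sym i)
        ; irrefl = λ {a} h → OrderedGraph.irrefl G (proj₁ (T-∧⁻ {adj G (member a) (member a)} h))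
        }

      trace⊑G : trace ⊑ G
      trace⊑G = record
        { map = member ; injective = increasing-injective increasing ; monotone = increasing-monotone increasing
        ; edges = λ {a} {b} h → proj₁ (T-∧⁻ {adj G (member a) (member b)} h) }

      pre-increasing : Increasing pre
      pre-increasing {i} {j} i<j = increasing-reflects map-increasing
        (subst₂ Fin._<_ (sym (map-pre i)) (sym (map-pre j)) (y-inc (increasing i<j)))

      trace⊑G′ : trace ⊑ G′
      trace⊑G′ = record
        { map = pre ; injective = increasing-injective pre-increasing ; monotone = increasing-monotone pre-increasing
        ; edges = λ {a} {b} h → pulled a b (does-T (imageEdge? _ _) (proj₂ (T-∧⁻ {adj G (member a) (member b)} h))) }
        where
        pulled : ∀ a b → ∃[ a′ ] ∃[ b′ ] map a′ ≡ y (member a) × map b′ ≡ y (member b) × T (adj G′ a′ b′) → T (adj G′ (pre a) (pre b))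
        pulled a b (a′ , b′ , eqa , eqb , ab) = subst₂ (λ s t → T (adj G′ s t)) (injective (trans eqa (sym (map-pre a))))
          (injective (trans eqb (sym (map-pre b)))) ab

      ⊑-trans : ∀ {l m n} {A : OrderedGraph l} {B : OrderedGraph m} {C : OrderedGraph n} → A ⊑ B → B ⊑ C → A ⊑ C
      ⊑-trans f g = record
        { map = _⊑_.map g ∘ _⊑_.map f ; injective = _⊑_.injective f ∘ _⊑_.injective g
        ; monotone = _⊑_.monotone g ∘ _⊑_.monotone f ; edges = _⊑_.edges g ∘ _⊑_.edges f }

    common : ℚ
    common = ∑∑ (λ u v → 𝟙 (edge G u v ∧ imageEdge (y u) (y v)))

    private
      g : Fin n → Fin n → ℚ
      g u v = 𝟙 (edge G u v ∧ imageEdge (y u) (y v))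

      hit-left : ∀ u v → T (edge G u v ∧ imageEdge (y u) (y v)) → T (does (hit? u))
      hit-left u v h with does-T (imageEdge? (y u) (y v)) (proj₂ (T-∧⁻ {edge G u v} h))
      ... | a , b , eqa , _ , _ = T-does (hit? u) (a , eqa)

      hit-right : ∀ u v → T (edge G u v ∧ imageEdge (y u) (y v)) → T (does (hit? v))
      hit-right u v h with does-T (imageEdge? (y u) (y v)) (proj₂ (T-∧⁻ {edge G u v} h))
      ... | a , b , _ , eqb , _ = T-does (hit? v) (b , eqb)

      absorb : ∀ a b → (T b → T a) → 𝟙 b ≡ 𝟙 a * 𝟙 b
      absorb a b imp = trans (cong 𝟙 (bool-≡ {b} {a ∧ b} (λ t → T-∧ (imp t) t) (λ t → proj₂ (T-∧⁻ {a} t)))) (𝟙-∧ a b)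

      common≡ : common ≡ ⟨ e trace ⟩
      common≡ = trans (trans (sum-cong-≗ (λ u → trans (sum-cong-≗ (λ v → absorb (does (hit? u)) _ (hit-left u v)))
            (sym (*-distribˡ-sum (𝟙 (does (hit? u))) (g u))))) (sum-member (λ u → sum (g u))))
        (trans (sum-cong-≗ (λ a → trans (sum-cong-≗ (λ v → absorb (does (hit? v)) _ (hit-right (member a) v))) (sum-member (g (member a)))))
        (trans (∑∑-cong (λ a b → cong 𝟙 (same a b))) (sym (⟨e⟩ trace))))
        where
        same : ∀ a b → edge G (member a) (member b) ∧ imageEdge (y (member a)) (y (member b)) ≡ edge trace a b
        same a b = bool-≡
          (λ t → let ge , i = T-∧⁻ {edge G (member a) (member b)} t
                     lt , ad = T-∧⁻ {does (member a Fin.<? member b)} ge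
                 in T-∧ (T-does (a Fin.<? b) (increasing-reflects increasing (does-T (member a Fin.<? member b) lt))) (T-∧ ad i))
          (λ t → let lt , ai = T-∧⁻ {does (a Fin.<? b)} t
                     ad , i = T-∧⁻ {adj G (member a) (member b)} ai
                 in T-∧ (T-∧ (T-does (member a Fin.<? member b) (increasing (does-T (a Fin.<? b) lt))) ad) i)

    -- The counted edges are those of `trace`. The increasing map y is not asked to be a copy of G:
    -- an edge of G that is not sent to an edge of G′ is simply not counted.
    copy-bound : common ≤ ⟨ maxFree G ⟩
    copy-bound = ℚ.≤-trans (ℚ.≤-reflexive common≡) (⟨⟩-mono (maxUpTo-upper {FreeSubgraph F G} (λ _ → em) (e G) free-trace trace≤))
      where
      free-trace : FreeSubgraph F G (e trace)
      free-trace = n″ , trace , trace⊑G , (λ F⊑ → free (⊑-trans F⊑ trace⊑G′)) , refl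
      trace≤ : e trace ℕ.≤ e G
      trace≤ = ⟨⟩-cancel (subst₂ _≤_ common≡ (sym (⟨e⟩ G)) (∑∑-mono (λ u v → 𝟙-mono (λ t → proj₁ (T-∧⁻ {edge G u v} t)))))

-- Random placements of a graph into the blocks

_≺?_ : ∀ {d} (x y : Word d) → Dec (x ≺ y)
x ≺? y with ≺-compare x y
... | inj₁ x≺y         = yes x≺y
... | inj₂ (inj₁ refl) = no ≺-irrefl
... | inj₂ (inj₂ y≺x)  = no (λ x≺y → ≺-asym x≺y y≺x)
  where
  ≺-asym : ∀ {d} {x y : Word d} → x ≺ y → ¬ (y ≺ x)
  ≺-asym (there p) (there q) = ≺-asym p q

multiplicity : ∀ {d} → Word d → Word d → ℚ
multiplicity {d} x y = ⟨ 2 ^ (d ∸ δ x y) ⟩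

multiplicity-density : ∀ {d} (x y : Word d) → multiplicity x y * density x y ≡ 1ℚ
multiplicity-density {d} x y = trans (ℚ.*-comm (multiplicity x y) (density x y)) (prob-* (d ∸ δ x y))

multiplicity≤ : ∀ {d} (x y : Word d) → multiplicity x y ≤ ⟨ 2 ^ d ⟩
multiplicity≤ {d} x y = ⟨⟩-mono (ℕ.^-monoʳ-≤ 2 (ℕ.m∸n≤m d (δ x y)))

-- Here v stands for a product of densities and W for an upper bound of its inverse: dividing
-- `count-bound` by v magnifies the error by at most W.
cancel-factor : ∀ {v W x c y} → 0ℚ ≤ W → 0ℚ ≤ y → 1ℚ ≤ v * W → v * x ≤ v * c + y → x ≤ c + W * y
cancel-factor {v} {W} {x} {c} {y} 0≤W 0≤y 1≤vW le = *-cancelˡ 0<v (ℚ.≤-trans le (ℚ.≤-trans (ℚ.+-monoʳ-≤ (v * c)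
    (subst (_≤ v * W * y) (ℚ.*-identityˡ y) (*-monoʳ 0≤y 1≤vW))) (ℚ.≤-reflexive (collect v c W y))))
  where
  collect : ∀ v c W y → v * c + v * W * y ≡ v * (c + W * y)
  collect = solve-∀ ring
  0<v : 0ℚ < v
  0<v with 0ℚ ℚ.<? v
  ... | yes p = p
  ... | no  p = ⊥-elim (ℚ.<-irrefl refl (ℚ.<-≤-trans (ℚ.positive⁻¹ 1ℚ) (ℚ.≤-trans 1≤vW
        (subst (v * W ≤_) (ℚ.*-zeroˡ W) (*-monoʳ 0≤W (ℚ.≮⇒≥ p))))))

-- G is mapped into the blocks by φ; each vertex u may be placed at any of the positions pos u r.
module Placement {d n : ℕ} (G : OrderedGraph n) (φ : Fin n → Word d) where

  crossing? : Decidable {A = Fin n × Fin n} (λ (u , v) → T (edge G u v) × φ u ≺ φ v)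
  crossing? (u , v) = T? (edge G u v) ×-dec (φ u ≺? φ v)

  crossingEdges : List (Fin n × Fin n)
  crossingEdges = filter crossing? (pairs n)

  unique : AllPairs _≢_ crossingEdges
  unique = Unique.filter⁺ crossing? (Unique.cartesianProduct⁺ (Unique.allFin⁺ n) (Unique.allFin⁺ n))

  ∑E : (Fin n → Fin n → ℚ) → ℚ
  ∑E g = ∑∑ (λ u v → 𝟙 (does (crossing? (u , v))) * g u v)

  ∑E-mono : ∀ {f g} → (∀ u v → φ u ≺ φ v → f u v ≤ g u v) → ∑E f ≤ ∑E g
  ∑E-mono {f} {g} f≤g = ∑∑-mono (λ u v → pointwise u v (crossing? (u , v)))
    where
    pointwise : ∀ u v (c? : Dec (T (edge G u v) × φ u ≺ φ v)) → 𝟙 (does c?) * f u v ≤ 𝟙 (does c?) * g u v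
    pointwise u v (yes (_ , φ≺)) = *-monoˡ 0≤1 (f≤g u v φ≺)
    pointwise u v (no _)         = ℚ.≤-reflexive (trans (ℚ.*-zeroˡ (f u v)) (sym (ℚ.*-zeroˡ (g u v))))

  -- The factor (c + l) l comes from `count-bound`, and (2^d)^l bounds the inverse of a product of l
  -- densities, each of which is at least 2^(-d).
  errorFactor : ℚ → ℚ
  errorFactor c = ⟨ (2 ^ d) ^ length crossingEdges ⟩ * ((c + ⟨ length crossingEdges ⟩) * ⟨ length crossingEdges ⟩)

  0≤errorFactor : ∀ {c} → 0ℚ ≤ c → 0ℚ ≤ errorFactor c
  0≤errorFactor 0≤c = 0≤* (0≤⟨⟩ ((2 ^ d) ^ length crossingEdges))
    (0≤* (0≤+ 0≤c (0≤⟨⟩ (length crossingEdges))) (0≤⟨⟩ (length crossingEdges)))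

  module _ (em : ExcludedMiddle 0ℓ) {k : ℕ} (F : OrderedGraph k)
    {M′ : ℕ} {R : OrderedGraph (2 ^ d ℕ.* suc M′)} {ε : ℚ} (0≤ε : 0ℚ ≤ ε) (reg : Regular d M′ R ε)
    {n′ : ℕ} {G′ : OrderedGraph n′} (G′⊑R : G′ ⊑ R) (free : ¬ (F ⊑ G′))
    {q′ s : ℕ} (M≤sq : suc M′ ℕ.≤ s ℕ.* suc q′)
    (pos : Fin n → Fin (suc q′) → Fin (suc M′)) (pos-inj : ∀ u → Injective _≡_ _≡_ (pos u))
    (inc : ∀ {u v} → u Fin.< v → ∀ r r′ → vtx {d} {suc M′} (φ u) (pos u r) Fin.< vtx {d} {suc M′} (φ v) (pos v r′)) where

    open Image G′⊑R

    private
      q M : ℕ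
      q = suc q′
      M = suc M′
      N Q ς η c l : ℚ
      N = ⟨ M ⟩
      Q = ⟨ q ⟩
      ς = ⟨ s ⟩
      η = ς * ς * ε
      c = ⟨ maxFree em F G ⟩
      l = ⟨ length crossingEdges ⟩
      at-pos : Fin n → Fin q → Fin (2 ^ d ℕ.* M)
      at-pos u r = vtx {d} {M} (φ u) (pos u r)
      Rel H : Fin n × Fin n → Fin q → Fin q → Bool
      Rel (u , v) r r′ = adj R (at-pos u r) (at-pos v r′)
      H (u , v) r r′ = imageEdge (at-pos u r) (at-pos v r′)
      p w : Fin n × Fin n → ℚ
      p (u , v) = density (φ u) (φ v)
      w (u , v) = multiplicity (φ u) (φ v)
      0≤η : 0ℚ ≤ η
      0≤η = 0≤* (0≤* (0≤⟨⟩ s) (0≤⟨⟩ s)) 0≤ε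

    open Counting q′ n Rel p η

    window-sum : ∀ u v α β (D : Fin M → Fin M → ℚ) → ∑∑ (λ r r′ → 𝟙 (α r ∧ β r′) * D (pos u r) (pos v r′)) ≡
      ∑∑ (λ i j → 𝟙 (inImage (pos u) α i ∧ inImage (pos v) β j) * D i j)
    window-sum u v α β D = trans (sum-cong-≗ (λ r → trans (pull (α r) β (λ r′ → D (pos u r) (pos v r′)))
        (cong (𝟙 (α r) *_) (sum-image (pos v) (pos-inj v) β (D (pos u r))))))
      (trans (sum-image (pos u) (pos-inj u) α (λ i → sum (λ j → 𝟙 (inImage (pos v) β j) * D i j)))
        (sum-cong-≗ (λ i → sym (pull (inImage (pos u) α i) (inImage (pos v) β) (D i)))))
      where
      pull : ∀ {m} a (b : Fin m → Bool) (f : Fin m → ℚ) → sum (λ j → 𝟙 (a ∧ b j) * f j) ≡ 𝟙 a * sum (λ j → 𝟙 (b j) * f j)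
      pull a b f = trans (sum-cong-≗ (λ j → trans (cong (_* f j) (𝟙-∧ a (b j))) (ℚ.*-assoc (𝟙 a) (𝟙 (b j)) (f j))))
        (sym (*-distribˡ-sum (𝟙 a) (λ j → 𝟙 (b j) * f j)))

    -- A rectangle of window places is a rectangle in the two blocks. Normalising it by q² instead
    -- of M² costs a factor (M/q)² ≤ s².
    window-quasirandom : ∀ u v → φ u ≺ φ v → Quasirandom (u , v)
    window-quasirandom u v φ≺ α β =
        *-cancelˡ 0<Q² (ℚ.≤-trans (ℚ.≤-reflexive QX≡NY) (ℚ.≤-trans (*-monoˡ 0≤N² (subst (Y ≤_) (ℚ.+-identityˡ ε) (proj₁ Y-small)))
          (ℚ.≤-trans N²ε≤ (ℚ.≤-reflexive (cong (Q * Q *_) (sym (ℚ.+-identityˡ η))))))) ,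
        *-cancelˡ 0<Q² (subst₂ _≤_ (sym (ℚ.*-zeroʳ (Q * Q))) (trans (cong (_+ Q * Q * η) (sym QX≡NY)) (sym (ℚ.*-distribˡ-+ (Q * Q) X η)))
          (ℚ.≤-trans (0≤* 0≤N² (proj₂ Y-small)) (ℚ.≤-trans (ℚ.≤-reflexive (ℚ.*-distribˡ-+ (N * N) Y ε)) (ℚ.+-monoʳ-≤ (N * N * Y) N²ε≤))))
      where
      D : Fin M → Fin M → ℚ
      D i j = 𝟙 (between {d} {M′} R (φ u) (φ v) i j) - density (φ u) (φ v)
      X Y : ℚ
      X = 𝔼 (uniform q′) (λ r → 𝔼 (uniform q′) (λ r′ → 𝟙 (α r ∧ β r′) * D (pos u r) (pos v r′)))
      Y = 𝔼 (uniform M′) (λ i → 𝔼 (uniform M′) (λ j → 𝟙 (inImage (pos u) α i ∧ inImage (pos v) β j) * D i j))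
      Y-small : Y ≈⟨ ε ⟩ 0ℚ
      Y-small = Regular.cut reg φ≺ (inImage (pos u) α) (inImage (pos v) β)
      0<Q² : 0ℚ < Q * Q
      0<Q² = 0<* (0<⟨⟩ q) (0<⟨⟩ q)
      0≤N² : 0ℚ ≤ N * N
      0≤N² = 0≤* (0≤⟨⟩ M) (0≤⟨⟩ M)
      QX≡NY : Q * Q * X ≡ N * N * Y
      QX≡NY = trans (sym (∑∑-𝔼 q′ (λ r r′ → 𝟙 (α r ∧ β r′) * D (pos u r) (pos v r′)))) (trans (window-sum u v α β D)
        (∑∑-𝔼 M′ (λ i j → 𝟙 (inImage (pos u) α i ∧ inImage (pos v) β j) * D i j)))
      N≤ςQ : N ≤ ς * Q
      N≤ςQ = subst (N ≤_) (⟨⟩-* s q) (⟨⟩-mono M≤sq)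
      N²ε≤ : N * N * ε ≤ Q * Q * η
      N²ε≤ = ℚ.≤-trans (*-monoʳ 0≤ε (*-mono (0≤* (0≤⟨⟩ s) (0≤⟨⟩ q)) (0≤⟨⟩ M) N≤ςQ N≤ςQ)) (ℚ.≤-reflexive (reorder ς Q ε))
        where
        reorder : ∀ s q e → s * q * (s * q) * e ≡ q * q * (s * s * e)
        reorder = solve-∀ ring

    all-admissible : All Admissible crossingEdges
    all-admissible = All.map (λ {f} (ed , φ≺) → admissible (does-T (proj₁ f Fin.<? proj₂ f) (proj₁ (T-∧⁻ {does (proj₁ f Fin.<? proj₂ f)} ed)))
      (window-quasirandom (proj₁ f) (proj₂ f) φ≺) (0≤prob (d ∸ δ (φ (proj₁ f)) (φ (proj₂ f)))) (prob≤1 (d ∸ δ (φ (proj₁ f)) (φ (proj₂ f)))))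
      (all-filter crossing? (pairs n))

    few-edges : ∀ y → sumL crossingEdges (λ f → 𝟙 (at (H f) f y)) ≤ c
    few-edges y = ℚ.≤-trans (ℚ.≤-reflexive (sumL-pairs n crossing? {λ f → 𝟙 (at (H f) f y)})) (ℚ.≤-trans
      (∑∑-mono (λ u v → pointwise u v (crossing? (u , v))))
      (copy-bound em F G G′⊑R free (λ u → at-pos u (lookup y u)) (λ {u} {v} u<v → inc u<v (lookup y u) (lookup y v))))
      where
      pointwise : ∀ u v (c? : Dec (T (edge G u v) × φ u ≺ φ v)) → 𝟙 (does c?) * 𝟙 (at (H (u , v)) (u , v) y) ≤
        𝟙 (edge G u v ∧ at (H (u , v)) (u , v) y)
      pointwise u v (yes (ed , _)) = subst (_≤ 𝟙 (edge G u v ∧ at (H (u , v)) (u , v) y)) (sym (ℚ.*-identityˡ (𝟙 (at (H (u , v)) (u , v) y))))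
        (𝟙-mono (λ t → T-∧ ed t))
      pointwise u v (no _) = subst (_≤ 𝟙 (edge G u v ∧ at (H (u , v)) (u , v) y)) (sym (ℚ.*-zeroˡ (𝟙 (at (H (u , v)) (u , v) y))))
        (0≤𝟙 (edge G u v ∧ at (H (u , v)) (u , v) y))

    weight-bound : ∀ E → 1ℚ ≤ weight E * ⟨ (2 ^ d) ^ length E ⟩
    weight-bound []            = ℚ.≤-reflexive (sym (trans (ℚ.*-identityˡ ⟨ 1 ⟩) ⟨1⟩))
    weight-bound ((u , v) ∷ E) = ℚ.≤-trans (weight-bound E) (ℚ.≤-trans (subst (_≤ p (u , v) * ⟨ 2 ^ d ⟩ * (weight E * ⟨ (2 ^ d) ^ length E ⟩))
        (ℚ.*-identityˡ (weight E * ⟨ (2 ^ d) ^ length E ⟩)) (*-monoʳ (ℚ.≤-trans 0≤1 (weight-bound E)) first))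
      (ℚ.≤-reflexive (trans (regroup (p (u , v)) ⟨ 2 ^ d ⟩ (weight E) ⟨ (2 ^ d) ^ length E ⟩) (cong (p (u , v) * weight E *_) (sym (⟨⟩-* (2 ^ d) ((2 ^ d) ^ length E)))))))
      where
      regroup : ∀ p t w r → p * t * (w * r) ≡ p * w * (t * r)
      regroup = solve-∀ ring
      first : 1ℚ ≤ p (u , v) * ⟨ 2 ^ d ⟩
      first = subst (_≤ p (u , v) * ⟨ 2 ^ d ⟩) (prob-* (d ∸ δ (φ u) (φ v))) (*-monoˡ (0≤prob (d ∸ δ (φ u) (φ v))) (multiplicity≤ (φ u) (φ v)))

    -- `count-bound` divided by the product of the densities. Each placement is an increasing map,
    -- so `copy-bound` gives it at most `maxFree em F G` edges of the F-free graph; each summand on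
    -- the left is the density of that graph at an edge, relative to the density of R there.
    placement-bound : ∑E (λ u v → multiplicity (φ u) (φ v) * 𝔼 (uniform q′) (λ r → 𝔼 (uniform q′) (λ r′ → 𝟙 (imageEdge (at-pos u r) (at-pos v r′)))))
      ≤ c + errorFactor c * (ς * ς * ε)
    placement-bound = ℚ.≤-trans (ℚ.≤-reflexive (sym (sumL-pairs n crossing? {λ f → w f * 𝔼 (uniform q′) (λ r → 𝔼 (uniform q′) (λ r′ → 𝟙 (H f r r′)))})))
      (ℚ.≤-trans (cancel-factor {weight crossingEdges} {⟨ (2 ^ d) ^ length crossingEdges ⟩} {sumL crossingEdges (λ f → w f * 𝔼 (uniform q′) (λ r → 𝔼 (uniform q′) (λ r′ → 𝟙 (H f r r′))))} {c}
            {(c + l) * l * η} (0≤⟨⟩ ((2 ^ d) ^ length crossingEdges)) (0≤* (0≤* (0≤+ 0≤c (0≤⟨⟩ (length crossingEdges))) (0≤⟨⟩ (length crossingEdges))) 0≤η)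
          (weight-bound crossingEdges)
          (count-bound 0≤η unique all-admissible H (λ f s t → imageEdge⇒adj) w (λ f → 0≤⟨⟩ (2 ^ (d ∸ δ (φ (proj₁ f)) (φ (proj₂ f)))))
            (λ {f} _ → multiplicity-density (φ (proj₁ f)) (φ (proj₂ f))) c 0≤c few-edges))
        (ℚ.≤-reflexive (cong (c +_) (sym (ℚ.*-assoc ⟨ (2 ^ d) ^ length crossingEdges ⟩ ((c + l) * l) η)))))
      where
      0≤c : 0ℚ ≤ c
      0≤c = 0≤⟨⟩ (maxFree em F G)

-- Positions outside the image are at most a proportion ρ of all and contribute at most B each. The
-- sum over the image is Z times its average, which is at most N times it because f is nonnegative.
shift-average : ∀ {Z′ M′} (ι : Fin (suc Z′) → Fin (suc M′)) → Injective _≡_ _≡_ ι → ∀ {B ρ} → 0ℚ ≤ B →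
  ⟨ suc M′ ⟩ - ⟨ suc Z′ ⟩ ≤ ρ * ⟨ suc M′ ⟩ → (f : Fin (suc M′) → ℚ) → (∀ i → 0ℚ ≤ f i) → (∀ i → f i ≤ B) →
  𝔼 (uniform M′) f ≤ 𝔼 (uniform Z′) (f ∘ ι) + B * ρ
shift-average {Z′} {M′} ι inj {B} {ρ} 0≤B gap f 0≤f f≤B = *-cancelˡ (0<⟨⟩ (suc M′)) (ℚ.≤-trans (ℚ.≤-reflexive (sym (uniform-sum M′ f)))
  (ℚ.≤-trans (≤-by (sum (λ i → B * (1ℚ - c i) + (c i * f i + (- 1ℚ) * f i))) (sum-nonneg {f = λ i → B * (1ℚ - c i) + (c i * f i + (- 1ℚ) * f i)} 0≤rest) total)
  (ℚ.≤-trans (ℚ.+-mono-≤ (*-monoʳ 0≤E Z≤N) (*-monoˡ 0≤B gap)) (ℚ.≤-reflexive (collect N EZ B ρ)))))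
  where
  N Z EZ : ℚ
  N = ⟨ suc M′ ⟩
  Z = ⟨ suc Z′ ⟩
  EZ = 𝔼 (uniform Z′) (f ∘ ι)
  c : Fin (suc M′) → ℚ
  c i = 𝟙 (inImage ι (λ _ → true) i)
  0≤E : 0ℚ ≤ EZ
  0≤E = 𝔼-≥ (uniform Z′) (λ i → 0≤f (ι i))
  image : ∀ g → sum (λ i → c i * g i) ≡ sum (g ∘ ι)
  image g = trans (sym (sum-image ι inj (λ _ → true) g)) (sum-cong-≗ (λ i → ℚ.*-identityˡ (g (ι i))))
  count : sum c ≡ Z
  count = trans (sum-cong-≗ (λ i → sym (ℚ.*-identityʳ (c i)))) (trans (image (λ _ → 1ℚ)) (trans (sum-const (suc Z′) 1ℚ) (ℚ.*-identityʳ Z)))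
  Z≤N : Z ≤ N
  Z≤N = subst₂ _≤_ count (trans (sum-const (suc M′) 1ℚ) (ℚ.*-identityʳ N)) (sum-mono {f = c} (λ i → 𝟙≤1 (inImage ι (λ _ → true) i)))
  0≤rest : ∀ i → 0ℚ ≤ B * (1ℚ - c i) + (c i * f i + (- 1ℚ) * f i)
  0≤rest i = subst (0ℚ ≤_) (factor (c i) B (f i)) (0≤* (0≤- (𝟙≤1 (inImage ι (λ _ → true) i))) (0≤- (f≤B i)))
    where
    factor : ∀ c b f → (1ℚ - c) * (b - f) ≡ b * (1ℚ - c) + (c * f + (- 1ℚ) * f)
    factor = solve-∀ ring
  total : sum f + sum (λ i → B * (1ℚ - c i) + (c i * f i + (- 1ℚ) * f i)) ≡ Z * EZ + B * (N - Z)
  total = trans (cong (sum f +_) (trans (∑-distrib-+ (λ i → B * (1ℚ - c i)) (λ i → c i * f i + (- 1ℚ) * f i)) (cong₂ _+_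
      (trans (sym (*-distribˡ-sum B (λ i → 1ℚ - c i))) (cong (B *_) (trans (trans (sum-cong-≗ (λ i → neg (c i))) (∑-distrib-+ (λ _ → 1ℚ) (λ i → (- 1ℚ) * c i)))
        (cong₂ _+_ (trans (sum-const (suc M′) 1ℚ) (ℚ.*-identityʳ N)) (trans (sym (*-distribˡ-sum (- 1ℚ) c)) (cong ((- 1ℚ) *_) count))))))
      (trans (∑-distrib-+ (λ i → c i * f i) (λ i → (- 1ℚ) * f i)) (cong₂ _+_ (trans (image f) (uniform-sum Z′ (f ∘ ι))) (sym (*-distribˡ-sum (- 1ℚ) f)))))))
    (collect′ (sum f) B N Z EZ)
    where
    neg : ∀ c → 1ℚ - c ≡ 1ℚ + (- 1ℚ) * c
    neg = solve-∀ ring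
    collect′ : ∀ s b n z x → s + (b * (n + (- 1ℚ) * z) + (z * x + (- 1ℚ) * s)) ≡ z * x + b * (n - z)
    collect′ = solve-∀ ring
  collect : ∀ n x b r → n * x + b * (r * n) ≡ n * (x + b * r)
  collect = solve-∀ ring

-- Relative densities, and F-free subgraphs between blocks

relDensity-* : ∀ (em : ExcludedMiddle 0ℓ) {k n} (F : OrderedGraph k) (G : OrderedGraph n) →
  relDensity em F G * ⟨ e G ⟩ ≡ ⟨ maxFree em F G ⟩
relDensity-* em F G with e G in eq | maxUpTo-≤ {FreeSubgraph F G} (λ _ → em) (e G)
... | zero  | _ = trans (ℚ.*-zeroˡ ⟨ 0 ⟩) (sym ⟨0⟩)
... | suc l | _ = ÷-cancel (maxUpTo {FreeSubgraph F G} (λ _ → em) (suc l)) (suc l)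

relDensity≤1 : ∀ (em : ExcludedMiddle 0ℓ) {k n} (F : OrderedGraph k) (G : OrderedGraph n) → relDensity em F G ≤ 1ℚ
relDensity≤1 em F G with e G
... | zero  = 0≤1
... | suc l = *-cancelˡ (0<⟨⟩ (suc l)) (ℚ.≤-trans (ℚ.≤-reflexive (trans (ℚ.*-comm ⟨ suc l ⟩ _) (÷-cancel (maxUpTo {FreeSubgraph F G} (λ _ → em) (suc l)) (suc l))))
  (ℚ.≤-trans (⟨⟩-mono (maxUpTo-≤ {FreeSubgraph F G} (λ _ → em) (suc l))) (ℚ.≤-reflexive (sym (ℚ.*-identityʳ ⟨ suc l ⟩)))))

0≤relDensity : ∀ (em : ExcludedMiddle 0ℓ) {k n} (F : OrderedGraph k) (G : OrderedGraph n) → 0ℚ ≤ relDensity em F G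
0≤relDensity em F G = 0≤÷ (maxFree em F G) (e G)

module ImageDensity {d M′ n′ : ℕ} {G′ : OrderedGraph n′} {R : OrderedGraph (2 ^ d ℕ.* suc M′)} (G′⊑R : G′ ⊑ R)
  {ε : ℚ} (reg : Regular d M′ R ε) where

  open Image G′⊑R

  private
    M : ℕ
    M = suc M′
    N : ℚ
    N = ⟨ M ⟩
    U : Average (Fin M)
    U = uniform M′
    vt : Word d → Fin M → Fin (2 ^ d ℕ.* M)
    vt = vtx {d} {M}

  hit : Word d → Word d → Fin M → Fin M → ℚ
  hit x y i j = 𝟙 (imageEdge (vt x i) (vt y j))

  imageDensity : Word d → Word d → ℚ
  imageDensity x y = 𝔼 U (λ i → 𝔼 U (hit x y i))

  0≤imageDensity : ∀ x y → 0ℚ ≤ imageDensity x y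
  0≤imageDensity x y = 𝔼-≥ U (λ i → 𝔼-≥ U (λ j → 0≤𝟙 (imageEdge (vt x i) (vt y j))))

  imageDensity≤1 : ∀ x y → imageDensity x y ≤ 1ℚ
  imageDensity≤1 x y = 𝔼-≤ U (λ i → 𝔼-≤ U (λ j → 𝟙≤1 (imageEdge (vt x i) (vt y j))))

  imageDensity-bound : ∀ {x y} → x ≺ y → imageDensity x y ≤ density x y + ε
  imageDensity-bound {x} {y} x≺y = ℚ.≤-trans (𝔼-mono U (λ i → 𝔼-mono U (λ j → 𝟙-mono (imageEdge⇒adj {vt x i} {vt y j}))))
    (subst₂ _≤_ (trans (cong (_+ p) excess) (restore m p)) (trans (cong (_+ p) (ℚ.+-identityˡ ε)) (ℚ.+-comm ε p))
      (ℚ.+-monoˡ-≤ p (proj₁ (Regular.cut reg x≺y (λ _ → true) (λ _ → true)))))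
    where
    p m : ℚ
    p = density x y
    m = 𝔼 U (λ i → 𝔼 U (λ j → 𝟙 (between {d} {M′} R x y i j)))
    excess : 𝔼 U (λ i → 𝔼 U (λ j → 1ℚ * (𝟙 (between {d} {M′} R x y i j) - p))) ≡ m - p
    excess = trans (𝔼-cong U (λ i → trans (𝔼-cong U (λ j → ℚ.*-identityˡ (𝟙 (between {d} {M′} R x y i j) - p))) (𝔼-+const U (- p) (λ j → 𝟙 (between {d} {M′} R x y i j)))))
      (𝔼-+const U (- p) (λ i → 𝔼 U (λ j → 𝟙 (between {d} {M′} R x y i j))))
    restore : ∀ m p → m - p + p ≡ m
    restore = solve-∀ ring

  -- Edges inside blocks are charged to `Regular.within`, so afterwards only densities between
  -- distinct blocks have to be bounded.
  ⟨e⟩-imageDensity : ⟨ e G′ ⟩ ≤ N * N * (∑≺ d imageDensity + ε)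
  ⟨e⟩-imageDensity = ℚ.≤-trans ⟨e⟩-image (ℚ.≤-trans (ℚ.≤-reflexive (∑∑-ordered {d} {M} g (λ s t s≮t → cong 𝟙 (vanish s t s≮t))))
    (ℚ.≤-trans (ℚ.+-mono-≤ across within) (ℚ.≤-reflexive (collect (N * N) (∑≺ d imageDensity) ε))))
    where
    g : Fin (2 ^ d ℕ.* M) → Fin (2 ^ d ℕ.* M) → ℚ
    g s t = 𝟙 (does (s Fin.<? t) ∧ imageEdge s t)
    vanish : ∀ s t → ¬ (s Fin.< t) → does (s Fin.<? t) ∧ imageEdge s t ≡ false
    vanish s t s≮t = bool-≡ (λ h → s≮t (does-T (s Fin.<? t) (proj₁ (T-∧⁻ {does (s Fin.<? t)} h)))) ⊥-elim
    across : ∑≺ d (λ x y → ∑∑ (λ i j → g (vt x i) (vt y j))) ≤ N * N * ∑≺ d imageDensity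
    across = ℚ.≤-trans (∑≺-mono d {g = λ x y → N * N * imageDensity x y} (λ {x} {y} x≺y → ℚ.≤-trans
        (∑∑-mono {f = λ i j → g (vt x i) (vt y j)} {g = hit x y} (λ i j → 𝟙-mono (λ h → proj₂ (T-∧⁻ {does (vt x i Fin.<? vt y j)} h)))) (ℚ.≤-reflexive (∑∑-𝔼 M′ (hit x y)))))
      (ℚ.≤-reflexive (∑≺-* d (N * N) imageDensity))
    within : ∑w d (λ x → ∑∑ (λ i j → g (vt x i) (vt x j))) ≤ ε * (N * N)
    within = ℚ.≤-trans (∑w-mono d (λ x → ∑∑-mono {f = λ i j → g (vt x i) (vt x j)} {g = λ i j → 𝟙 (edge R (vt x i) (vt x j))} (λ i j → 𝟙-mono (λ h → let lt , im = T-∧⁻ {does (vt x i Fin.<? vt x j)} h in T-∧ lt (imageEdge⇒adj {vt x i} {vt x j} im)))))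
      (Regular.within reg)
    collect : ∀ n x ε → n * x + ε * n ≡ n * (x + ε)
    collect = solve-∀ ring

-- Comparing R(M,d) with R(m,d)

<ʷ⇒≺ : ∀ {d} {x y : Word d} → x <ʷ y → x ≺ y
<ʷ⇒≺ {x = zero ∷ x}     {suc zero ∷ y} (zero , refl , refl , _)          = here
<ʷ⇒≺ {x = a ∷ x}        {b ∷ y}        (suc i , xᵢ≡0 , yᵢ≡1 , agree) with agree zero (ℕ.s≤s ℕ.z≤n)
... | refl = there (<ʷ⇒≺ (i , xᵢ≡0 , yᵢ≡1 , λ j j<i → agree (suc j) (ℕ.s≤s j<i)))

∑E-𝔼 : ∀ {d n} (G : OrderedGraph n) (φ : Fin n → Word d) {A : Set} (α : Average A) (g : A → Fin n → Fin n → ℚ) →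
  𝔼 α (λ a → Placement.∑E G φ (g a)) ≡ Placement.∑E G φ (λ u v → 𝔼 α (λ a → g a u v))
∑E-𝔼 {n = n} G φ α g = trans (𝔼-sum α {n} (λ u a → sum (λ v → c u v * g a u v))) (sum-cong-≗ (λ u →
  trans (𝔼-sum α {n} (λ v a → c u v * g a u v)) (sum-cong-≗ (λ v → 𝔼-* α (c u v) (λ a → g a u v)))))
  where
  c : Fin n → Fin n → ℚ
  c u v = 𝟙 (does (Placement.crossing? G φ (u , v)))

∑E-+const : ∀ {d n} (G : OrderedGraph n) (φ : Fin n → Word d) (f : Fin n → Fin n → ℚ) {c} → 0ℚ ≤ c →
  Placement.∑E G φ (λ u v → f u v + c) ≤ Placement.∑E G φ f + ⟨ n ⟩ * (⟨ n ⟩ * c)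
∑E-+const {n = n} G φ f {c} 0≤c = ℚ.≤-trans (∑∑-mono {g = λ u v → b u v * f u v + c} (λ u v → subst (_≤ b u v * f u v + c)
      (sym (ℚ.*-distribˡ-+ (b u v) (f u v) c)) (ℚ.+-monoʳ-≤ (b u v * f u v) (subst (b u v * c ≤_) (ℚ.*-identityˡ c)
        (*-monoʳ 0≤c (𝟙≤1 (does (Placement.crossing? G φ (u , v)))))))))
  (ℚ.≤-reflexive (trans (sum-cong-≗ (λ u → trans (∑-distrib-+ (λ v → b u v * f u v) (λ _ → c)) (cong (sum (λ v → b u v * f u v) +_) (sum-const n c))))
    (trans (∑-distrib-+ (λ u → sum (λ v → b u v * f u v)) (λ _ → ⟨ n ⟩ * c)) (cong (Placement.∑E G φ f +_) (sum-const n (⟨ n ⟩ * c))))))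
  where
  b : Fin n → Fin n → ℚ
  b u v = 𝟙 (does (Placement.crossing? G φ (u , v)))

undigits-injective : ∀ {d} {x y : Word d} → undigits x ≡ undigits y → x ≡ y
undigits-injective {d} {x} {y} eq = trans (sym (digits-undigits x)) (trans (cong (digits d) eq) (digits-undigits y))

-- Vertex (x , i) of R(m,d) is placed in a window of q positions of the block x of R(M,d), and the windows
-- of a block are shifted by a common random offset, independently for different blocks.
module Inner (em : ExcludedMiddle 0ℓ) {k : ℕ} (F : OrderedGraph k) (d m′ M′ Z′ q′ s : ℕ)
  (M≡ : suc Z′ ℕ.+ suc m′ ℕ.* suc q′ ≡ suc M′) (M≤sq : suc M′ ℕ.≤ s ℕ.* suc q′)
  {ρ : ℚ} (gap : ⟨ suc m′ ℕ.* suc q′ ⟩ ≤ ρ * ⟨ suc M′ ⟩)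
  (Rm : OrderedGraph (2 ^ d ℕ.* suc m′)) {ε₁ : ℚ} (0≤ε₁ : 0ℚ ≤ ε₁) (reg₁ : Regular d m′ Rm ε₁)
  (RM : OrderedGraph (2 ^ d ℕ.* suc M′)) {ε₂ : ℚ} (0≤ε₂ : 0ℚ ≤ ε₂) (reg₂ : Regular d M′ RM ε₂)
  {n′ : ℕ} {G′ : OrderedGraph n′} (G′⊑R : G′ ⊑ RM) (free : ¬ (F ⊑ G′)) where

  open ImageDensity G′⊑R reg₂
  open Image G′⊑R

  private
    m q M Z n : ℕ
    m = suc m′
    q = suc q′
    M = suc M′
    Z = suc Z′
    n = 2 ^ d ℕ.* m
    wd : Fin n → Word d
    wd = word d m
    μ P W c : ℚ
    μ = ⟨ m ⟩
    P = ⟨ 2 ^ d ⟩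
    W = ∑≺ d (λ _ _ → 1ℚ)
    c = ⟨ maxFree em F Rm ⟩

  open Placement Rm wd

  C : ℚ
  C = c + errorFactor c * (⟨ s ⟩ * ⟨ s ⟩ * ε₂)

  shiftBy : Fin (m ℕ.* q) → Fin Z → Fin M
  shiftBy a o = Fin.fromℕ< (subst (Fin.toℕ o ℕ.+ Fin.toℕ a ℕ.<_) M≡ (ℕ.+-mono-< (Fin.toℕ<n o) (Fin.toℕ<n a)))

  toℕ-shiftBy : ∀ a o → Fin.toℕ (shiftBy a o) ≡ Fin.toℕ o ℕ.+ Fin.toℕ a
  toℕ-shiftBy a o = Fin.toℕ-fromℕ< _

  shiftBy-injectiveʳ : ∀ a → Injective _≡_ _≡_ (shiftBy a)
  shiftBy-injectiveʳ a {o} {o′} eq = Fin.toℕ-injective (ℕ.+-cancelʳ-≡ (Fin.toℕ a) (Fin.toℕ o) (Fin.toℕ o′)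
    (trans (sym (toℕ-shiftBy a o)) (trans (cong Fin.toℕ eq) (toℕ-shiftBy a o′))))

  shiftBy-monoˡ : ∀ {a b} o → a Fin.< b → shiftBy a o Fin.< shiftBy b o
  shiftBy-monoˡ {a} {b} o a<b = subst₂ ℕ._<_ (sym (toℕ-shiftBy a o)) (sym (toℕ-shiftBy b o)) (ℕ.+-monoʳ-< (Fin.toℕ o) a<b)

  slot : Fin m → Fin q → Fin (m ℕ.* q)
  slot = Fin.combine

  place : Vec (Fin Z) (2 ^ d) → Word d → Fin m → Fin q → Fin M
  place o x i r = shiftBy (slot i r) (lookup o (undigits x))

  place-injective : ∀ o x i → Injective _≡_ _≡_ (place o x i)
  place-injective o x i = increasing-injective {ι = place o x i} (λ r<r′ → shiftBy-monoˡ (lookup o (undigits x)) (combine-monoʳ-< i r<r′))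

  -- Within a block all vertices share one offset, and their slots are disjoint and in order. In
  -- different blocks the words decide, whatever the offsets are.
  place-increasing : ∀ o {u v} → u Fin.< v → ∀ r r′ →
    vtx {d} {M} (wd u) (place o (wd u) (position d m u) r) Fin.< vtx {d} {M} (wd v) (place o (wd v) (position d m v) r′)
  place-increasing o {u} {v} u<v r r′ with <-lex d m u v u<v
  ... | inj₁ x<y = vtx-mono-≺ {d} {M} _ _ (<ʷ⇒≺ {d} {wd u} {wd v} x<y)
  ... | inj₂ (x≡y , i<j) = subst (λ y → vtx {d} {M} (wd u) (place o (wd u) (position d m u) r) Fin.< vtx {d} {M} y (place o y (position d m v) r′)) x≡y
    (vtx-mono-< {d} {M} (wd u) (shiftBy-monoˡ (lookup o (undigits (wd u))) (Fin.combine-monoˡ-< r r′ i<j)))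

  private
    Uq : Average (Fin q)
    Uq = uniform q′
    UZ : Average (Fin Z)
    UZ = uniform Z′
    Offsets : Average (Vec (Fin Z) (2 ^ d))
    Offsets = tuples UZ (2 ^ d)

    placed : Vec (Fin Z) (2 ^ d) → Fin n → Fin n → ℚ
    placed o u v = 𝔼 Uq (λ r → 𝔼 Uq (λ r′ → hit (wd u) (wd v) (place o (wd u) (position d m u) r) (place o (wd v) (position d m v) r′)))

  placed-bound : ∀ o → ∑E (λ u v → multiplicity (wd u) (wd v) * placed o u v) ≤ C
  placed-bound o = placement-bound em F 0≤ε₂ reg₂ G′⊑R free {q′} {s} M≤sq (λ u → place o (wd u) (position d m u))
    (λ u → place-injective o (wd u) (position d m u)) (place-increasing o)

  0≤ρM : 0ℚ ≤ ρ
  0≤ρM = *-cancelˡ (0<⟨⟩ M) (subst₂ _≤_ (sym (ℚ.*-zeroʳ ⟨ M ⟩)) (ℚ.*-comm ρ ⟨ M ⟩) (ℚ.≤-trans (0≤⟨⟩ (m ℕ.* q)) gap))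

  gap-Z : ⟨ M ⟩ - ⟨ Z ⟩ ≤ ρ * ⟨ M ⟩
  gap-Z = subst (_≤ ρ * ⟨ M ⟩) (sym (trans (cong (_- ⟨ Z ⟩) (trans (cong ⟨_⟩ (sym M≡)) (⟨⟩-+ Z (m ℕ.* q)))) (cancel ⟨ Z ⟩ ⟨ m ℕ.* q ⟩))) gap
    where
    cancel : ∀ z a → z + a - z ≡ a
    cancel = solve-∀ ring

  -- For a fixed place in the window, the offsets reach all but a proportion ρ of the positions of
  -- the block. This is applied once in each of the two blocks.
  offset-average : ∀ x y a b → imageDensity x y ≤ 𝔼 UZ (λ o → 𝔼 UZ (λ o′ → hit x y (shiftBy a o) (shiftBy b o′))) + (ρ + ρ)
  offset-average x y a b = ℚ.≤-trans (shift-average (shiftBy a) (shiftBy-injectiveʳ a) {1ℚ} {ρ} 0≤1 gap-Z (λ i → 𝔼 UM (hit x y i))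
      (λ i → 𝔼-≥ UM (λ j → 0≤𝟙 (imageEdge (vtx {d} {M} x i) (vtx {d} {M} y j)))) (λ i → 𝔼-≤ UM (λ j → 𝟙≤1 (imageEdge (vtx {d} {M} x i) (vtx {d} {M} y j)))))
    (ℚ.≤-trans (ℚ.+-monoˡ-≤ (1ℚ * ρ) (ℚ.≤-trans (𝔼-mono UZ (λ o → shift-average (shiftBy b) (shiftBy-injectiveʳ b) {1ℚ} {ρ} 0≤1 gap-Z (hit x y (shiftBy a o))
        (λ j → 0≤𝟙 (imageEdge (vtx {d} {M} x (shiftBy a o)) (vtx {d} {M} y j))) (λ j → 𝟙≤1 (imageEdge (vtx {d} {M} x (shiftBy a o)) (vtx {d} {M} y j)))))
        (ℚ.≤-reflexive (𝔼-+const UZ (1ℚ * ρ) (λ o → 𝔼 UZ (λ o′ → hit x y (shiftBy a o) (shiftBy b o′)))))))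
      (ℚ.≤-reflexive (collect (𝔼 UZ (λ o → 𝔼 UZ (λ o′ → hit x y (shiftBy a o) (shiftBy b o′)))) ρ)))
    where
    UM : Average (Fin M)
    UM = uniform M′
    collect : ∀ e r → e + 1ℚ * r + 1ℚ * r ≡ e + (r + r)
    collect = solve-∀ ring

  -- Distinct blocks have independent offsets, so on average over them each of the q² pairs of
  -- places sees a nearly uniform pair of positions.
  imageDensity≤placed : ∀ u v → wd u ≺ wd v → imageDensity (wd u) (wd v) ≤ 𝔼 Offsets (λ o → placed o u v) + (ρ + ρ)
  imageDensity≤placed u v x≺y = ℚ.≤-trans (𝔼-≥ Uq (λ r → 𝔼-≥ Uq (λ r′ → offset-average x y (slot i r) (slot j r′))))
    (ℚ.≤-reflexive (trans (𝔼-cong Uq (λ r → 𝔼-+const Uq (ρ + ρ) (λ r′ → X r r′))) (trans (𝔼-+const Uq (ρ + ρ) (λ r → 𝔼 Uq (X r)))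
      (cong (_+ (ρ + ρ)) (sym (trans (𝔼-swap-uniform Offsets q′ (λ o r → 𝔼 Uq (λ r′ → Y o r r′)))
        (𝔼-cong Uq (λ r → trans (𝔼-swap-uniform Offsets q′ (λ o r′ → Y o r r′)) (𝔼-cong Uq (λ r′ →
          𝔼-marginal₂ Z′ (λ eq → ≺⇒≢ x≺y (undigits-injective {d} {x} {y} eq)) (λ o o′ → hit x y (shiftBy (slot i r) o) (shiftBy (slot j r′) o′))))))))))))
    where
    x y : Word d
    x = wd u
    y = wd v
    i j : Fin m
    i = position d m u
    j = position d m v
    X : Fin q → Fin q → ℚ
    X r r′ = 𝔼 UZ (λ o → 𝔼 UZ (λ o′ → hit x y (shiftBy (slot i r) o) (shiftBy (slot j r′) o′)))
    Y : Vec (Fin Z) (2 ^ d) → Fin q → Fin q → ℚ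
    Y o r r′ = hit x y (place o x i r) (place o y j r′)

  0≤PP : 0ℚ ≤ P * (ρ + ρ)
  0≤PP = 0≤* (0≤⟨⟩ (2 ^ d)) (0≤+ 0≤ρM 0≤ρM)

  f : Word d → Word d → ℚ
  f x y = multiplicity x y * imageDensity x y

  ∑E-imageDensity : ∑E (λ u v → f (wd u) (wd v)) ≤ C + ⟨ n ⟩ * (⟨ n ⟩ * (P * (ρ + ρ)))
  ∑E-imageDensity = ℚ.≤-trans (∑E-mono {λ u v → f (wd u) (wd v)} {λ u v → g u v + P * (ρ + ρ)} (λ u v x≺y → each u v x≺y)) (ℚ.≤-trans (∑E-+const Rm wd g 0≤PP)
    (ℚ.+-monoˡ-≤ (⟨ n ⟩ * (⟨ n ⟩ * (P * (ρ + ρ)))) (ℚ.≤-trans (ℚ.≤-reflexive (sym (∑E-𝔼 Rm wd Offsets (λ o u v → multiplicity (wd u) (wd v) * placed o u v))))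
      (𝔼-≤ Offsets placed-bound))))
    where
    g : Fin n → Fin n → ℚ
    g u v = 𝔼 Offsets (λ o → multiplicity (wd u) (wd v) * placed o u v)
    each : ∀ u v → wd u ≺ wd v → f (wd u) (wd v) ≤ g u v + P * (ρ + ρ)
    each u v x≺y = ℚ.≤-trans (*-monoˡ (0≤⟨⟩ (2 ^ (d ∸ δ (wd u) (wd v)))) (imageDensity≤placed u v x≺y))
      (ℚ.≤-trans (ℚ.≤-reflexive (ℚ.*-distribˡ-+ w X (ρ + ρ))) (ℚ.+-mono-≤
        (ℚ.≤-reflexive (sym (𝔼-* Offsets w (λ o → placed o u v)))) (*-monoʳ (0≤+ 0≤ρM 0≤ρM) (multiplicity≤ (wd u) (wd v)))))
      where
      w X : ℚ
      w = multiplicity (wd u) (wd v)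
      X = 𝔼 Offsets (λ o → placed o u v)

  ∑E-blocks : ∑E (λ u v → f (wd u) (wd v)) ≡ ∑≺ d (λ x y → ∑∑ (λ i j → 𝟙 (between {d} {m′} Rm x y i j)) * f x y)
  ∑E-blocks = trans (∑∑-ordered {d} {m} g (λ u v u≮v → trans (cong (λ b → 𝟙 b * f (wd u) (wd v)) (bool-≡ (λ t → u≮v (forward u v t)) ⊥-elim)) (ℚ.*-zeroˡ (f (wd u) (wd v)))))
    (trans (cong₂ _+_ (∑≺-cong d across) (∑w-zero d inside)) (ℚ.+-identityʳ (∑≺ d (λ x y → ∑∑ (λ i j → 𝟙 (between {d} {m′} Rm x y i j)) * f x y))))
    where
    vt : Word d → Fin m → Fin n
    vt = vtx {d} {m}
    g : Fin n → Fin n → ℚ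
    g u v = 𝟙 (does (crossing? (u , v))) * f (wd u) (wd v)
    forward : ∀ u v → T (does (crossing? (u , v))) → u Fin.< v
    forward u v t = does-T (u Fin.<? v) (proj₁ (T-∧⁻ {does (u Fin.<? v)} (proj₁ (does-T (crossing? (u , v)) t))))
    across : ∀ {x y} → x ≺ y → ∑∑ (λ i j → g (vt x i) (vt y j)) ≡ ∑∑ (λ i j → 𝟙 (between {d} {m′} Rm x y i j)) * f x y
    across {x} {y} x≺y = trans (∑∑-cong (λ i j → cong₂ _*_ (cong 𝟙 (same i j)) (cong₂ f (word-vtx {d} {m} x i) (word-vtx {d} {m} y j))))
        (trans (sum-cong-≗ (λ i → trans (sum-cong-≗ (λ j → ℚ.*-comm (b i j) (f x y))) (sym (*-distribˡ-sum (f x y) (b i)))))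
          (trans (sym (*-distribˡ-sum (f x y) (λ i → sum (b i)))) (ℚ.*-comm (f x y) (∑∑ b))))
      where
      b : Fin m → Fin m → ℚ
      b i j = 𝟙 (between {d} {m′} Rm x y i j)
      same : ∀ i j → does (crossing? (vt x i , vt y j)) ≡ between {d} {m′} Rm x y i j
      same i j = bool-≡ (λ t → proj₂ (T-∧⁻ {does (vt x i Fin.<? vt y j)} (proj₁ (does-T (crossing? (vt x i , vt y j)) t))))
        (λ t → T-does (crossing? (vt x i , vt y j)) (T-∧ (T-does (vt x i Fin.<? vt y j) (vtx-mono-≺ {d} {m} i j x≺y)) t ,
          subst₂ _≺_ (sym (word-vtx {d} {m} x i)) (sym (word-vtx {d} {m} y j)) x≺y))
    inside : ∀ x → ∑∑ (λ i j → g (vt x i) (vt x j)) ≡ 0ℚ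
    inside x = sum-zero (λ i → sum-zero (λ j → trans (cong (λ b → 𝟙 b * f (wd (vt x i)) (wd (vt x j))) (bool-≡ {b = false} (λ t →
      ≺-irrefl (subst₂ _≺_ (word-vtx {d} {m} x i) (word-vtx {d} {m} x j) (proj₂ (does-T (crossing? (vt x i , vt x j)) t)))) ⊥-elim)) (ℚ.*-zeroˡ (f (wd (vt x i)) (wd (vt x j))))))

  -- R(m,d) has nearly μ² p edges between the two blocks, and each is counted with weight 1/p; thus
  -- every pair of blocks contributes nearly μ² times its image density.
  dense-pairs : ∀ {x y} → x ≺ y → μ * μ * (imageDensity x y - ε₁ * P) ≤ ∑∑ (λ i j → 𝟙 (between {d} {m′} Rm x y i j)) * f x y
  dense-pairs {x} {y} x≺y = ℚ.≤-trans (*-monoˡ (0≤* (0≤⟨⟩ m) (0≤⟨⟩ m)) pointwise)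
      (ℚ.≤-reflexive (trans (sym (ℚ.*-assoc (μ * μ) mean (f x y))) (cong (_* f x y) (sym (∑∑-𝔼 m′ (λ i j → 𝟙 (between {d} {m′} Rm x y i j)))))))
    where
    p mean w h : ℚ
    p = density x y
    w = multiplicity x y
    h = imageDensity x y
    mean = 𝔼 (uniform m′) (λ i → 𝔼 (uniform m′) (λ j → 𝟙 (between {d} {m′} Rm x y i j)))
    excess : 𝔼 (uniform m′) (λ i → 𝔼 (uniform m′) (λ j → 1ℚ * (𝟙 (between {d} {m′} Rm x y i j) - p))) ≡ mean - p
    excess = trans (𝔼-cong (uniform m′) (λ i → trans (𝔼-cong (uniform m′) (λ j → ℚ.*-identityˡ (𝟙 (between {d} {m′} Rm x y i j) - p)))
      (𝔼-+const (uniform m′) (- p) (λ j → 𝟙 (between {d} {m′} Rm x y i j))))) (𝔼-+const (uniform m′) (- p) (λ i → 𝔼 (uniform m′) (λ j → 𝟙 (between {d} {m′} Rm x y i j))))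
    0≤mean-p+ε : 0ℚ ≤ mean - p + ε₁
    0≤mean-p+ε = subst (λ z → 0ℚ ≤ z + ε₁) excess (proj₂ (Regular.cut reg₁ x≺y (λ _ → true) (λ _ → true)))
    wh≤P : w * h ≤ P
    wh≤P = subst (w * h ≤_) (ℚ.*-identityʳ P) (*-mono (0≤⟨⟩ (2 ^ d)) (0≤imageDensity x y) (multiplicity≤ x y) (imageDensity≤1 x y))
    collect : ∀ h e P w m p → h * (w * p) - e * P + ((m - p + e) * (w * h) + e * (P - w * h)) ≡ m * (w * h)
    collect = solve-∀ ring
    pointwise : h - ε₁ * P ≤ mean * f x y
    pointwise = ≤-by ((mean - p + ε₁) * (w * h) + ε₁ * (P - w * h))
      (0≤+ (0≤* 0≤mean-p+ε (0≤* (0≤⟨⟩ (2 ^ (d ∸ δ x y))) (0≤imageDensity x y))) (0≤* 0≤ε₁ (0≤- wh≤P)))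
      (trans (cong (λ z → z - ε₁ * P + ((mean - p + ε₁) * (w * h) + ε₁ * (P - w * h))) (sym (trans (cong (h *_) (multiplicity-density x y)) (ℚ.*-identityʳ h))))
        (collect h ε₁ P w mean p))

  -- The weighted sum over the crossing edges of R(m,d) is estimated twice: from above by averaging
  -- over placements, from below for each pair of blocks by `dense-pairs`.
  inner-bound : μ * μ * ∑≺ d imageDensity ≤ C + ⟨ n ⟩ * (⟨ n ⟩ * (P * (ρ + ρ))) + μ * μ * (ε₁ * P * W)
  inner-bound = ℚ.≤-trans (ℚ.≤-reflexive (sym split)) (ℚ.+-monoˡ-≤ (μ * μ * (ε₁ * P * W)) (ℚ.≤-trans
      (ℚ.≤-trans (ℚ.≤-reflexive (sym (∑≺-* d (μ * μ) (λ x y → imageDensity x y - ε₁ * P)))) (∑≺-mono d dense-pairs))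
      (ℚ.≤-trans (ℚ.≤-reflexive (sym ∑E-blocks)) ∑E-imageDensity)))
    where
    S : ℚ
    S = ∑≺ d imageDensity
    neg : ∀ a → - a ≡ (- a) * 1ℚ
    neg = solve-∀ ring
    collect : ∀ m s e w → m * (s + (- e) * w) + m * (e * w) ≡ m * s
    collect = solve-∀ ring
    split : μ * μ * ∑≺ d (λ x y → imageDensity x y - ε₁ * P) + μ * μ * (ε₁ * P * W) ≡ μ * μ * S
    split = trans (cong (λ z → μ * μ * z + μ * μ * (ε₁ * P * W)) (trans (∑≺-+ d imageDensity (λ _ _ → - (ε₁ * P)))
        (cong (S +_) (trans (∑≺-cong d (λ _ → neg (ε₁ * P))) (∑≺-* d (- (ε₁ * P)) (λ _ _ → 1ℚ))))))
      (collect (μ * μ) S (ε₁ * P) W)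

-- Choice of parameters for the limit in m

1≤⟨⟩ : ∀ n → 1 ℕ.≤ n → 1ℚ ≤ ⟨ n ⟩
1≤⟨⟩ n 1≤n = subst (_≤ ⟨ n ⟩) ⟨1⟩ (⟨⟩-mono 1≤n)

1≤T-size : ∀ d → 1 ℕ.≤ d → 1ℚ ≤ T-size d
1≤T-size d 1≤d = 1≤⟨⟩ _ (ℕ.*-mono-≤ 1≤d (ℕ.m^n>0 2 (d ∸ 1)))

-- The quotient of M by D, rounded down. Then M/q is at most 2 D, which does not depend on M: the
-- loss s² in `placement-bound` stays fixed while M grows.
window : ∀ D M .⦃ _ : ℕ.NonZero D ⦄ → D ℕ.≤ M → ∃[ q′ ] D ℕ.* suc q′ ℕ.≤ M × M ℕ.≤ 2 ℕ.* D ℕ.* suc q′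
window D M D≤M with M ℕ./ D in eq | ℕ.m≥n⇒m/n>0 {M} {D} D≤M
... | suc q′ | _ = q′ , subst (ℕ._≤ M) (trans (cong (ℕ._* D) eq) (ℕ.*-comm (suc q′) D)) (ℕ.m/n*n≤m M D) ,
  ℕ.≤-trans (ℕ.≤-reflexive (trans (ℕ.m≡m%n+[m/n]*n M D) (cong (λ x → M ℕ.% D ℕ.+ x ℕ.* D) eq)))
    (ℕ.≤-trans (ℕ.+-monoˡ-≤ (suc q′ ℕ.* D) (ℕ.≤-trans (ℕ.<⇒≤ (ℕ.m%n<n M D)) (ℕ.m≤m+n D (q′ ℕ.* D))))
      (ℕ.≤-reflexive (double D (suc q′))))
  where
  double : ∀ D q → q ℕ.* D ℕ.+ q ℕ.* D ≡ 2 ℕ.* D ℕ.* q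
  double = ℕ-solve-∀

module Normalise (em : ExcludedMiddle 0ℓ) {k : ℕ} (F : OrderedGraph k) (d m′ : ℕ) (R : OrderedGraph (2 ^ d ℕ.* suc m′))
  {ε : ℚ} (0≤ε : 0ℚ ≤ ε) (reg : Regular d m′ R ε) where

  private
    N ρ τ : ℚ
    N = ⟨ suc m′ ⟩
    ρ = relDensity em F R
    τ = T-size d
    0<N² : 0ℚ < N * N
    0<N² = 0<* (0<⟨⟩ (suc m′)) (0<⟨⟩ (suc m′))
    0≤ετ : 0ℚ ≤ ε * τ
    0≤ετ = 0≤* 0≤ε (0≤T-size d)
    ρ≤1 : ρ ≤ 1ℚ
    ρ≤1 = relDensity≤1 em F R
    0≤ρ : 0ℚ ≤ ρ
    0≤ρ = 0≤relDensity em F R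

  maxFree-≤ : ⟨ maxFree em F R ⟩ ≤ N * N * (ρ * τ + ε * τ)
  maxFree-≤ = ℚ.≤-trans (ℚ.≤-reflexive (sym (relDensity-* em F R))) (ℚ.≤-trans (*-monoˡ 0≤ρ (Regular.size≤ reg))
    (≤-by (N * N * ((1ℚ - ρ) * (ε * τ))) (0≤* (ℚ.<⇒≤ 0<N²) (0≤* (0≤- ρ≤1) 0≤ετ)) (collect ρ ε τ (N * N))))
    where
    collect : ∀ r e t n → r * ((1ℚ + e) * (t * n)) + n * ((1ℚ - r) * (e * t)) ≡ n * (r * t + e * t)
    collect = solve-∀ ring

  -- The lower bound on the number of edges gives ρ (1 - ε) τ ≤ X, and ρ ≤ 1 turns the factor 1 - ε
  -- into the additive error ετ.
  relDensity-≤ : ∀ {X} → ⟨ maxFree em F R ⟩ ≤ N * N * X → ρ * τ ≤ X + ε * τ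
  relDensity-≤ {X} J≤ = *-cancelˡ 0<N² (ℚ.≤-trans (≤-by (N * N * ((1ℚ - ρ) * (ε * τ)))
      (0≤* (ℚ.<⇒≤ 0<N²) (0≤* (0≤- ρ≤1) 0≤ετ)) (collect ρ ε τ (N * N)))
    (ℚ.≤-trans (ℚ.+-monoˡ-≤ (N * N * (ε * τ)) (ℚ.≤-trans (*-monoˡ 0≤ρ (Regular.size≥ reg)) (ℚ.≤-trans (ℚ.≤-reflexive (relDensity-* em F R)) J≤)))
      (ℚ.≤-reflexive (sym (ℚ.*-distribˡ-+ (N * N) X (ε * τ))))))
    where
    collect : ∀ r e t n → n * (r * t) + n * ((1ℚ - r) * (e * t)) ≡ r * ((1ℚ - e) * (t * n)) + n * (e * t)
    collect = solve-∀ ring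

thirds : ∀ {ε} → ½ * ε + (½ * (½ * ε) + ½ * (½ * ε)) ≡ ε
thirds {ε} = eq ε
  where
  eq : ∀ ε → ½ * ε + (½ * (½ * ε) + ½ * (½ * ε)) ≡ ε
  eq = solve-∀ ring

0<½* : ∀ {ε} → 0ℚ < ε → 0ℚ < ½ * ε
0<½* 0<ε = 0<* (ℚ.positive⁻¹ ½) 0<ε

maxFree-≤-sup : ∀ (em : ExcludedMiddle 0ℓ) {k n} (F : OrderedGraph k) (G : OrderedGraph n) {b} → 0ℚ ≤ b →
  (∀ {n′} {G′ : OrderedGraph n′} → G′ ⊑ G → ¬ (F ⊑ G′) → ⟨ e G′ ⟩ ≤ b) → ⟨ maxFree em F G ⟩ ≤ b
maxFree-≤-sup em F G {b} 0≤b bound with maxUpTo-attained {FreeSubgraph F G} (λ _ → em) (e G)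
... | inj₁ eq = subst (_≤ b) (sym (trans (cong ⟨_⟩ eq) ⟨0⟩)) 0≤b
... | inj₂ (n′ , G′ , G′⊑G , free , eq) = subst (λ j → ⟨ j ⟩ ≤ b) eq (bound G′⊑G free)

module _ (em : ExcludedMiddle 0ℓ) (R : (m d : ℕ) → OrderedGraph (2 ^ d ℕ.* m)) (fam : IsRFamily R) {k : ℕ} (F : OrderedGraph k)
  (d : ℕ) (1≤d : 1 ℕ.≤ d) where

  private
    τ P W : ℚ
    τ = T-size d
    P = ⟨ 2 ^ d ⟩
    W = ∑≺ d (λ _ _ → 1ℚ)
    ρ : ℕ → ℚ
    ρ m = relDensity em F (R m d)
    0≤τ : 0ℚ ≤ τ
    0≤τ = 0≤T-size d
    0<τ : 0ℚ < τ
    0<τ = ℚ.<-≤-trans (ℚ.positive⁻¹ 1ℚ) (1≤T-size d 1≤d)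

  private
    module Step {ε : ℚ} (0<ε : 0ℚ < ε) (m′ M′ κ q′ : ℕ) (ε₁ ε₂ K : ℚ) (0≤ε₁ : 0ℚ ≤ ε₁) (0≤ε₂ : 0ℚ ≤ ε₂)
      (reg₁ : Regular d m′ (R (suc m′) d) ε₁) (reg₂ : Regular d M′ (R (suc M′) d) ε₂)
      (K≡ : K ≡ Placement.errorFactor (R (suc m′) d) (word d (suc m′)) ⟨ maxFree em F (R (suc m′) d) ⟩)
      (ε₁≤ : ε₁ * (τ + P * W) ≤ ½ * ε)
      (κ≤ : inv κ * (⟨ 2 ^ d ℕ.* suc m′ ⟩ * (⟨ 2 ^ d ℕ.* suc m′ ⟩ * (P + P))) ≤ ½ * (½ * ε))
      (s : ℕ) (ε₂≤ : ε₂ * (1ℚ + τ + K * (⟨ s ⟩ * ⟨ s ⟩)) ≤ ½ * (½ * ε))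
      (Dq≤M : suc (suc κ) ℕ.* suc m′ ℕ.* suc q′ ℕ.≤ suc M′) (M≤sq : suc M′ ℕ.≤ s ℕ.* suc q′) where
      m n M q Z′ : ℕ
      m = suc m′
      n = 2 ^ d ℕ.* m
      M = suc M′
      q = suc q′
      Z′ = M ∸ suc (m ℕ.* q)
      μ c : ℚ
      μ = ⟨ m ⟩
      c = ⟨ maxFree em F (R m d) ⟩

      split : suc (suc κ) ℕ.* m ℕ.* q ≡ m ℕ.* q ℕ.+ suc κ ℕ.* (m ℕ.* q)
      split = ℕ.*-assoc (suc (suc κ)) m q
      mq<M : m ℕ.* q ℕ.< M
      mq<M = ℕ.<-≤-trans (ℕ.<-≤-trans (ℕ.m<m+n (m ℕ.* q) (ℕ.s≤s ℕ.z≤n)) (ℕ.≤-reflexive (sym split))) Dq≤M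
      M≡ : suc Z′ ℕ.+ m ℕ.* q ≡ M
      M≡ = trans (sym (ℕ.+-suc Z′ (m ℕ.* q))) (ℕ.m∸n+n≡m mq<M)
      gap : ⟨ m ℕ.* q ⟩ ≤ inv κ * ⟨ M ⟩
      gap = *-cancelˡ (0<⟨⟩ (suc κ)) (subst₂ _≤_ (⟨⟩-* (suc κ) (m ℕ.* q)) (trans (sym (ℚ.*-identityˡ ⟨ M ⟩))
          (trans (cong (_* ⟨ M ⟩) (sym (inv-* κ))) (reorder (inv κ) ⟨ suc κ ⟩ ⟨ M ⟩)))
        (⟨⟩-mono (ℕ.≤-trans (ℕ.m≤n+m (suc κ ℕ.* (m ℕ.* q)) (m ℕ.* q)) (ℕ.≤-trans (ℕ.≤-reflexive (sym split)) Dq≤M))))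
        where
        reorder : ∀ a b c → a * b * c ≡ b * (a * c)
        reorder = solve-∀ ring

      A₁ A₂ A₃ X : ℚ
      A₁ = K * (⟨ s ⟩ * ⟨ s ⟩ * ε₂)
      A₂ = ⟨ n ⟩ * (⟨ n ⟩ * (P * (inv κ + inv κ)))
      A₃ = ε₁ * P * W
      X = ρ m * τ + ε₁ * τ + A₁ + A₂ + A₃

      0≤A₁ : 0ℚ ≤ A₁
      0≤A₁ = 0≤* (subst (0ℚ ≤_) (sym K≡) (Placement.0≤errorFactor (R m d) (word d m) (0≤⟨⟩ (maxFree em F (R m d))))) (0≤* (0≤* (0≤⟨⟩ s) (0≤⟨⟩ s)) 0≤ε₂)
      0≤A₂ : 0ℚ ≤ A₂
      0≤A₂ = 0≤* (0≤⟨⟩ n) (0≤* (0≤⟨⟩ n) (0≤* (0≤⟨⟩ (2 ^ d)) (0≤+ (0≤inv κ) (0≤inv κ))))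
      0≤A₃ : 0ℚ ≤ A₃
      0≤A₃ = 0≤* (0≤* 0≤ε₁ (0≤⟨⟩ (2 ^ d))) (0≤∑≺1 d)
      0≤X : 0ℚ ≤ X
      0≤X = 0≤+ (0≤+ (0≤+ (0≤+ (0≤* (0≤relDensity em F (R m d)) 0≤τ) (0≤* 0≤ε₁ 0≤τ)) 0≤A₁) 0≤A₂) 0≤A₃

      density-bound : ∀ {n′} {G′ : OrderedGraph n′} (G′⊑R : G′ ⊑ R M d) → ¬ (F ⊑ G′) → ∑≺ d (ImageDensity.imageDensity G′⊑R reg₂) ≤ X
      density-bound G′⊑R free = *-cancelˡ 0<μ² (ℚ.≤-trans inner
          (ℚ.≤-trans (ℚ.+-monoˡ-≤ (μ * μ * A₃) (ℚ.+-monoˡ-≤ A₂ (ℚ.+-monoˡ-≤ A₁ (Normalise.maxFree-≤ em F d m′ (R m d) 0≤ε₁ reg₁))))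
            -- As μ² ≥ 1, the errors A₁ and A₂ may be multiplied by μ², which makes μ² a common
            -- factor that cancels.
            (≤-by ((μ * μ - 1ℚ) * (A₁ + A₂)) (0≤* (0≤- 1≤μ²) (0≤+ 0≤A₁ 0≤A₂)) (collect (μ * μ) (ρ m * τ + ε₁ * τ) A₁ A₂ A₃))))
        where
        inner : μ * μ * ∑≺ d (ImageDensity.imageDensity G′⊑R reg₂) ≤ c + A₁ + A₂ + μ * μ * A₃
        inner = subst (λ K → μ * μ * ∑≺ d (ImageDensity.imageDensity G′⊑R reg₂) ≤ c + K * (⟨ s ⟩ * ⟨ s ⟩ * ε₂) + A₂ + μ * μ * A₃) (sym K≡)
          (Inner.inner-bound em F d m′ M′ Z′ q′ s M≡ M≤sq {inv κ} gap (R m d) 0≤ε₁ reg₁ (R M d) 0≤ε₂ reg₂ G′⊑R free)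
        0<μ² : 0ℚ < μ * μ
        0<μ² = 0<* (0<⟨⟩ m) (0<⟨⟩ m)
        1≤μ² : 1ℚ ≤ μ * μ
        1≤μ² = subst (_≤ μ * μ) (ℚ.*-identityˡ 1ℚ) (*-mono (0≤⟨⟩ m) 0≤1 (1≤⟨⟩ m (ℕ.s≤s ℕ.z≤n)) (1≤⟨⟩ m (ℕ.s≤s ℕ.z≤n)))
        collect : ∀ m a b c e → m * a + b + c + m * e + (m - 1ℚ) * (b + c) ≡ m * (a + b + c + e)
        collect = solve-∀ ring

      maxFree-bound : ⟨ maxFree em F (R M d) ⟩ ≤ ⟨ M ⟩ * ⟨ M ⟩ * (X + ε₂)
      maxFree-bound = maxFree-≤-sup em F (R M d) (0≤* 0≤M² (0≤+ 0≤X 0≤ε₂)) (λ G′⊑R free →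
        ℚ.≤-trans (ImageDensity.⟨e⟩-imageDensity G′⊑R reg₂) (*-monoˡ 0≤M² (ℚ.+-monoˡ-≤ ε₂ (density-bound G′⊑R free))))
        where
        0≤M² : 0ℚ ≤ ⟨ M ⟩ * ⟨ M ⟩
        0≤M² = 0≤* (0≤⟨⟩ M) (0≤⟨⟩ M)

      conclusion : ρ M ≤ ρ m + ε
      conclusion = *-cancelˡ 0<τ (subst (_≤ τ * (ρ m + ε)) (ℚ.*-comm (ρ M) τ) (ℚ.≤-trans
        (Normalise.relDensity-≤ em F d M′ (R M d) 0≤ε₂ reg₂ maxFree-bound)
        (ℚ.≤-trans (ℚ.≤-reflexive (collect (ρ m) τ ε₁ K (⟨ s ⟩ * ⟨ s ⟩) ε₂ ⟨ n ⟩ P (inv κ) W))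
        (ℚ.≤-trans (ℚ.+-monoʳ-≤ (ρ m * τ) (ℚ.≤-trans (ℚ.+-mono-≤ ε₁≤ (ℚ.+-mono-≤ κ≤ ε₂≤)) (ℚ.≤-reflexive (thirds {ε}))))
          (ℚ.≤-trans (ℚ.+-monoʳ-≤ (ρ m * τ) (subst (_≤ ε * τ) (ℚ.*-identityʳ ε) (*-monoˡ (ℚ.<⇒≤ 0<ε) (1≤T-size d 1≤d))))
            (ℚ.≤-reflexive (factor (ρ m) ε τ)))))))
        where
        factor : ∀ r e t → r * t + e * t ≡ t * (r + e)
        factor = solve-∀ ring
        collect : ∀ r t e1 K s e2 n p i w → r * t + e1 * t + K * (s * e2) + n * (n * (p * (i + i))) + e1 * p * w + e2 + e2 * t ≡
          r * t + (e1 * (t + p * w) + (i * (n * (n * (p + p))) + e2 * (1ℚ + t + K * s)))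
        collect = solve-∀ ring

  -- The order of choices matters: first the regularity for m; then m fixes κ, the bound s on M/q
  -- and the error factor K; only then the regularity for M is chosen. So the threshold for M
  -- depends on m.
  almost-decreasing : ∀ {ε} → 0ℚ < ε → ∃[ m₀ ] ∀ m → m₀ ℕ.≤ m → ∃[ M₀ ] ∀ M → M₀ ℕ.≤ M → ρ M ≤ ρ m + ε
  almost-decreasing {ε} 0<ε with small (0<½* 0<ε) (τ + P * W)
  ... | k₁ , k₁≤ with regular-family R fam d 1≤d (0<inv k₁)
  ... | m₁ , regs₁ = suc m₁ , inner
    where
    inner : ∀ m → suc m₁ ℕ.≤ m → ∃[ M₀ ] ∀ M → M₀ ℕ.≤ M → ρ M ≤ ρ m + ε
    inner (suc m′) (ℕ.s≤s m₁≤m′) with small (0<½* (0<½* 0<ε)) (⟨ 2 ^ d ℕ.* suc m′ ⟩ * (⟨ 2 ^ d ℕ.* suc m′ ⟩ * (P + P)))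
    ... | κ , κ≤ = rest (2 ℕ.* (suc (suc κ) ℕ.* suc m′)) refl (Placement.errorFactor (R (suc m′) d) (word d (suc m′)) ⟨ maxFree em F (R (suc m′) d) ⟩) refl
      where
      -- D q ≤ M leaves room for κ + 1 further stretches of m q positions beside the window. Hence m
      -- q ≤ M / (κ + 1), and m q < M leaves at least one offset.
      D : ℕ
      D = suc (suc κ) ℕ.* suc m′
      rest : ∀ s → 2 ℕ.* D ≡ s → ∀ K → K ≡ Placement.errorFactor (R (suc m′) d) (word d (suc m′)) ⟨ maxFree em F (R (suc m′) d) ⟩ →
        ∃[ M₀ ] ∀ M → M₀ ℕ.≤ M → ρ M ≤ ρ (suc m′) + ε
      rest s s≡ K K≡ with small (0<½* (0<½* 0<ε)) (1ℚ + τ + K * (⟨ s ⟩ * ⟨ s ⟩))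
      ... | k₂ , k₂≤ with regular-family R fam d 1≤d (0<inv k₂)
      ... | m₂ , regs₂ = suc (D ℕ.⊔ m₂) , outer
        where
        outer : ∀ M → suc (D ℕ.⊔ m₂) ℕ.≤ M → ρ M ≤ ρ (suc m′) + ε
        outer (suc M′) (ℕ.s≤s le) with window D (suc M′) (ℕ.m≤n⇒m≤1+n (ℕ.≤-trans (ℕ.m≤m⊔n D m₂) le))
        ... | q′ , Dq≤M , M≤2Dq = Step.conclusion {ε} 0<ε m′ M′ κ q′ (inv k₁) (inv k₂) K (0≤inv k₁) (0≤inv k₂)
          (regs₁ m′ (ℕ.m≤n⇒m≤1+n m₁≤m′)) (regs₂ M′ (ℕ.m≤n⇒m≤1+n (ℕ.≤-trans (ℕ.m≤n⊔m D m₂) le)))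
          K≡ k₁≤ κ≤ s k₂≤ Dq≤M (subst (λ t → suc M′ ℕ.≤ t ℕ.* suc q′) s≡ M≤2Dq)

-- Spreading the copies of G over the levels of the tree

module Tree {n : ℕ} (G : OrderedGraph n) (k : ℕ) where
  open Comb k
  open Hide k

  edgeSum : (Fin n → Fin n → ℚ) → ℚ
  edgeSum f = ∑∑ (λ u v → 𝟙 (edge G u v) * f u v)

  edgeSum-mono : ∀ {f g} → (∀ u v → u Fin.< v → f u v ≤ g u v) → edgeSum f ≤ edgeSum g
  edgeSum-mono {f} {g} f≤g = ∑∑-mono (λ u v → pointwise u v (edge G u v) (λ t → does-T (u Fin.<? v) (proj₁ (T-∧⁻ {does (u Fin.<? v)} t))))
    where
    pointwise : ∀ u v b → (T b → u Fin.< v) → 𝟙 b * f u v ≤ 𝟙 b * g u v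
    pointwise u v true  lt = *-monoˡ 0≤1 (f≤g u v (lt _))
    pointwise u v false lt = ℚ.≤-reflexive (trans (ℚ.*-zeroˡ (f u v)) (sym (ℚ.*-zeroˡ (g u v))))

  edgeSum-+const : ∀ f c → edgeSum (λ u v → f u v + c) ≡ edgeSum f + ⟨ e G ⟩ * c
  edgeSum-+const f c = trans (sum-cong-≗ (λ u → trans (sum-cong-≗ (λ v → trans (ℚ.*-distribˡ-+ (b u v) (f u v) c) (cong (b u v * f u v +_) (ℚ.*-comm (b u v) c))))
      (trans (∑-distrib-+ (λ v → b u v * f u v) (λ v → c * b u v)) (cong (sum (λ v → b u v * f u v) +_) (sym (*-distribˡ-sum c (b u)))))))
    (trans (∑-distrib-+ (λ u → sum (λ v → b u v * f u v)) (λ u → c * sum (b u))) (cong (edgeSum f +_)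
      (trans (sym (*-distribˡ-sum c (λ u → sum (b u)))) (trans (cong (c *_) (sym (⟨e⟩ G))) (ℚ.*-comm c ⟨ e G ⟩)))))
    where
    b : Fin n → Fin n → ℚ
    b u v = 𝟙 (edge G u v)

  edgeSum-𝔼 : ∀ {A : Set} (α : Average A) (f : A → Fin n → Fin n → ℚ) → 𝔼 α (λ a → edgeSum (f a)) ≡ edgeSum (λ u v → 𝔼 α (λ a → f a u v))
  edgeSum-𝔼 α f = trans (𝔼-sum α {n} (λ u a → sum (λ v → 𝟙 (edge G u v) * f a u v))) (sum-cong-≗ (λ u →
    trans (𝔼-sum α {n} (λ v a → 𝟙 (edge G u v) * f a u v)) (sum-cong-≗ (λ v → 𝔼-* α (𝟙 (edge G u v)) (λ a → f a u v)))))

  edgeSum-const : ∀ c → edgeSum (λ _ _ → c) ≡ ⟨ e G ⟩ * c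
  edgeSum-const c = trans (sum-cong-≗ (λ u → sum-cong-≗ (λ v → cong (𝟙 (edge G u v) *_) (sym (ℚ.+-identityˡ c)))))
    (trans (edgeSum-+const (λ _ _ → 0ℚ) c) (trans (cong (_+ ⟨ e G ⟩ * c) (sum-zero (λ u → sum-zero (λ v → ℚ.*-zeroʳ (𝟙 (edge G u v)))))) (ℚ.+-identityˡ (⟨ e G ⟩ * c))))

  -- The bound b holds for every chain, hence on average over a random common prefix of c bits
  -- followed by a comb. There the level of an edge uv lies in the run of its smaller end u, shifted
  -- by c.
  comb-bound : ∀ d (g : Word d → Word d → ℚ) {B b} → (∀ x y → 0ℚ ≤ g x y) → (∀ x y → g x y ≤ B) →
    (∀ (ch : Chain n d) → edgeSum (λ u v → g (proj₁ ch u) (proj₁ ch v)) ≤ b) → ∀ c e′ → d ≡ c ℕ.+ dep n e′ →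
    edgeSum (λ u v → 𝔼 (uniform K′) (λ r → lev d g (c ℕ.+ (Fin.toℕ u ℕ.* K ℕ.+ Fin.toℕ r)))) ≤ b + ⟨ e G ⟩ * (⟨ n ⟩ * (B * inv k))
  comb-bound d g {B} {b} 0≤g g≤B bound c e′ refl = ℚ.≤-trans (edgeSum-mono {L} {λ u v → X u v + ζ} each)
    (ℚ.≤-trans (ℚ.≤-reflexive (edgeSum-+const X ζ)) (ℚ.+-monoˡ-≤ (⟨ e G ⟩ * ζ)
      (ℚ.≤-trans (ℚ.≤-reflexive (sym (edgeSum-𝔼 chains (λ ch u v → g (proj₁ ch u) (proj₁ ch v))))) (𝔼-≤ chains bound))))
    where
    ζ : ℚ
    ζ = ⟨ n ⟩ * (B * inv k)
    prefix : Word c → Chain n (dep n e′) → Chain n (c ℕ.+ dep n e′)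
    prefix w (v , inc) = (λ u → w Vec.++ v u) , λ i j i<j → ++-≺ w (inc i j i<j)
    chains : Average (Chain n (c ℕ.+ dep n e′))
    chains = bind (Words c) λ w → bind (comb n e′) λ ch → return (prefix w ch)
    ℓ : Fin n → Fin K → ℕ
    ℓ u r = Fin.toℕ u ℕ.* K ℕ.+ Fin.toℕ r
    L X : Fin n → Fin n → ℚ
    L u v = 𝔼 (uniform K′) (λ r → lev (c ℕ.+ dep n e′) g (c ℕ.+ ℓ u r))
    X u v = 𝔼 chains (λ ch → g (proj₁ ch u) (proj₁ ch v))
    gw : Word c → Word (dep n e′) → Word (dep n e′) → ℚ
    gw w x y = g (w Vec.++ x) (w Vec.++ y)
    each : ∀ u v → u Fin.< v → L u v ≤ X u v + ζ
    each u v u<v = ℚ.≤-trans (ℚ.≤-reflexive (trans (𝔼-cong (uniform K′) (λ r → lev-prefix c (dep n e′) g (ℓ u r)))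
        (sym (𝔼-swap-uniform (Words c) K′ (λ w r → lev (dep n e′) (gw w) (ℓ u r))))))
      (ℚ.≤-trans (𝔼-mono (Words c) (λ w → comb-pair n e′ u v u<v (gw w) (λ x y → 0≤g (w Vec.++ x) (w Vec.++ y)) (λ x y → g≤B (w Vec.++ x) (w Vec.++ y))))
        (ℚ.≤-reflexive (𝔼-+const (Words c) ζ (λ w → 𝔼 (comb n e′) (λ ch → gw w (proj₁ ch u) (proj₁ ch v))))))

  -- Letting the start c of the runs vary spreads the level of every edge over nearly all levels,
  -- since the nK positions of the runs are at most a proportion ρ of the depth. The bound for
  -- chains becomes one for a uniform level.
  tree-average : ∀ d′ C′ → suc C′ ℕ.+ n ℕ.* K ≡ suc d′ → ∀ (g : Word (suc d′) → Word (suc d′) → ℚ) {B b ρ} →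
    (∀ x y → 0ℚ ≤ g x y) → (∀ x y → g x y ≤ B) → 0ℚ ≤ B → ⟨ n ℕ.* K ⟩ ≤ ρ * ⟨ suc d′ ⟩ →
    (∀ (ch : Chain n (suc d′)) → edgeSum (λ u v → g (proj₁ ch u) (proj₁ ch v)) ≤ b) →
    ⟨ e G ⟩ * 𝔼 (uniform d′) (λ ℓ → lev (suc d′) g (Fin.toℕ ℓ)) ≤ b + ⟨ e G ⟩ * (⟨ n ⟩ * (B * inv k)) + ⟨ e G ⟩ * (B * ρ)
  tree-average d′ C′ C≡ g {B} {b} {ρ} 0≤g g≤B 0≤B gap bound = ℚ.≤-trans (ℚ.≤-reflexive (sym (edgeSum-const ā)))
    (ℚ.≤-trans (edgeSum-mono {λ _ _ → ā} {λ u v → X u v + B * ρ} (λ u v _ → each u v)) (ℚ.≤-trans (ℚ.≤-reflexive (edgeSum-+const X (B * ρ)))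
      (ℚ.+-monoˡ-≤ (⟨ e G ⟩ * (B * ρ)) (ℚ.≤-trans (ℚ.≤-reflexive (sym (edgeSum-𝔼 (uniform C′) (λ c u v → 𝔼 (uniform K′) (λ r → a (Fin.toℕ c ℕ.+ ℓ u r))))))
        (𝔼-≤ (uniform C′) (λ c → comb-bound (suc d′) g 0≤g g≤B bound (Fin.toℕ c) (rest c) (depth c)))))))
    where
    a : ℕ → ℚ
    a = lev (suc d′) g
    ā : ℚ
    ā = 𝔼 (uniform d′) (λ ℓ → a (Fin.toℕ ℓ))
    ℓ : Fin n → Fin K → ℕ
    ℓ u r = Fin.toℕ u ℕ.* K ℕ.+ Fin.toℕ r
    X : Fin n → Fin n → ℚ
    X u v = 𝔼 (uniform C′) (λ c → 𝔼 (uniform K′) (λ r → a (Fin.toℕ c ℕ.+ ℓ u r)))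
    rest : Fin (suc C′) → ℕ
    rest c = suc C′ ∸ Fin.toℕ c
    depth : ∀ c → suc d′ ≡ Fin.toℕ c ℕ.+ dep n (rest c)
    depth c = trans (sym C≡) (sym (trans (cong (Fin.toℕ c ℕ.+_) (trans (dep-+ n (rest c)) (ℕ.+-comm (n ℕ.* K) (rest c))))
      (trans (sym (ℕ.+-assoc (Fin.toℕ c) (rest c) (n ℕ.* K))) (cong (ℕ._+ n ℕ.* K) (ℕ.m+[n∸m]≡n (ℕ.<⇒≤ (Fin.toℕ<n c)))))))
    ℓ<nK : ∀ u r → ℓ u r ℕ.< n ℕ.* K
    ℓ<nK u r = ℕ.<-≤-trans (ℕ.+-monoʳ-< (Fin.toℕ u ℕ.* K) (Fin.toℕ<n r)) (ℕ.≤-trans (ℕ.≤-reflexive (ℕ.+-comm (Fin.toℕ u ℕ.* K) K))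
      (ℕ.*-monoˡ-≤ K (Fin.toℕ<n u)))
    ι : Fin n → Fin K → Fin (suc C′) → Fin (suc d′)
    ι u r c = Fin.fromℕ< (subst (Fin.toℕ c ℕ.+ ℓ u r ℕ.<_) C≡ (ℕ.+-mono-< (Fin.toℕ<n c) (ℓ<nK u r)))
    toℕ-ι : ∀ u r c → Fin.toℕ (ι u r c) ≡ Fin.toℕ c ℕ.+ ℓ u r
    toℕ-ι u r c = Fin.toℕ-fromℕ< _
    ι-injective : ∀ u r → Injective _≡_ _≡_ (ι u r)
    ι-injective u r {c} {c′} eq = Fin.toℕ-injective (ℕ.+-cancelʳ-≡ (ℓ u r) (Fin.toℕ c) (Fin.toℕ c′)
      (trans (sym (toℕ-ι u r c)) (trans (cong Fin.toℕ eq) (toℕ-ι u r c′))))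
    gap′ : ⟨ suc d′ ⟩ - ⟨ suc C′ ⟩ ≤ ρ * ⟨ suc d′ ⟩
    gap′ = subst (_≤ ρ * ⟨ suc d′ ⟩) (sym (trans (cong (_- ⟨ suc C′ ⟩) (trans (cong ⟨_⟩ (sym C≡)) (⟨⟩-+ (suc C′) (n ℕ.* K)))) (cancel ⟨ suc C′ ⟩ ⟨ n ℕ.* K ⟩))) gap
      where
      cancel : ∀ z a → z + a - z ≡ a
      cancel = solve-∀ ring
    each : ∀ u v → ā ≤ X u v + B * ρ
    each u v = ℚ.≤-trans (𝔼-≥ (uniform K′) (λ r → subst (λ z → ā ≤ z + B * ρ) (𝔼-cong (uniform C′) (λ c → cong a (toℕ-ι u r c)))
        (shift-average (ι u r) (ι-injective u r) {B} {ρ} 0≤B gap′ (λ ℓ → a (Fin.toℕ ℓ)) (λ ℓ → lev-nonneg (suc d′) 0≤g (Fin.toℕ ℓ)) (λ ℓ → lev-≤ (suc d′) 0≤B g≤B (Fin.toℕ ℓ)))))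
      (ℚ.≤-reflexive (trans (𝔼-+const (uniform K′) (B * ρ) (λ r → 𝔼 (uniform C′) (λ c → a (Fin.toℕ c ℕ.+ ℓ u r))))
        (cong (_+ B * ρ) (𝔼-swap-uniform (uniform K′) C′ (λ r c → a (Fin.toℕ c ℕ.+ ℓ u r))))))

-- Bounds `errorFactor` for all chains at once: G has at most n² crossing edges.
chainErrorFactor : ∀ d n → ℚ → ℚ
chainErrorFactor d n c = ⟨ (2 ^ d) ^ (n ℕ.* n) ⟩ * ((c + ⟨ n ℕ.* n ⟩) * ⟨ n ℕ.* n ⟩)

module Outer (em : ExcludedMiddle 0ℓ) {κ₀ : ℕ} (F : OrderedGraph κ₀) {n : ℕ} (G : OrderedGraph n) (d M′ : ℕ)
  (R : OrderedGraph (2 ^ d ℕ.* suc M′)) {ε : ℚ} (0≤ε : 0ℚ ≤ ε) (reg : Regular d M′ R ε) (εP≤1 : ε * ⟨ 2 ^ d ⟩ ≤ 1ℚ)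
  {n′ : ℕ} {G′ : OrderedGraph n′} (G′⊑R : G′ ⊑ R) (free : ¬ (F ⊑ G′)) where

  open ImageDensity G′⊑R reg

  private
    c 2ℚ : ℚ
    c = ⟨ maxFree em F G ⟩
    2ℚ = 1ℚ + 1ℚ

  -- Set to 0 unless x ≺ y, so that the bound by 2 holds for all pairs of words.
  relative : Word d → Word d → ℚ
  relative x y = 𝟙 (does (x ≺? y)) * (multiplicity x y * imageDensity x y)

  0≤relative : ∀ x y → 0ℚ ≤ relative x y
  0≤relative x y = 0≤* (0≤𝟙 (does (x ≺? y))) (0≤* (0≤⟨⟩ (2 ^ (d ∸ δ x y))) (0≤imageDensity x y))

  -- Hiding forced bits costs a multiple of this bound, so it must not depend on d. The ratio of
  -- image density to density exceeds 1 by at most ε times the multiplicity, hence by at most ε 2^d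
  -- ≤ 1.
  relative≤2 : ∀ x y → relative x y ≤ 2ℚ
  relative≤2 x y = bound (x ≺? y)
    where
    w : ℚ
    w = multiplicity x y
    expand : ∀ w p e → w * (p + e) ≡ w * p + e * w
    expand = solve-∀ ring
    bound : (x≺?y : Dec (x ≺ y)) → 𝟙 (does x≺?y) * (w * imageDensity x y) ≤ 2ℚ
    bound (no _)    = subst (_≤ 2ℚ) (sym (ℚ.*-zeroˡ (w * imageDensity x y))) (0≤+ 0≤1 0≤1)
    bound (yes x≺y) = subst (_≤ 2ℚ) (sym (ℚ.*-identityˡ (w * imageDensity x y))) (ℚ.≤-trans (*-monoˡ (0≤⟨⟩ (2 ^ (d ∸ δ x y))) (imageDensity-bound x≺y))
      (ℚ.≤-trans (ℚ.≤-reflexive (expand w (density x y) ε)) (ℚ.+-mono-≤ (ℚ.≤-reflexive (multiplicity-density x y))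
        (ℚ.≤-trans (*-monoˡ 0≤ε (multiplicity≤ x y)) εP≤1))))

  ∑≺-relative : ∑≺ d imageDensity ≡ ∑≺ d (λ x y → density x y * relative x y)
  ∑≺-relative = ∑≺-cong d (λ {x} {y} x≺y → each x≺y (x ≺? y))
    where
    regroup : ∀ p w h → p * (1ℚ * (w * h)) ≡ w * p * h
    regroup = solve-∀ ring
    each : ∀ {x y} → x ≺ y → (x≺?y : Dec (x ≺ y)) → imageDensity x y ≡ density x y * (𝟙 (does x≺?y) * (multiplicity x y * imageDensity x y))
    each {x} {y} x≺y (yes _) = sym (trans (regroup (density x y) (multiplicity x y) (imageDensity x y))
      (trans (cong (_* imageDensity x y) (multiplicity-density x y)) (ℚ.*-identityˡ (imageDensity x y))))
    each x≺y (no x⊀y) = ⊥-elim (x⊀y x≺y)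

  -- A chain sends the vertices of G to distinct blocks in increasing order, so every edge is
  -- crossing and whole blocks serve as windows, with s = 1.
  chain-bound : ∀ k (ch : Chain n d) → Tree.edgeSum G k (λ u v → relative (proj₁ ch u) (proj₁ ch v)) ≤ c + chainErrorFactor d n c * ε
  chain-bound k (v , inc) = ℚ.≤-trans (ℚ.≤-reflexive (∑∑-cong (λ a b → sym (trans (cong (_* X a b) (𝟙-∧ (edge G a b) (does (v a ≺? v b))))
      (ℚ.*-assoc (𝟙 (edge G a b)) (𝟙 (does (v a ≺? v b))) (X a b))))))
    (ℚ.≤-trans (placement-bound em F 0≤ε reg G′⊑R free {M′} {1} (ℕ.≤-reflexive (sym (ℕ.*-identityˡ (suc M′)))) (λ _ r → r) (λ _ eq → eq)
        (λ {a} {b} a<b r r′ → vtx-mono-≺ {d} {suc M′} r r′ (inc a b a<b)))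
      (ℚ.+-monoʳ-≤ c (ℚ.≤-trans (ℚ.≤-reflexive (cong (errorFactor c *_) (trans (cong (λ z → z * z * ε) ⟨1⟩) (one ε)))) (*-monoʳ 0≤ε factor≤))))
    where
    open Placement G v
    X : Fin n → Fin n → ℚ
    X a b = multiplicity (v a) (v b) * imageDensity (v a) (v b)
    one : ∀ e → 1ℚ * 1ℚ * e ≡ e
    one = solve-∀ ring
    l : ℕ
    l = length crossingEdges
    l≤ : l ℕ.≤ n ℕ.* n
    l≤ = ⟨⟩-cancel (ℚ.≤-trans (ℚ.≤-reflexive (length-pairs n crossing?)) (ℚ.≤-trans (∑∑-mono {g = λ _ _ → 1ℚ} (λ u v → 𝟙≤1 (does (crossing? (u , v)))))
      (ℚ.≤-reflexive (trans (sum-cong-≗ (λ (u : Fin n) → trans (sum-const n 1ℚ) (ℚ.*-identityʳ ⟨ n ⟩))) (trans (sum-const n ⟨ n ⟩) (sym (⟨⟩-* n n)))))))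
    0≤c : 0ℚ ≤ c
    0≤c = 0≤⟨⟩ (maxFree em F G)
    factor≤ : errorFactor c ≤ chainErrorFactor d n c
    factor≤ = *-mono (0≤⟨⟩ ((2 ^ d) ^ (n ℕ.* n))) (0≤* (0≤+ 0≤c (0≤⟨⟩ l)) (0≤⟨⟩ l)) (⟨⟩-mono (ℕ.^-monoʳ-≤ (2 ^ d) ⦃ ℕ.m^n≢0 2 d ⦄ l≤))
      (*-mono (0≤+ 0≤c (0≤⟨⟩ (n ℕ.* n))) (0≤⟨⟩ l) (ℚ.+-monoʳ-≤ c (⟨⟩-mono l≤)) (⟨⟩-mono l≤))

module OuterStep (em : ExcludedMiddle 0ℓ) {κ₀ : ℕ} (F : OrderedGraph κ₀) {n : ℕ} (G : OrderedGraph n) (0<e : 0 ℕ.< e G) (d′ M′ k C′ : ℕ)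
  (C≡ : suc C′ ℕ.+ n ℕ.* Hide.K k ≡ suc d′) {ρ : ℚ} (0≤ρ : 0ℚ ≤ ρ) (gap : ⟨ n ℕ.* Hide.K k ⟩ ≤ ρ * ⟨ suc d′ ⟩)
  (R : OrderedGraph (2 ^ suc d′ ℕ.* suc M′)) {ε : ℚ} (0≤ε : 0ℚ ≤ ε) (reg : Regular (suc d′) M′ R ε) (εP≤1 : ε * ⟨ 2 ^ suc d′ ⟩ ≤ 1ℚ) where

  private
    d M : ℕ
    d = suc d′
    M = suc M′
    c g τ E₀ ζ A : ℚ
    c = ⟨ maxFree em F G ⟩
    g = ⟨ e G ⟩
    τ = T-size d
    E₀ = chainErrorFactor d n c * ε
    ζ = ⟨ n ⟩ * ((1ℚ + 1ℚ) * inv k)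
    A = relDensity em F G + (E₀ + ζ + (1ℚ + 1ℚ) * ρ)
    1≤g : 1ℚ ≤ g
    1≤g = 1≤⟨⟩ (e G) 0<e
    0<g : 0ℚ < g
    0<g = ℚ.<-≤-trans (ℚ.positive⁻¹ 1ℚ) 1≤g
    0≤τ : 0ℚ ≤ τ
    0≤τ = 0≤T-size d
    1≤τ : 1ℚ ≤ τ
    1≤τ = 1≤T-size d (ℕ.s≤s ℕ.z≤n)
    0≤c : 0ℚ ≤ c
    0≤c = 0≤⟨⟩ (maxFree em F G)
    0≤E₀ : 0ℚ ≤ E₀
    0≤E₀ = 0≤* (0≤* (0≤⟨⟩ ((2 ^ d) ^ (n ℕ.* n))) (0≤* (0≤+ 0≤c (0≤⟨⟩ (n ℕ.* n))) (0≤⟨⟩ (n ℕ.* n)))) 0≤ε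
    0≤A : 0ℚ ≤ A
    0≤A = 0≤+ (0≤relDensity em F G) (0≤+ (0≤+ 0≤E₀ (0≤* (0≤⟨⟩ n) (0≤* (0≤+ 0≤1 0≤1) (0≤inv k)))) (0≤* (0≤+ 0≤1 0≤1) 0≤ρ))

  -- By `∑≺-density` the total of density times `relative` is τ times the average of `relative` over
  -- a uniform level, which is what `tree-average` bounds; dividing by e(G) turns `maxFree em F G`
  -- into the relative density of G.
  density-bound : ∀ {n′} {G′ : OrderedGraph n′} (G′⊑R : G′ ⊑ R) → ¬ (F ⊑ G′) → ∑≺ d (ImageDensity.imageDensity G′⊑R reg) ≤ τ * A
  density-bound G′⊑R free = ℚ.≤-trans (ℚ.≤-reflexive (trans O.∑≺-relative (trans (∑≺-density d O.relative)
      (trans (cong (⟨ 2 ^ d′ ⟩ *_) (uniform-sum d′ (λ ℓ → lev d O.relative (Fin.toℕ ℓ)))) (trans (sym (ℚ.*-assoc ⟨ 2 ^ d′ ⟩ ⟨ d ⟩ ā))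
        (cong (_* ā) (trans (ℚ.*-comm ⟨ 2 ^ d′ ⟩ ⟨ d ⟩) (sym (⟨⟩-* d (2 ^ d′))))))))))
    (*-monoˡ 0≤τ (*-cancelˡ 0<g (ℚ.≤-trans averaged (≤-by ((g - 1ℚ) * E₀) (0≤* (0≤- 1≤g) 0≤E₀)
      (trans (cong (λ c → c + E₀ + g * ζ + g * ((1ℚ + 1ℚ) * ρ) + (g - 1ℚ) * E₀) (sym (relDensity-* em F G))) (collect (relDensity em F G) g E₀ ζ ρ))))))
    where
    module O = Outer em F G d M′ R 0≤ε reg εP≤1 G′⊑R free
    ā : ℚ
    ā = 𝔼 (uniform d′) (λ ℓ → lev d O.relative (Fin.toℕ ℓ))
    averaged : g * ā ≤ c + E₀ + g * ζ + g * ((1ℚ + 1ℚ) * ρ)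
    averaged = Tree.tree-average G k d′ C′ C≡ O.relative {1ℚ + 1ℚ} {c + E₀} {ρ} O.0≤relative O.relative≤2 (0≤+ 0≤1 0≤1) gap (O.chain-bound k)
    collect : ∀ r g e z p → r * g + e + g * z + g * ((1ℚ + 1ℚ) * p) + (g - 1ℚ) * e ≡ g * (r + (e + z + (1ℚ + 1ℚ) * p))
    collect = solve-∀ ring

  conclusion : relDensity em F R ≤ relDensity em F G + (ε * (chainErrorFactor d n c + (1ℚ + 1ℚ)) + (ζ + (1ℚ + 1ℚ) * ρ))
  conclusion = *-cancelˡ 0<τ (subst (_≤ τ * (relDensity em F G + (ε * (Q + (1ℚ + 1ℚ)) + (ζ + (1ℚ + 1ℚ) * ρ)))) (ℚ.*-comm (relDensity em F R) τ)
    (ℚ.≤-trans (Normalise.relDensity-≤ em F d M′ R 0≤ε reg J≤) (≤-by ((τ - 1ℚ) * ε) (0≤* (0≤- 1≤τ) 0≤ε) (collect (relDensity em F G) τ ε Q ζ ρ))))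
    where
    Q : ℚ
    Q = chainErrorFactor d n c
    0<τ : 0ℚ < τ
    0<τ = ℚ.<-≤-trans (ℚ.positive⁻¹ 1ℚ) 1≤τ
    0≤M² : 0ℚ ≤ ⟨ M ⟩ * ⟨ M ⟩
    0≤M² = 0≤* (0≤⟨⟩ M) (0≤⟨⟩ M)
    J≤ : ⟨ maxFree em F R ⟩ ≤ ⟨ M ⟩ * ⟨ M ⟩ * (τ * A + ε)
    J≤ = maxFree-≤-sup em F R (0≤* 0≤M² (0≤+ (0≤* 0≤τ 0≤A) 0≤ε)) (λ G′⊑R free →
      ℚ.≤-trans (ImageDensity.⟨e⟩-imageDensity G′⊑R reg) (*-monoˡ 0≤M² (ℚ.+-monoˡ-≤ ε (density-bound G′⊑R free))))
    collect : ∀ r t e q z p → t * (r + (q * e + z + (1ℚ + 1ℚ) * p)) + e + e * t + (t - 1ℚ) * e ≡ t * (r + (e * (q + (1ℚ + 1ℚ)) + (z + (1ℚ + 1ℚ) * p)))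
    collect = solve-∀ ring

inv≤1 : ∀ k → inv k ≤ 1ℚ
inv≤1 k = subst₂ _≤_ (ℚ.*-identityʳ (inv k)) (inv-* k) (*-monoˡ (0≤inv k) (1≤⟨⟩ (suc k) (ℕ.s≤s ℕ.z≤n)))

-- k and κ depend on G and ε only; then d is taken large against nK; finally the regularity depends
-- on d, through the factor (2^d)^(n²) and the requirement that it be at most 2^(-d).
relDensity-limit-≤ : ∀ (em : ExcludedMiddle 0ℓ) R → IsRFamily R → ∀ {κ₀} (F : OrderedGraph κ₀) {n} (G : OrderedGraph n) → 0 ℕ.< e G →
  ∀ {ε} → 0ℚ < ε → ∃[ d₀ ] ∀ d → d₀ ℕ.≤ d → ∃[ m₀ ] ∀ m → m₀ ℕ.≤ m → relDensity em F (R m d) ≤ relDensity em F G + ε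
relDensity-limit-≤ em R fam F {n} G 0<e {ε} 0<ε with small (0<½* (0<½* 0<ε)) (⟨ n ⟩ * (1ℚ + 1ℚ)) | small (0<½* (0<½* 0<ε)) (1ℚ + 1ℚ)
... | k , k≤ | κ , κ≤ = suc (suc κ ℕ.* nK) , deep
  where
  nK : ℕ
  nK = n ℕ.* Hide.K k
  deep : ∀ d → suc (suc κ ℕ.* nK) ℕ.≤ d → ∃[ m₀ ] ∀ m → m₀ ℕ.≤ m → relDensity em F (R m d) ≤ relDensity em F G + ε
  deep (suc d′) (ℕ.s≤s κnK≤d′) with small (0<½* 0<ε) (chainErrorFactor (suc d′) n ⟨ maxFree em F G ⟩ + (1ℚ + 1ℚ)) | small (ℚ.positive⁻¹ 1ℚ) ⟨ 2 ^ suc d′ ⟩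
  ... | k₂ , k₂≤ | k₃ , k₃≤ with regular-family R fam (suc d′) (ℕ.s≤s ℕ.z≤n) (0<* (0<inv k₂) (0<inv k₃))
  ... | m₁ , regs = suc m₁ , large
    where
    c Q : ℚ
    c = ⟨ maxFree em F G ⟩
    Q = chainErrorFactor (suc d′) n c
    nK≤d′ : nK ℕ.≤ d′
    nK≤d′ = ℕ.≤-trans (ℕ.m≤m+n nK (κ ℕ.* nK)) κnK≤d′
    C≡ : suc (d′ ∸ nK) ℕ.+ nK ≡ suc d′
    C≡ = cong suc (ℕ.m∸n+n≡m nK≤d′)
    gap : ⟨ nK ⟩ ≤ inv κ * ⟨ suc d′ ⟩
    gap = *-cancelˡ (0<⟨⟩ (suc κ)) (subst₂ _≤_ (⟨⟩-* (suc κ) nK) (trans (sym (ℚ.*-identityˡ ⟨ suc d′ ⟩))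
        (trans (cong (_* ⟨ suc d′ ⟩) (sym (inv-* κ))) (reorder (inv κ) ⟨ suc κ ⟩ ⟨ suc d′ ⟩)))
      (⟨⟩-mono (ℕ.≤-trans κnK≤d′ (ℕ.n≤1+n d′))))
      where
      reorder : ∀ a b c → a * b * c ≡ b * (a * c)
      reorder = solve-∀ ring
    0≤Q2 : 0ℚ ≤ Q + (1ℚ + 1ℚ)
    0≤Q2 = 0≤+ (0≤* (0≤⟨⟩ ((2 ^ suc d′) ^ (n ℕ.* n))) (0≤* (0≤+ (0≤⟨⟩ (maxFree em F G)) (0≤⟨⟩ (n ℕ.* n))) (0≤⟨⟩ (n ℕ.* n)))) (0≤+ 0≤1 0≤1)
    -- A product of two numbers in (0,1] is at most each of them, so both smallness requirements
    -- hold at once.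
    ε₂ : ℚ
    ε₂ = inv k₂ * inv k₃
    0≤ε₂ : 0ℚ ≤ ε₂
    0≤ε₂ = 0≤* (0≤inv k₂) (0≤inv k₃)
    ε₂≤₂ : ε₂ ≤ inv k₂
    ε₂≤₂ = subst (ε₂ ≤_) (ℚ.*-identityʳ (inv k₂)) (*-monoˡ (0≤inv k₂) (inv≤1 k₃))
    ε₂≤₃ : ε₂ ≤ inv k₃
    ε₂≤₃ = subst (ε₂ ≤_) (ℚ.*-identityˡ (inv k₃)) (*-monoʳ (0≤inv k₃) (inv≤1 k₂))
    large : ∀ m → suc m₁ ℕ.≤ m → relDensity em F (R m (suc d′)) ≤ relDensity em F G + ε
    large (suc M′) (ℕ.s≤s m₁≤) = ℚ.≤-trans
      (OuterStep.conclusion em F G 0<e d′ M′ k (d′ ∸ nK) C≡ {inv κ} (0≤inv κ) gap (R (suc M′) (suc d′)) {ε₂} 0≤ε₂ (regs M′ (ℕ.m≤n⇒m≤1+n m₁≤))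
        (ℚ.≤-trans (*-monoʳ (0≤⟨⟩ (2 ^ suc d′)) ε₂≤₃) k₃≤))
      (ℚ.+-monoʳ-≤ (relDensity em F G) (ℚ.≤-trans (ℚ.+-mono-≤ (ℚ.≤-trans (*-monoʳ 0≤Q2 ε₂≤₂) k₂≤)
        (ℚ.+-mono-≤ (ℚ.≤-trans (ℚ.≤-reflexive (reorder ⟨ n ⟩ (1ℚ + 1ℚ) (inv k))) k≤) (ℚ.≤-trans (ℚ.≤-reflexive (ℚ.*-comm (1ℚ + 1ℚ) (inv κ))) κ≤)))
        (ℚ.≤-reflexive (thirds {ε}))))
      where
      reorder : ∀ a b c → a * (b * c) ≡ c * (a * b)
      reorder = solve-∀ ring

-- Limits

-- If a value is not nearly minimal, there is another one smaller by more than ε. As all values lie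
-- in [0,1], this can be repeated only about 1/ε times.
near-minimum : ExcludedMiddle 0ℓ → {I : Set} (f : I → ℚ) → (∀ i → 0ℚ ≤ f i) → (∀ i → f i ≤ 1ℚ) → I →
  ∀ {ε} → 0ℚ < ε → ∃[ i ] ∀ j → f i ≤ f j + ε
near-minimum em f 0≤f f≤1 i₀ {ε} 0<ε with archimedean 0<ε
... | k , k≤ε = descend (suc k) i₀ (ℚ.≤-trans (f≤1 i₀) (subst (_≤ ⟨ suc k ⟩ * ε) (trans (ℚ.*-comm ⟨ suc k ⟩ (inv k)) (inv-* k)) (*-monoˡ (0≤⟨⟩ (suc k)) k≤ε)))
  where
  descend : ∀ n i → f i ≤ ⟨ n ⟩ * ε → ∃[ i ] ∀ j → f i ≤ f j + ε
  descend zero i fi≤ = i , λ j → ℚ.≤-trans fi≤ (subst (_≤ f j + ε) (sym (trans (cong (_* ε) ⟨0⟩) (ℚ.*-zeroˡ ε))) (0≤+ (0≤f j) (ℚ.<⇒≤ 0<ε)))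
  descend (suc n) i fi≤ with em {∃[ j ] f j + ε < f i}
  ... | yes (j , fj<) = descend n j (≤-from-- (subst (0ℚ ≤_) (trans (cong (λ x → x * ε - (f j + ε)) (⟨⟩-suc n)) (collect ⟨ n ⟩ ε (f j)))
      (0≤- (ℚ.≤-trans (ℚ.<⇒≤ fj<) fi≤))))
    where
    collect : ∀ n e f → (1ℚ + n) * e - (f + e) ≡ n * e - f
    collect = solve-∀ ring
  ... | no none = i , λ j → ℚ.≮⇒≥ (λ lt → none (j , lt))

module _ (em : ExcludedMiddle 0ℓ) (s : ℕ → ℚ) (0≤s : ∀ m → 0ℚ ≤ s m) (s≤1 : ∀ m → s m ≤ 1ℚ) where

  -- These cuts define a real before any convergence is known. Thus the inner limit has a name for
  -- every d, even for d = 0, where the family satisfies no condition.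
  liminf : ℝ
  liminf = record
    { lower = λ q → ∃[ r ] q < r × (∃[ N ] ∀ m → N ℕ.≤ m → r ≤ s m)
    ; upper = λ q → ∃[ r ] r < q × (∀ N → ∃[ m ] N ℕ.≤ m × s m ≤ r)
    ; lower-inhabited = - 1ℚ , 0ℚ , ℚ.negative⁻¹ (- 1ℚ) , 0 , λ m _ → 0≤s m
    ; upper-inhabited = 1ℚ + 1ℚ , 1ℚ , ℚ.+-monoʳ-< 1ℚ (ℚ.positive⁻¹ 1ℚ) , λ N → N , ℕ.≤-refl , s≤1 N
    ; lower-down = λ { q<q′ (r , q′<r , ev) → r , ℚ.<-trans q<q′ q′<r , ev }
    ; upper-up = λ { q<q′ (r , r<q , fr) → r , ℚ.<-trans r<q q<q′ , fr }
    ; lower-open = λ { (r , q<r , ev) → let t , q<t , t<r = ℚ.<-dense q<r in t , q<t , r , t<r , ev }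
    ; upper-open = λ { (r , r<q , fr) → let t , r<t , t<q = ℚ.<-dense r<q in t , t<q , r , r<t , fr }
    ; disjoint = λ { (r , q<r , N , ev) (r′ , r′<q , fr) → let m , N≤m , sm≤r′ = fr N in
        ℚ.<-irrefl refl (ℚ.<-≤-trans (ℚ.<-trans r′<q q<r) (ℚ.≤-trans (ev m N≤m) sm≤r′)) }
    ; located = loc
    }
    where
    loc : ∀ {q r} → q < r → (∃[ t ] q < t × (∃[ N ] ∀ m → N ℕ.≤ m → t ≤ s m)) ⊎ (∃[ t ] t < r × (∀ N → ∃[ m ] N ℕ.≤ m × s m ≤ t))
    loc q<r with ℚ.<-dense q<r
    ... | t , q<t , t<r with em {∃[ N ] ∀ m → N ℕ.≤ m → t ≤ s m}
    ...   | yes ev = inj₁ (t , q<t , ev)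
    ...   | no ¬ev = inj₂ (t , t<r , λ N → often N em)
      where
      often : ∀ N → Dec (∃[ m ] N ℕ.≤ m × s m ≤ t) → ∃[ m ] N ℕ.≤ m × s m ≤ t
      often N (yes found) = found
      often N (no none)   = ⊥-elim (¬ev (N , λ m N≤m → ℚ.≮⇒≥ (λ lt → none (m , N≤m , ℚ.<⇒≤ lt))))

-- The rational separating the cuts is placed 3ε/8 above a value. Approximations cost ε/8, and after
-- subtracting ε it still lies more than ε/8 below.
eighth : ℚ → ℚ
eighth ε = ½ * (½ * (½ * ε))

0<eighth : ∀ {ε} → 0ℚ < ε → 0ℚ < eighth ε
0<eighth 0<ε = 0<½* (0<½* (0<½* 0<ε))

<-by : ∀ {a b} x → 0ℚ < x → a + x ≡ b → a < b
<-by {a} x 0<x refl = subst (_< a + x) (ℚ.+-identityʳ a) (ℚ.+-monoʳ-< a 0<x)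

module _ {ε : ℚ} (0<ε : 0ℚ < ε) where
  private
    η : ℚ
    η = eighth ε
    0<η : 0ℚ < η
    0<η = 0<eighth 0<ε
    0≤η : 0ℚ ≤ η
    0≤η = ℚ.<⇒≤ 0<η

  <-+η : ∀ a → a < a + η
  <-+η a = <-by η 0<η refl

  below : ∀ {a b} → a ≤ b + η → a + (η + (η + η)) - ε < b - η
  below {a} {b} a≤ = ℚ.≤-<-trans (ℚ.+-monoˡ-≤ (- ε) (ℚ.+-monoˡ-≤ (η + (η + η)) a≤))
    (<-by (η + (η + η)) (ℚ.+-mono-<-≤ 0<η (0≤+ 0≤η 0≤η)) (collect b ε))
    where
    collect : ∀ b e → let h = ½ * (½ * (½ * e)) in b + h + (h + (h + h)) - e + (h + (h + h)) ≡ b - h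
    collect = solve-∀ ring

  below′ : ∀ a → a + (η + (η + η)) - ε < a
  below′ a = <-by (η + (η + η) + (η + η)) (ℚ.+-mono-<-≤ (ℚ.+-mono-<-≤ 0<η (0≤+ 0≤η 0≤η)) (0≤+ 0≤η 0≤η)) (collect a ε)
    where
    collect : ∀ b e → let h = ½ * (½ * (½ * e)) in b + (h + (h + h)) - e + (h + (h + h) + (h + h)) ≡ b
    collect = solve-∀ ring

  +3η : ∀ a → a < a + (η + (η + η))
  +3η a = <-by (η + (η + η)) (ℚ.+-mono-<-≤ 0<η (0≤+ 0≤η 0≤η)) refl

  +η<+3η : ∀ {a b} → a ≤ b + η → a + η < b + (η + (η + η))
  +η<+3η {a} {b} a≤ = ℚ.≤-<-trans (ℚ.+-monoˡ-≤ η a≤) (<-by η 0<η (collect b η))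
    where
    collect : ∀ b h → b + h + h + h ≡ b + (h + (h + h))
    collect = solve-∀ ring

  -η≤ : ∀ {a b} → a ≤ b + η → a - η ≤ b
  -η≤ {a} {b} a≤ = ℚ.≤-trans (ℚ.+-monoˡ-≤ (- η) a≤) (ℚ.≤-reflexive (cancel b η))
    where
    cancel : ∀ b h → b + h - h ≡ b
    cancel = solve-∀ ring

module _ (em : ExcludedMiddle 0ℓ) (s : ℕ → ℚ) (0≤s : ∀ m → 0ℚ ≤ s m) (s≤1 : ∀ m → s m ≤ 1ℚ) where

  private
    -- Both s n and the lower limit are within ε/8 of s m₁: no term from m₀ on is smaller by more
    -- than that, and no term from M₁ on is larger by more than that.
    limit-close : ∀ {ε} (0<ε : 0ℚ < ε) m₀ m₁ M₁ → (∀ m → m₀ ℕ.≤ m → s m₁ ≤ s m + eighth ε) → (∀ M → M₁ ℕ.≤ M → s M ≤ s m₁ + eighth ε) →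
      ∀ n → m₀ ℕ.≤ n → M₁ ℕ.≤ n → (fromℚ (s n) < liminf em s 0≤s s≤1 ⊕ ε) × (liminf em s 0≤s s≤1 < fromℚ (s n) ⊕ ε)
    limit-close {ε} 0<ε m₀ m₁ M₁ minimal bounded n m₀≤n M₁≤n = (q , s<q , lower-limit) , (q , upper-limit , below′ 0<ε (s n))
      where
      η q : ℚ
      η = eighth ε
      q = s n + (η + (η + η))
      s<q : s n < q
      s<q = +3η 0<ε (s n)
      lower-limit : ℝ.lower (liminf em s 0≤s s≤1) (q - ε)
      lower-limit = s m₁ - η , below 0<ε {s n} {s m₁} (bounded n M₁≤n) , m₀ , λ m m₀≤m → -η≤ 0<ε {s m₁} {s m} (minimal m m₀≤m)
      upper-limit : ℝ.upper (liminf em s 0≤s s≤1) q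
      upper-limit = s m₁ + η , +η<+3η 0<ε {s m₁} {s n} (minimal n m₀≤n) , λ N → N ℕ.⊔ M₁ , ℕ.m≤m⊔n N M₁ , bounded (N ℕ.⊔ M₁) (ℕ.m≤n⊔m N M₁)

  -- m₁ is a near minimum of the tail on which the almost-decrease is available; applying the
  -- almost-decrease at m₁ then bounds all late terms.
  liminf-limit : (∀ {ε} → 0ℚ < ε → ∃[ m₀ ] ∀ m → m₀ ℕ.≤ m → ∃[ M₀ ] ∀ M → M₀ ℕ.≤ M → s M ≤ s m + ε) →
    (λ m → fromℚ (s m)) ⟶ liminf em s 0≤s s≤1
  liminf-limit decr ε 0<ε = m₀ ℕ.⊔ proj₁ after , λ n le → limit-close 0<ε m₀ m₁ (proj₁ after)
      (λ m m₀≤m → proj₂ near (m , m₀≤m)) (proj₂ after) n (ℕ.≤-trans (ℕ.m≤m⊔n m₀ (proj₁ after)) le) (ℕ.≤-trans (ℕ.m≤n⊔m m₀ (proj₁ after)) le)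
    where
    decr-η : ∃[ m₀ ] ∀ m → m₀ ℕ.≤ m → ∃[ M₀ ] ∀ M → M₀ ℕ.≤ M → s M ≤ s m + eighth ε
    decr-η = decr (0<eighth 0<ε)
    m₀ : ℕ
    m₀ = proj₁ decr-η
    near : Σ (∃[ m ] m₀ ℕ.≤ m) λ i → ∀ (j : ∃[ m ] m₀ ℕ.≤ m) → s (proj₁ i) ≤ s (proj₁ j) + eighth ε
    near = near-minimum em {∃[ m ] m₀ ℕ.≤ m} (λ i → s (proj₁ i)) (λ i → 0≤s (proj₁ i)) (λ i → s≤1 (proj₁ i)) (m₀ , ℕ.≤-refl) (0<eighth 0<ε)
    m₁ : ℕ
    m₁ = proj₁ (proj₁ near)
    after : ∃[ M₁ ] ∀ M → M₁ ℕ.≤ M → s M ≤ s m₁ + eighth ε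
    after = proj₂ decr-η m₁ (proj₂ (proj₁ near))

-- Makes R(m,d) one of the graphs over which the infimum in `relTuránDensity` is taken.
eventually-has-edge : ∀ R → IsRFamily R → ∀ d → 1 ℕ.≤ d → ∃[ m₀ ] ∀ m → m₀ ℕ.≤ m → 0 ℕ.< e (R m d)
eventually-has-edge R fam d 1≤d = suc (proj₁ regs) , has
  where
  regs : ∃[ m₁ ] ∀ M′ → m₁ ℕ.≤ suc M′ → Regular d M′ (R (suc M′) d) ½
  regs = regular-family R fam d 1≤d (ℚ.positive⁻¹ ½)
  has : ∀ m → suc (proj₁ regs) ℕ.≤ m → 0 ℕ.< e (R m d)
  has (suc m′) (ℕ.s≤s m₁≤m′) = ℕ.≰⇒> (λ e≤0 → ℚ.<-irrefl refl (ℚ.<-≤-trans positive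
      (ℚ.≤-trans (Regular.size≥ (proj₂ regs m′ (ℕ.m≤n⇒m≤1+n m₁≤m′))) (subst (⟨ e (R (suc m′) d) ⟩ ≤_) ⟨0⟩ (⟨⟩-mono e≤0)))))
    where
    positive : 0ℚ < (1ℚ - ½) * (T-size d * (⟨ suc m′ ⟩ * ⟨ suc m′ ⟩))
    positive = 0<* (ℚ.positive⁻¹ (1ℚ - ½)) (0<* (ℚ.<-≤-trans (ℚ.positive⁻¹ 1ℚ) (1≤T-size d 1≤d)) (0<* (0<⟨⟩ (suc m′)) (0<⟨⟩ (suc m′))))

module _ (em : ExcludedMiddle 0ℓ) (R : (m d : ℕ) → OrderedGraph (2 ^ d ℕ.* m)) (fam : IsRFamily R) {k : ℕ} (F : OrderedGraph k) where

  private
    ρ : ℕ → ℕ → ℚ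
    ρ d m = relDensity em F (R m d)
    0≤ρ : ∀ d m → 0ℚ ≤ ρ d m
    0≤ρ d m = 0≤relDensity em F (R m d)
    ρ≤1 : ∀ d m → ρ d m ≤ 1ℚ
    ρ≤1 d m = relDensity≤1 em F (R m d)
    ρ-of : GraphWithEdge em → ℚ
    ρ-of (_ , G , _) = relDensity em F G
    some-graph : GraphWithEdge em
    some-graph = proj₁ (proj₂ (ℝ.upper-inhabited (relTuránDensity em F)))

  innerLimit : ℕ → ℝ
  innerLimit d = liminf em (ρ d) (0≤ρ d) (ρ≤1 d)

  private
    -- The graph i is nearly optimal. The inner limit is at most its density plus ε/8 by the
    -- averaging over copies, and at least its density minus ε/8 because the graphs `R m d` compete
    -- with i.
    outer-close : ∀ {ε} (0<ε : 0ℚ < ε) (i : GraphWithEdge em) → (∀ j → ρ-of i ≤ ρ-of j + eighth ε) → ∀ d →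
      ∃[ m₀ ] (∀ m → m₀ ℕ.≤ m → ρ d m ≤ ρ-of i + eighth ε) → ∃[ m₁ ] (∀ m → m₁ ℕ.≤ m → 0 ℕ.< e (R m d)) →
      (innerLimit d < relTuránDensity em F ⊕ ε) × (relTuránDensity em F < innerLimit d ⊕ ε)
    outer-close {ε} 0<ε i minimal d (m₀ , upper) (m₁ , has-edge) = (q , upper-inner , lower-ρ) , (q , upper-ρ , lower-inner)
      where
      η a q : ℚ
      η = eighth ε
      a = ρ-of i
      q = a + (η + (η + η))
      a≤a+η : a ≤ a + η
      a≤a+η = ℚ.<⇒≤ (<-+η 0<ε a)
      near : q - ε < a - η
      near = below 0<ε {a} {a} a≤a+η
      upper-inner : ℝ.upper (innerLimit d) q
      upper-inner = a + η , +η<+3η 0<ε {a} {a} a≤a+η , λ N → N ℕ.⊔ m₀ , ℕ.m≤m⊔n N m₀ , upper (N ℕ.⊔ m₀) (ℕ.m≤n⊔m N m₀)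
      lower-inner : ℝ.lower (innerLimit d) (q - ε)
      lower-inner = a - η , near , m₁ , λ m m₁≤m → -η≤ 0<ε {a} {ρ d m} (minimal (_ , R m d , has-edge m m₁≤m))
      upper-ρ : ℝ.upper (relTuránDensity em F) q
      upper-ρ = i , +3η 0<ε a
      lower-ρ : ℝ.lower (relTuránDensity em F) (q - ε)
      lower-ρ = a - η , near , λ j → -η≤ 0<ε {a} {ρ-of j} (minimal j)

  outer-limit : innerLimit ⟶ relTuránDensity em F
  -- The maximum with 1 is taken since the conditions on the family start at d = 1.
  outer-limit ε 0<ε = proj₁ deep ℕ.⊔ 1 , λ d le → outer-close 0<ε i (proj₂ near) d
      (proj₂ deep d (ℕ.≤-trans (ℕ.m≤m⊔n (proj₁ deep) 1) le)) (eventually-has-edge R fam d (ℕ.≤-trans (ℕ.m≤n⊔m (proj₁ deep) 1) le))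
    where
    near : Σ (GraphWithEdge em) λ i → ∀ j → ρ-of i ≤ ρ-of j + eighth ε
    near = near-minimum em ρ-of (λ (_ , G , _) → 0≤relDensity em F G) (λ (_ , G , _) → relDensity≤1 em F G) some-graph (0<eighth 0<ε)
    i : GraphWithEdge em
    i = proj₁ near
    deep : ∃[ d₀ ] ∀ d → d₀ ℕ.≤ d → ∃[ m₀ ] ∀ m → m₀ ℕ.≤ m → ρ d m ≤ ρ-of i + eighth ε
    deep = relDensity-limit-≤ em R fam F (proj₁ (proj₂ i)) (proj₂ (proj₂ i)) (0<eighth 0<ε)

  inner-limit : ∀ d → 1 ℕ.≤ d → (λ m → fromℚ (ρ d m)) ⟶ innerLimit d
  inner-limit d 1≤d = liminf-limit em (ρ d) (0≤ρ d) (ρ≤1 d) (almost-decreasing em R fam F d 1≤d)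

theorem1p1 : (em : ExcludedMiddle 0ℓ) →
    (R : (m d : ℕ) → OrderedGraph (2 ^ d ℕ.* m)) → IsRFamily R →
    (k : ℕ) (F : OrderedGraph k) →
    Σ (ℕ → ℝ) λ L →
    (∀ d → 1 ℕ.≤ d → (λ m → fromℚ (relDensity em F (R m d))) ⟶ L d) ×
    (L ⟶ relTuránDensity em F)
theorem1p1 em R fam k F = innerLimit em R fam F , inner-limit em R fam F , outer-limit em R fam F
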